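{- For every $n\ge1$, $$\mathrm{SH}_n(x)=\frac{1}{n+1}\sum_{\lambda} 2^{\ell(\lambda)}\,P_\lambda(1^{n+1})\,P_\lambda(x),$$ the sum over all partitions $\lambda$ of $n$ into distinct parts, where $\ell(\lambda)$ is the number of parts and $P_\lambda(1^{n+1})$ denotes $P_\lambda$ evaluated at $x_1=\cdots=x_{n+1}=1$, $x_i=0$ for $i>n+1$.
   Context: Work in the ring $\Lambda_{\mathbb Q}$ of symmetric functions with rational coefficients in variables $x=(x_1,x_2,\dots)$; $p_k$ denotes the power sum. For $f\in\Lambda_{\mathbb Q}$, its shiftification $f(x/x)$ is obtained by writing $f$ as a polynomial in the power sums and substituting $p_{2i+1}\mapsto 2p_{2i+1}$ and $p_{2i}\mapsto 0$ for all $i\ge1$. A parking function of length $n$ is a sequence $(a_1,\dots,a_n)$ of positive integers whose weakly increasing rearrangement $b_1\le\cdots\le b_n$ satisfies $b_i\le i$ for all $i$. The symmetric group $S_n$ acts on the set of parking functions of length $n$ by permuting coordinates; $\mathrm{PF}_n$ denotes the Frobenius characteristic of this permutation representation ($\mathrm{PF}_0=1$). Define $\mathrm{SH}_n(x)=\mathrm{PF}_n(x/x)$. For a partition $\lambda$ with distinct parts, $P_\lambda$ denotes Schur's $P$-function (as in Macdonald, Ch. III.8); in particular $1+2\sum_{n\ge1}P_n(x)t^n=\prod_i\frac{1+x_it}{1-x_it}$.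
   Formalization: Shiftification is taken to send p_k to 2p_k for every odd k including k = 1 (and p_k to 0 for even k); with p_1 left unchanged, as "i ≥ 1" literally says, the identity fails at n = 1 (p_1 versus 2p_1). -}

module Defs where

open import Algebra.Bundles using (CommutativeRing)
open import Data.Bool.Base using (if_then_else_)
open import Data.Fin.Base as Fin using (Fin; toℕ)
import Data.Fin.Properties as Fin
open import Data.Fin.Permutation as Perm using (Permutation′; _⟨$⟩ʳ_; _⟨$⟩ˡ_)
open import Data.Integer.Base using (+_)
open import Data.List.Base
  using (List; []; _∷_; _++_; map; concatMap; foldr; filter; length; allFin; upTo;
         iterate; cartesianProduct)
import Data.List.Membership.DecPropositional as DecMembership
open import Data.List.Relation.Unary.All using (all?)
open import Data.Nat.Base as ℕ using (ℕ; zero; suc; _∸_; _!; parity)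
import Data.Nat.Properties as ℕ
open import Data.List.Sort ℕ.≤-decTotalOrder using (sort)
open import Data.Parity.Base using (Parity; 0ℙ; 1ℙ)
open import Data.Product.Base using (_×_; _,_; proj₁; proj₂)
open import Data.Rational.Base as ℚ using (ℚ; 0ℚ; 1ℚ; _/_)
open import Data.Vec.Base as Vec using (Vec; []; _∷_)
import Data.Vec.Properties as Vec
open import Function.Base using (_∘_; const)
open import Level using (0ℓ)
open import Relation.Binary.Structures using (IsEquivalence)
open import Relation.Binary.PropositionalEquality.Core as ≡ using (_≡_)
open import Relation.Nullary using (does; yes; no; _→-dec_)
open import Relation.Unary using (Decidable)

------------------------------------------------------------------------
-- Polynomial rings

-- The polynomial ring ℚ[X] is the free commutative ℚ-algebra on X:
-- expressions modulo the congruence generated by the algebra axioms.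

infixl 6 _⊕_ _⊖_
infixl 7 _⊗_
infix  4 _≈_

data Poly (X : Set) : Set where
  con     : ℚ → Poly X
  var     : X → Poly X
  _⊕_ _⊗_ : Poly X → Poly X → Poly X

data _≈_ {X : Set} : Poly X → Poly X → Set where
  ≈-refl      : ∀ {f} → f ≈ f
  ≈-sym       : ∀ {f g} → f ≈ g → g ≈ f
  ≈-trans     : ∀ {f g h} → f ≈ g → g ≈ h → f ≈ h
  ⊕-cong      : ∀ {f f′ g g′} → f ≈ f′ → g ≈ g′ → f ⊕ g ≈ f′ ⊕ g′
  ⊗-cong      : ∀ {f f′ g g′} → f ≈ f′ → g ≈ g′ → f ⊗ g ≈ f′ ⊗ g′
  ⊕-assoc     : ∀ f g h → (f ⊕ g) ⊕ h ≈ f ⊕ (g ⊕ h)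
  ⊕-comm      : ∀ f g → f ⊕ g ≈ g ⊕ f
  ⊕-identityˡ : ∀ f → con 0ℚ ⊕ f ≈ f
  ⊗-assoc     : ∀ f g h → (f ⊗ g) ⊗ h ≈ f ⊗ (g ⊗ h)
  ⊗-comm      : ∀ f g → f ⊗ g ≈ g ⊗ f
  ⊗-identityˡ : ∀ f → con 1ℚ ⊗ f ≈ f
  ⊗-zeroˡ     : ∀ f → con 0ℚ ⊗ f ≈ con 0ℚ
  ⊗-distribˡ  : ∀ f g h → f ⊗ (g ⊕ h) ≈ (f ⊗ g) ⊕ (f ⊗ h)
  con-⊕       : ∀ a b → con (a ℚ.+ b) ≈ con a ⊕ con b
  con-⊗       : ∀ a b → con (a ℚ.* b) ≈ con a ⊗ con b

private
  variable
    A X Y : Set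
    N n   : ℕ

⊝_ : Poly X → Poly X
⊝ f = con (ℚ.- 1ℚ) ⊗ f

_⊖_ : Poly X → Poly X → Poly X
f ⊖ g = f ⊕ (⊝ g)

_^^_ : Poly X → ℕ → Poly X
f ^^ zero  = con 1ℚ
f ^^ suc k = f ⊗ (f ^^ k)

⊕-inverseʳ : (f : Poly X) → f ⊕ (⊝ f) ≈ con 0ℚ
⊕-inverseʳ f =
  ≈-trans (⊕-cong (≈-trans (≈-sym (⊗-identityˡ f)) (⊗-comm _ _)) (⊗-comm _ _))
  (≈-trans (≈-sym (⊗-distribˡ f _ _))
  (≈-trans (⊗-cong ≈-refl (≈-sym (con-⊕ 1ℚ (ℚ.- 1ℚ))))
  (≈-trans (⊗-comm _ _) (⊗-zeroˡ f))))

polyRing : Set → CommutativeRing 0ℓ 0ℓ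
polyRing X = record
  { Carrier = Poly X ; _≈_ = _≈_ ; _+_ = _⊕_ ; _*_ = _⊗_ ; -_ = ⊝_
  ; 0# = con 0ℚ ; 1# = con 1ℚ
  ; isCommutativeRing = record
    { isRing = record
      { +-isAbelianGroup = record
        { isGroup = record
          { isMonoid = record
            { isSemigroup = record
              { isMagma = record { isEquivalence = isEq ; ∙-cong = ⊕-cong }
              ; assoc = ⊕-assoc }
            ; identity = ⊕-identityˡ , λ f → ≈-trans (⊕-comm _ _) (⊕-identityˡ f) }
          ; inverse = (λ f → ≈-trans (⊕-comm _ _) (⊕-inverseʳ f)) , ⊕-inverseʳ
          ; ⁻¹-cong = ⊗-cong ≈-refl }
        ; comm = ⊕-comm }
      ; *-cong = ⊗-cong
      ; *-assoc = ⊗-assoc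
      ; *-identity = ⊗-identityˡ , λ f → ≈-trans (⊗-comm _ _) (⊗-identityˡ f)
      ; distrib = ⊗-distribˡ , λ f g h →
          ≈-trans (⊗-comm _ _) (≈-trans (⊗-distribˡ f g h) (⊕-cong (⊗-comm _ _) (⊗-comm _ _)))
      }
    ; *-comm = ⊗-comm } }
  where
  isEq : IsEquivalence (_≈_ {X})
  isEq = record { refl = ≈-refl ; sym = ≈-sym ; trans = ≈-trans }

Sum Prod : List A → (A → Poly X) → Poly X
Sum  as f = foldr (λ a s → f a ⊕ s) (con 0ℚ) as
Prod as f = foldr (λ a s → f a ⊗ s) (con 1ℚ) as

infix 5 Sum Prod
syntax Sum  as (λ a → f) = ∑[ a ∈ as ] f
syntax Prod as (λ a → f) = ∏[ a ∈ as ] f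

subst : (X → Poly Y) → Poly X → Poly Y
subst σ (con c) = con c
subst σ (var x) = σ x
subst σ (f ⊕ g) = subst σ f ⊕ subst σ g
subst σ (f ⊗ g) = subst σ f ⊗ subst σ g

evalℚ : (X → ℚ) → Poly X → ℚ
evalℚ ρ (con c) = c
evalℚ ρ (var x) = ρ x
evalℚ ρ (f ⊕ g) = evalℚ ρ f ℚ.+ evalℚ ρ g
evalℚ ρ (f ⊗ g) = evalℚ ρ f ℚ.* evalℚ ρ g

------------------------------------------------------------------------
-- Division by x_i − x_j

infix 8 _[_≔_]

_[_≔_] : Poly (Fin N) → Fin N → Fin N → Poly (Fin N)
f [ i ≔ j ] = subst (λ k → if does (k Fin.≟ i) then var j else var k) f

-- The quotient of f by x_i − x_j (i ≠ j); the remainder is f [ i ≔ j ],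
-- which vanishes when x_i − x_j divides f.

quo : Fin N → Fin N → Poly (Fin N) → Poly (Fin N)
quo i j (con c) = con 0ℚ
quo i j (var k) = if does (k Fin.≟ i) then con 1ℚ else con 0ℚ
quo i j (f ⊕ g) = quo i j f ⊕ quo i j g
quo i j (f ⊗ g) = quo i j f ⊗ g ⊕ f [ i ≔ j ] ⊗ quo i j g

quo-correct : (i j : Fin N) (f : Poly (Fin N)) →
              f ≈ f [ i ≔ j ] ⊕ (var i ⊖ var j) ⊗ quo i j f
quo-correct {N} i j = go
  where
  open CommutativeRing (polyRing (Fin N))
    using (setoid; +-identityʳ; +-identityˡ; *-identityʳ; zeroʳ; distribʳ;
           +-cong; +-congˡ; +-congʳ; *-congˡ; *-congʳ; +-assoc; +-comm; *-assoc; *-comm;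
           -‿inverseʳ)
  open import Relation.Binary.Reasoning.Setoid setoid
  d = var i ⊖ var j

  const-case : ∀ f → f ≈ f ⊕ d ⊗ con 0ℚ
  const-case f = ≈-sym (≈-trans (+-congˡ (zeroʳ d)) (+-identityʳ f))

  go : ∀ f → f ≈ f [ i ≔ j ] ⊕ d ⊗ quo i j f
  go (con c) = const-case (con c)
  go (var k) with k Fin.≟ i
  ... | no  _      = const-case (var k)
  ... | yes ≡.refl = begin
    var i                                ≈⟨ +-identityʳ _ ⟨
    var i ⊕ con 0ℚ                       ≈⟨ +-congˡ (-‿inverseʳ (var j)) ⟨
    var i ⊕ (var j ⊕ (⊝ var j))          ≈⟨ +-assoc _ _ _ ⟨
    (var i ⊕ var j) ⊕ (⊝ var j)          ≈⟨ +-congʳ (+-comm _ _) ⟩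
    (var j ⊕ var i) ⊕ (⊝ var j)          ≈⟨ +-assoc _ _ _ ⟩
    var j ⊕ d                            ≈⟨ +-congˡ (*-identityʳ d) ⟨
    var j ⊕ d ⊗ con 1ℚ                   ∎
  go (f ⊕ g) = begin
    f ⊕ g                                       ≈⟨ +-cong (go f) (go g) ⟩
    (f′ ⊕ d ⊗ q) ⊕ (g′ ⊕ d ⊗ r)                 ≈⟨ +-assoc _ _ _ ⟩
    f′ ⊕ (d ⊗ q ⊕ (g′ ⊕ d ⊗ r))                 ≈⟨ +-congˡ (+-assoc _ _ _) ⟨
    f′ ⊕ ((d ⊗ q ⊕ g′) ⊕ d ⊗ r)                 ≈⟨ +-congˡ (+-congʳ (+-comm _ _)) ⟩
    f′ ⊕ ((g′ ⊕ d ⊗ q) ⊕ d ⊗ r)                 ≈⟨ +-congˡ (+-assoc _ _ _) ⟩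
    f′ ⊕ (g′ ⊕ (d ⊗ q ⊕ d ⊗ r))                 ≈⟨ +-assoc _ _ _ ⟨
    (f′ ⊕ g′) ⊕ (d ⊗ q ⊕ d ⊗ r)                 ≈⟨ +-congˡ (⊗-distribˡ d q r) ⟨
    (f′ ⊕ g′) ⊕ d ⊗ (q ⊕ r)                     ∎
    where
    f′ = f [ i ≔ j ] ; g′ = g [ i ≔ j ] ; q = quo i j f ; r = quo i j g
  go (f ⊗ g) = begin
    f ⊗ g                                       ≈⟨ *-congʳ (go f) ⟩
    (f′ ⊕ d ⊗ q) ⊗ g                            ≈⟨ distribʳ g f′ (d ⊗ q) ⟩
    f′ ⊗ g ⊕ d ⊗ q ⊗ g                          ≈⟨ +-cong (*-congˡ (go g)) (*-assoc d q g) ⟩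
    f′ ⊗ (g′ ⊕ d ⊗ r) ⊕ d ⊗ (q ⊗ g)             ≈⟨ +-congʳ (⊗-distribˡ f′ g′ (d ⊗ r)) ⟩
    (f′ ⊗ g′ ⊕ f′ ⊗ (d ⊗ r)) ⊕ d ⊗ (q ⊗ g)      ≈⟨ +-congʳ (+-congˡ swap) ⟩
    (f′ ⊗ g′ ⊕ d ⊗ (f′ ⊗ r)) ⊕ d ⊗ (q ⊗ g)      ≈⟨ +-assoc _ _ _ ⟩
    f′ ⊗ g′ ⊕ (d ⊗ (f′ ⊗ r) ⊕ d ⊗ (q ⊗ g))      ≈⟨ +-congˡ (+-comm _ _) ⟩
    f′ ⊗ g′ ⊕ (d ⊗ (q ⊗ g) ⊕ d ⊗ (f′ ⊗ r))      ≈⟨ +-congˡ (⊗-distribˡ d _ _) ⟨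
    f′ ⊗ g′ ⊕ d ⊗ (q ⊗ g ⊕ f′ ⊗ r)              ∎
    where
    f′ = f [ i ≔ j ] ; g′ = g [ i ≔ j ] ; q = quo i j f ; r = quo i j g
    swap : f′ ⊗ (d ⊗ r) ≈ d ⊗ (f′ ⊗ r)
    swap = ≈-trans (≈-sym (*-assoc _ _ _)) (≈-trans (*-congʳ (*-comm _ _)) (*-assoc _ _ _))

------------------------------------------------------------------------
-- Symmetric functions

-- A symmetric function f is recorded by its specialisations
-- f(x_1,…,x_N) ∈ ℚ[x_1,…,x_N] for all N, which determine it.

SymFun : Set
SymFun = ∀ N → Poly (Fin N)

infix 4 _≈Λ_
_≈Λ_ : SymFun → SymFun → Set
f ≈Λ g = ∀ N → f N ≈ g N

infixr 7 _•_
_•_ : ℚ → SymFun → SymFun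
(c • f) N = con c ⊗ f N

SumΛ : List A → (A → SymFun) → SymFun
SumΛ as f N = ∑[ a ∈ as ] f a N

infix 5 SumΛ
syntax SumΛ as (λ a → f) = ∑Λ[ a ∈ as ] f

_at1^_ : SymFun → ℕ → ℚ
f at1^ m = evalℚ (const 1ℚ) (f m)

-- Λ_ℚ = ℚ[p_1,p_2,…]: the variable k stands for p_{k+1}.

PowerSumPoly : Set
PowerSumPoly = Poly ℕ

p : ℕ → PowerSumPoly
p k = var (k ∸ 1)

toSymFun : PowerSumPoly → SymFun
toSymFun f N = subst (λ k → ∑[ i ∈ allFin N ] var i ^^ suc k) f

-- f(x/x): p_k ↦ 2 p_k for k odd (including k = 1) and p_k ↦ 0 for k even.

shiftify : PowerSumPoly → PowerSumPoly
shiftify = subst (λ k → image k (parity (suc k)))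
  where
  image : ℕ → Parity → PowerSumPoly
  image k 1ℙ = con (+ 2 / 1) ⊗ var k
  image k 0ℙ = con 0ℚ

------------------------------------------------------------------------
-- The symmetric group and the Frobenius characteristic

-- w is determined by w(0) and by the order-preserving relabelling of its
-- restriction to the remaining points.

permutations : ∀ n → List (Permutation′ n)
permutations zero    = Perm.id ∷ []
permutations (suc n) =
  concatMap (λ i → map (Perm.insert Fin.zero i) (permutations n)) (allFin (suc n))

orbit : Permutation′ n → Fin n → List (Fin n)
orbit {n} w i = iterate (w ⟨$⟩ʳ_) i n

-- The list above repeats points when the cycle of i is shorter than n.

cycleLength : Permutation′ n → Fin n → ℕ
cycleLength {n} w i = length (filter (_∈? orbit w i) (allFin n))
  where open DecMembership (Fin._≟_ {n}) using (_∈?_)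

-- One length per cycle, each cycle being represented by its least element.

cycleType : Permutation′ n → List ℕ
cycleType {n} w =
  map (cycleLength w) (filter (λ i → all? (i Fin.≤?_) (orbit w i)) (allFin n))

frobenius : (Permutation′ n → ℚ) → PowerSumPoly
frobenius {n} χ =
  con ((+ 1 / (n !)) {{n ℕ.!≢0}}) ⊗
  (∑[ w ∈ permutations n ] con (χ w) ⊗ (∏[ k ∈ cycleType w ] p k))

------------------------------------------------------------------------
-- Parking functions

words : List A → ∀ n → List (Vec A n)
words as zero    = [] ∷ []
words as (suc n) = concatMap (λ a → map (a ∷_) (words as n)) as

-- b_i ≤ i for all i, where the first entry of the list is b_{k+1}.

data Bounded : ℕ → List ℕ → Set where
  []  : ∀ {k} → Bounded k []
  _∷_ : ∀ {k b bs} → b ℕ.≤ suc k → Bounded (suc k) bs → Bounded k (b ∷ bs)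

bounded? : ∀ k → Decidable (Bounded k)
bounded? k []       = yes []
bounded? k (b ∷ bs) with b ℕ.≤? suc k | bounded? (suc k) bs
... | yes q | yes qs = yes (q ∷ qs)
... | no ¬q | _      = no λ { (q ∷ _) → ¬q q }
... | _     | no ¬qs = no λ { (_ ∷ qs) → ¬qs qs }

-- For sequences of positive integers; positivity is built into the
-- enumeration below.

IsParkingFunction : Vec ℕ n → Set
IsParkingFunction a = Bounded 0 (sort (Vec.toList a))

isParkingFunction? : Decidable (IsParkingFunction {n})
isParkingFunction? a = bounded? 0 (sort (Vec.toList a))

-- b_i ≤ i ≤ n forces the entries to lie in {1,…,n}.

parkingFunctions : ∀ n → List (Vec ℕ n)
parkingFunctions n = filter isParkingFunction? (words (map suc (upTo n)) n)

infixr 8 _·_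
_·_ : Permutation′ n → Vec A n → Vec A n
w · a = Vec.tabulate (λ i → Vec.lookup a (w ⟨$⟩ˡ i))

-- The character of a permutation representation counts fixed points.

parkingCharacter : Permutation′ n → ℚ
parkingCharacter {n} w =
  + length (filter (λ a → Vec.≡-dec ℕ._≟_ (w · a) a) (parkingFunctions n)) / 1

PF : ℕ → PowerSumPoly
PF n = frobenius (parkingCharacter {n})

SH : ℕ → SymFun
SH n = toSymFun (shiftify (PF n))

------------------------------------------------------------------------
-- Partitions into distinct parts

-- boundedStrict m n: strictly decreasing lists of parts in {1,…,m} with sum n.

boundedStrict : ℕ → ℕ → List (List ℕ)
boundedStrict zero    zero    = [] ∷ []
boundedStrict zero    (suc n) = []
boundedStrict (suc m) n       =
  (if does (suc m ℕ.≤? n) then map (suc m ∷_) (boundedStrict m (n ∸ suc m)) else [])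
  ++ boundedStrict m n

strictPartitions : ℕ → List (List ℕ)
strictPartitions n = boundedStrict n n

part : List ℕ → ℕ → ℕ
part []      _       = 0
part (l ∷ μ) zero    = l
part (l ∷ μ) (suc i) = part μ i

------------------------------------------------------------------------
-- Hall–Littlewood polynomials and Schur's P-functions

pairs : ∀ N → List (Fin N × Fin N)
pairs N = filter (λ ij → proj₁ ij Fin.<? proj₂ ij) (cartesianProduct (allFin N) (allFin N))

-- The representatives w of the cosets S_N / S_N^λ that are increasing on
-- every block of equal parts of λ, trailing zeros included.

cosetRep? : (λs : Fin N → ℕ) → Decidable
  (λ (w : Permutation′ N) → ∀ i j → i Fin.< j → λs i ≡ λs j → w ⟨$⟩ʳ i Fin.< w ⟨$⟩ʳ j)
cosetRep? λs w = Fin.all? λ i → Fin.all? λ j →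
  (i Fin.<? j) →-dec ((λs i ℕ.≟ λs j) →-dec ((w ⟨$⟩ʳ i) Fin.<? (w ⟨$⟩ʳ j)))

sign : Permutation′ N → ℚ
sign {N} w = foldr (λ ij s → if does ((w ⟨$⟩ʳ proj₂ ij) Fin.<? (w ⟨$⟩ʳ proj₁ ij)) then ℚ.- s else s)
  1ℚ (pairs N)

-- For ℓ(λ) ≤ N,
--   P_λ(x_1,…,x_N; t) = ∑_{w ∈ S_N/S_N^λ} w( x^λ ∏_{λ_i>λ_j} (x_i − t x_j)/(x_i − x_j) ).
-- Putting everything over the common denominator Δ = ∏_{i<j} (x_i − x_j), for
-- which w(Δ) = sgn(w) Δ, this is hlNumerator / Δ.

hlNumerator : ℚ → List ℕ → SymFun
hlNumerator t μ N =
  ∑[ w ∈ filter (cosetRep? λs) (permutations N) ]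
    con (sign w)
    ⊗ (∏[ i ∈ allFin N ] var (w ⟨$⟩ʳ i) ^^ λs i)
    ⊗ (∏[ ij ∈ pairs N ] factor w (proj₁ ij) (proj₂ ij))
  where
  λs : Fin N → ℕ
  λs i = part μ (toℕ i)
  factor : Permutation′ N → Fin N → Fin N → Poly (Fin N)
  factor w i j = if does (λs j ℕ.<? λs i)
    then var (w ⟨$⟩ʳ i) ⊖ con t ⊗ var (w ⟨$⟩ʳ j)
    else var (w ⟨$⟩ʳ i) ⊖ var (w ⟨$⟩ʳ j)

divideByΔ : Poly (Fin N) → Poly (Fin N)
divideByΔ {N} f = foldr (λ ij g → quo (proj₁ ij) (proj₂ ij) g) f (pairs N)

hallLittlewoodP : ℚ → List ℕ → SymFun
hallLittlewoodP t μ N =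
  if does (length μ ℕ.≤? N) then divideByΔ (hlNumerator t μ N) else con 0ℚ

schurP : List ℕ → SymFun
schurP = hallLittlewoodP (ℚ.- 1ℚ)

{-# OPTIONS --safe #-}

-- By Pollak's cyclic shift, n + 1 times the number of parking functions fixed by w is
-- (n + 1)^c(w), where c(w) is the number of cycles of w. Hence (n + 1) SH_n(x) is the average over
-- w ∈ S_n of the product of (n + 1) p_k(x/x) over the cycles of w. Contracting one point of a
-- permutation at a time gives the recursion n E_n = Σ_k f_k E_{n-k} with f_k = (n + 1) p_k(x/x), so
-- this average is the coefficient of t^n in ∏_i ((1 + x_i t)/(1 − x_i t))^(n+1), the case y = 1^(n+1)
-- of the Cauchy kernel ∏_{i,j} (1 + x_i y_j t)/(1 − x_i y_j t).
--
-- The Cauchy identity for Schur's P-functions is proved from their symmetrisation formula. Put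
-- r(a,b) = (a + b)/(a − b). The terms of length l add up to 2^l/l! times the sum J_l over pairs of
-- l-tuples of distinct x's and y's, where removing a pair (x,y) contributes
-- ∏ r(x,x′) ∏ r(y,y′) xyt/(1 − xyt), the products being over the remaining variables. Adding a
-- variable w to the y's multiplies Σ_l 2^l/l! J_l by ∏_x (1 + xwt)/(1 − xwt): this follows from
-- partial fractions and from the antisymmetry of r, which makes the removal operators anticommute.
-- These computations take place in power series over the total ring of fractions of the polynomial
-- ring, where the differences of distinct variables are invertible.

module Submission where

open import Algebra.Bundles using (CommutativeRing)
open import Data.Bool.Base using (if_then_else_; true; false; Bool)
open import Data.Fin.Base as Fin using (Fin; zero; suc; toℕ; punchIn; _↑ˡ_; _↑ʳ_; splitAt)
import Data.Fin.Properties as Fin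
open import Data.Fin.Permutation as Perm using (Permutation′; _⟨$⟩ʳ_; _⟨$⟩ˡ_; _∘ₚ_)
open import Data.Integer.Base as ℤ using (ℤ; -[1+_])
import Data.Integer.Properties as ℤ
open import Data.List.Base
  using (List; []; _∷_; _++_; _ʳ++_; map; concatMap; foldr; length; allFin; tabulate; upTo; downFrom;
         filter; iterate; cartesianProduct)
import Data.List.Properties as List
open import Data.List.Membership.Propositional using (_∈_)
import Data.List.Membership.DecPropositional as DecMembership
open import Data.List.Relation.Binary.Permutation.Propositional as ↭ using (_↭_)
import Data.List.Relation.Binary.Permutation.Propositional.Properties as ↭
open import Data.List.Relation.Unary.All as All using (All; []; _∷_; all?)
import Data.List.Relation.Unary.All.Properties as All
open import Data.List.Relation.Unary.AllPairs using (AllPairs; []; _∷_)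
open import Data.List.Relation.Unary.Any using (here; there)
open import Data.List.Relation.Unary.Linked.Properties using (Linked⇒AllPairs)
open import Data.List.Relation.Unary.Unique.Propositional using (Unique)
import Data.List.Relation.Unary.Unique.Propositional.Properties as Unique
open import Data.Maybe.Base using (Maybe; just; nothing)
open import Data.Nat.Base as ℕ using (ℕ; zero; suc; _!)
open import Data.Nat.Induction using (<-rec)
import Data.Nat.Properties as ℕ
open import Data.List.Sort ℕ.≤-decTotalOrder using (sort; sort-↭; sort-↗)
open import Data.Parity.Base using (0ℙ; 1ℙ)
open import Data.Product.Base using (_×_; _,_; proj₁; proj₂; ∃; ∃₂)
open import Data.Rational.Base as ℚ using (ℚ; 0ℚ; 1ℚ; ½)
import Data.Rational.Properties as ℚ
import Data.Rational.Unnormalised.Base as ℚᵘ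
import Data.Rational.Unnormalised.Properties as ℚᵘ
open import Data.Sum.Base using (_⊎_; inj₁; inj₂; [_,_]′)
open import Data.Unit.Base using (⊤; tt)
open import Data.Vec.Base as Vec using (Vec; []; _∷_)
import Data.Vec.Properties as Vec
open import Data.Vec.Relation.Unary.All as VecAll using ([]; _∷_)
open import Function.Base using (_∘_; id; const)
open import Function.Bundles using (mk⇔; _⇔_; Equivalence)
open import Level using (0ℓ)
open import Relation.Binary.Definitions using (tri<; tri≈; tri>)
open import Relation.Binary.PropositionalEquality.Core as ≡ using (_≡_; _≢_)
open import Relation.Nullary using (Dec; yes; no; does; contradiction; ¬_; _→-dec_)
open import Relation.Nullary.Decidable using (dec-true; dec-false; does-⇔)
open import Relation.Unary using (Decidable)

-- Two obstacles shape the proof. The denominators y_i - y_j of the symmetrisation formula vanish at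
-- y = 1^(n+1). The Cauchy identity is therefore proved for independent y's, put into a form whose
-- two sides are polynomials (a sum over cycles against n! times the Schur expansion), pulled back
-- along the injection into fractions, and only then specialised. Moreover, equality of polynomials
-- is a congruence on expressions without normal forms. That x_i - x_j can be cancelled is read off
-- from the division algorithm, which respects the congruence and undoes multiplication by x_i -
-- x_j; inverting all cancellable elements then supplies the denominators. The weights c_l = 2^l/l!
-- are forced. Adjoining w produces (l + 1) c_(l+1) B_l, where B_l is a sum with one x matched to w,
-- while multiplying by the kernel of w produces 2 c_l B_l. The recursion (l + 1) c_(l+1) = 2 c_l
-- returns when words become strict partitions: there l + 1 counts the places of the largest letter,
-- and each part is left with a factor 2.

data Sel {A : Set} : A → List A → List A → Set where
  here  : ∀ {x xs} → Sel x xs (x ∷ xs)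
  there : ∀ {x y ys xs} → Sel y ys xs → Sel y (x ∷ ys) (x ∷ xs)

Sel-length : ∀ {A : Set} {y : A} {ys xs} → Sel y ys xs → length xs ≡ suc (length ys)
Sel-length here      = ≡.refl
Sel-length (there s) = ≡.cong suc (Sel-length s)

Sel-All : ∀ {A : Set} {P : A → Set} {y ys xs} → Sel y ys xs → All P xs → P y × All P ys
Sel-All here      (px ∷ pxs) = px , pxs
Sel-All (there s) (px ∷ pxs) with Sel-All s pxs
... | py , pys = py , px ∷ pys

Sel-AllPairs : ∀ {A : Set} {D : A → A → Set} → (∀ {x y} → D x y → D y x) →
               ∀ {y ys xs} → Sel y ys xs → AllPairs D xs → All (D y) ys × AllPairs D ys
Sel-AllPairs D-sym here      (px ∷ pxs) = px , pxs
Sel-AllPairs D-sym (there s) (px ∷ pxs)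
  with Sel-All s px | Sel-AllPairs D-sym s pxs
... | dy , dys | ey , eys = D-sym dy ∷ ey , dys ∷ eys

-- Ring solver and finite sums over an arbitrary commutative ring

module IntegerCoefficients (R : CommutativeRing 0ℓ 0ℓ) where
  open CommutativeRing R hiding (zero)
  open import Algebra.Properties.Ring ring
  open import Algebra.Properties.AbelianGroup +-abelianGroup using (⁻¹-∙-comm; ⁻¹-involutive; ε⁻¹≈ε)
  open import Algebra.Properties.Semiring.Mult.TCOptimised semiring
    using (1+×; ×-homo-+; ×1-homo-*) renaming (_×_ to _×ᴿ_)
  open import Relation.Binary.Reasoning.Setoid setoid
  open import Algebra.Solver.Ring.AlmostCommutativeRing

  private
    ⟦_⟧ : ℤ → Carrier
    ⟦ ℤ.+ n ⟧      = n ×ᴿ 1#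
    ⟦ -[1+ n ] ⟧ = - (suc n ×ᴿ 1#)

    cancel-1 : ∀ a b → (1# + a) - (1# + b) ≈ a - b
    cancel-1 a b = begin
      (1# + a) + - (1# + b)      ≈⟨ +-cong (+-comm _ _) (sym (⁻¹-∙-comm _ _)) ⟩
      (a + 1#) + (- 1# + - b)    ≈⟨ +-assoc _ _ _ ⟩
      a + (1# + (- 1# + - b))    ≈⟨ +-congˡ (sym (+-assoc _ _ _)) ⟩
      a + ((1# + - 1#) + - b)    ≈⟨ +-congˡ (+-congʳ (-‿inverseʳ _)) ⟩
      a + (0# + - b)             ≈⟨ +-congˡ (+-identityˡ _) ⟩
      a + - b                    ∎

    ⊖-homo : ∀ m n → ⟦ m ℤ.⊖ n ⟧ ≈ m ×ᴿ 1# - n ×ᴿ 1#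
    ⊖-homo zero    zero    = sym (trans (+-congˡ ε⁻¹≈ε) (+-identityʳ _))
    ⊖-homo zero    (suc n) = sym (+-identityˡ _)
    ⊖-homo (suc m) zero    = sym (trans (+-congˡ ε⁻¹≈ε) (+-identityʳ _))
    ⊖-homo (suc m) (suc n) = begin
      ⟦ suc m ℤ.⊖ suc n ⟧              ≡⟨ ≡.cong ⟦_⟧ (ℤ.[1+m]⊖[1+n]≡m⊖n m n) ⟩
      ⟦ m ℤ.⊖ n ⟧                      ≈⟨ ⊖-homo m n ⟩
      m ×ᴿ 1# - n ×ᴿ 1#                  ≈⟨ cancel-1 _ _ ⟨
      (1# + m ×ᴿ 1#) - (1# + n ×ᴿ 1#)    ≈⟨ +-cong (1+× m 1#) (-‿cong (1+× n 1#)) ⟨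
      suc m ×ᴿ 1# - suc n ×ᴿ 1#          ∎

    +-homo : ∀ i j → ⟦ i ℤ.+ j ⟧ ≈ ⟦ i ⟧ + ⟦ j ⟧
    +-homo (ℤ.+ m)    (ℤ.+ n)    = ×-homo-+ 1# m n
    +-homo (ℤ.+ m)    -[1+ n ] = ⊖-homo m (suc n)
    +-homo -[1+ m ] (ℤ.+ n)    = trans (⊖-homo n (suc m)) (+-comm _ _)
    +-homo -[1+ m ] -[1+ n ] = begin
      - (suc (suc (m ℕ.+ n)) ×ᴿ 1#)       ≈⟨ -‿cong (1+× (suc (m ℕ.+ n)) 1#) ⟩
      - (1# + suc (m ℕ.+ n) ×ᴿ 1#)        ≈⟨ -‿cong (+-congˡ (×-homo-+ 1# (suc m) n)) ⟩
      - (1# + (suc m ×ᴿ 1# + n ×ᴿ 1#))     ≈⟨ -‿cong (trans (sym (+-assoc _ _ _)) (trans (+-congʳ (+-comm _ _))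
          (+-assoc _ _ _))) ⟩
      - (suc m ×ᴿ 1# + (1# + n ×ᴿ 1#))     ≈⟨ -‿cong (+-congˡ (1+× n 1#)) ⟨
      - (suc m ×ᴿ 1# + suc n ×ᴿ 1#)        ≈⟨ ⁻¹-∙-comm _ _ ⟨
      - (suc m ×ᴿ 1#) + - (suc n ×ᴿ 1#)    ∎

    -‿homo : ∀ i → ⟦ ℤ.- i ⟧ ≈ - ⟦ i ⟧
    -‿homo (ℤ.+ zero)  = sym ε⁻¹≈ε
    -‿homo (ℤ.+ suc n) = refl
    -‿homo -[1+ n ]  = sym (⁻¹-involutive _)

    *-homo⁺ : ∀ m n → ⟦ ℤ.+ m ℤ.* ℤ.+ n ⟧ ≈ ⟦ ℤ.+ m ⟧ * ⟦ ℤ.+ n ⟧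
    *-homo⁺ m n = trans (reflexive (≡.cong ⟦_⟧ (≡.sym (ℤ.pos-* m n)))) (×1-homo-* m n)

    *-homo : ∀ i j → ⟦ i ℤ.* j ⟧ ≈ ⟦ i ⟧ * ⟦ j ⟧
    *-homo (ℤ.+ m)    (ℤ.+ n)    = *-homo⁺ m n
    *-homo (ℤ.+ m)    -[1+ n ] = begin
      ⟦ ℤ.+ m ℤ.* -[1+ n ] ⟧            ≡⟨ ≡.cong ⟦_⟧ (≡.sym (ℤ.neg-distribʳ-* (ℤ.+ m) (ℤ.+ suc n))) ⟩
      ⟦ ℤ.- (ℤ.+ m ℤ.* ℤ.+ suc n) ⟧       ≈⟨ trans (-‿homo (ℤ.+ m ℤ.* ℤ.+ suc n)) (-‿cong (*-homo⁺ m (suc n))) ⟩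
      - (m ×ᴿ 1# * suc n ×ᴿ 1#)         ≈⟨ -‿distribʳ-* _ _ ⟩
      m ×ᴿ 1# * - (suc n ×ᴿ 1#)         ∎
    *-homo -[1+ m ] (ℤ.+ n)    = begin
      ⟦ -[1+ m ] ℤ.* ℤ.+ n ⟧            ≡⟨ ≡.cong ⟦_⟧ (≡.sym (ℤ.neg-distribˡ-* (ℤ.+ suc m) (ℤ.+ n))) ⟩
      ⟦ ℤ.- (ℤ.+ suc m ℤ.* ℤ.+ n) ⟧       ≈⟨ trans (-‿homo (ℤ.+ suc m ℤ.* ℤ.+ n)) (-‿cong (*-homo⁺ (suc m) n)) ⟩
      - (suc m ×ᴿ 1# * n ×ᴿ 1#)         ≈⟨ -‿distribˡ-* _ _ ⟩
      - (suc m ×ᴿ 1#) * n ×ᴿ 1#         ∎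
    *-homo -[1+ m ] -[1+ n ] = begin
      ⟦ ℤ.+ suc m ℤ.* ℤ.+ suc n ⟧           ≈⟨ *-homo⁺ (suc m) (suc n) ⟩
      suc m ×ᴿ 1# * suc n ×ᴿ 1#           ≈⟨ ⁻¹-involutive _ ⟨
      - - (suc m ×ᴿ 1# * suc n ×ᴿ 1#)     ≈⟨ -‿cong (-‿distribˡ-* _ _) ⟩
      - (- (suc m ×ᴿ 1#) * suc n ×ᴿ 1#)   ≈⟨ -‿distribʳ-* _ _ ⟩
      - (suc m ×ᴿ 1#) * - (suc n ×ᴿ 1#)   ∎

    morphism : ℤ.+-*-rawRing -Raw-AlmostCommutative⟶ fromCommutativeRing R
    morphism = record
      { ⟦_⟧ = ⟦_⟧ ; +-homo = +-homo ; *-homo = *-homo ; -‿homo = -‿homo ; 0-homo = refl ; 1-homo = refl }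

    -- Equality in `R` need not be decidable; deciding it for integer coefficients is what lets the
    -- solver cancel terms.
    coeff≟ : ∀ i j → Maybe (⟦ i ⟧ ≈ ⟦ j ⟧)
    coeff≟ i j with i ℤ.≟ j
    ... | yes i≡j = just (reflexive (≡.cong ⟦_⟧ i≡j))
    ... | no  _   = nothing

  open import Algebra.Solver.Ring ℤ.+-*-rawRing (fromCommutativeRing R) morphism coeff≟ public
    using (solve; _:=_; _:+_; _:*_; _:-_; :-_)
  open import Algebra.Solver.Ring ℤ.+-*-rawRing (fromCommutativeRing R) morphism coeff≟
    using (Polynomial; con)

  :0 :1 :2 : ∀ {n} → Polynomial n
  :0 = con (ℤ.+ 0)
  :1 = con (ℤ.+ 1)
  :2 = con (ℤ.+ 2)

module Sums (R : CommutativeRing 0ℓ 0ℓ) where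
  open CommutativeRing R hiding (zero)
  open import Algebra.Properties.AbelianGroup +-abelianGroup using (⁻¹-∙-comm; ε⁻¹≈ε)
  open import Algebra.Properties.CommutativeSemigroup +-commutativeSemigroup using (interchange)
  open import Algebra.Properties.CommutativeSemigroup *-commutativeSemigroup
    using () renaming (interchange to *-interchange; x∙yz≈y∙xz to *-swap)
  open import Relation.Binary.Reasoning.Setoid setoid

  private variable A B : Set

  infixr 8 _^_
  _^_ : Carrier → ℕ → Carrier
  x ^ zero  = 1#
  x ^ suc n = x * x ^ n

  fromℕ : ℕ → Carrier
  fromℕ zero    = 0#
  fromℕ (suc n) = 1# + fromℕ n

  fromℕ-+ : ∀ m n → fromℕ (m ℕ.+ n) ≈ fromℕ m + fromℕ n
  fromℕ-+ zero    n = sym (+-identityˡ _)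
  fromℕ-+ (suc m) n = trans (+-congˡ (fromℕ-+ m n)) (sym (+-assoc _ _ _))

  fromℕ-* : ∀ m n → fromℕ (m ℕ.* n) ≈ fromℕ m * fromℕ n
  fromℕ-* zero    n = sym (zeroˡ _)
  fromℕ-* (suc m) n = trans (fromℕ-+ n (m ℕ.* n))
    (trans (+-cong (sym (*-identityˡ _)) (fromℕ-* m n)) (sym (distribʳ _ _ _)))

  ^-cong : ∀ {x y} n → x ≈ y → x ^ n ≈ y ^ n
  ^-cong zero    e = refl
  ^-cong (suc n) e = *-cong e (^-cong n e)

  *-^ : ∀ x y n → (x * y) ^ n ≈ x ^ n * y ^ n
  *-^ x y zero    = sym (*-identityˡ _)
  *-^ x y (suc n) = trans (*-congˡ (*-^ x y n)) (*-interchange _ _ _ _)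

  ΣL ΠL : List A → (A → Carrier) → Carrier
  ΣL as f = foldr (λ a s → f a + s) 0# as
  ΠL as f = foldr (λ a s → f a * s) 1# as

  ΣL-cong : ∀ (as : List A) {f g} → (∀ a → f a ≈ g a) → ΣL as f ≈ ΣL as g
  ΣL-cong []       e = refl
  ΣL-cong (a ∷ as) e = +-cong (e a) (ΣL-cong as e)

  ΣL-congᴬ : ∀ {P : A → Set} {as : List A} {f g} → All P as → (∀ a → P a → f a ≈ g a) → ΣL as f ≈ ΣL as g
  ΣL-congᴬ []         e = refl
  ΣL-congᴬ (pa ∷ pas) e = +-cong (e _ pa) (ΣL-congᴬ pas e)

  ΠL-cong : ∀ (as : List A) {f g} → (∀ a → f a ≈ g a) → ΠL as f ≈ ΠL as g
  ΠL-cong []       e = refl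
  ΠL-cong (a ∷ as) e = *-cong (e a) (ΠL-cong as e)

  ΠL-congᴬ : ∀ {P : A → Set} {as : List A} {f g} → All P as → (∀ a → P a → f a ≈ g a) → ΠL as f ≈ ΠL as g
  ΠL-congᴬ []         e = refl
  ΠL-congᴬ (pa ∷ pas) e = *-cong (e _ pa) (ΠL-congᴬ pas e)

  ΣL-0 : ∀ (as : List A) → ΣL as (λ _ → 0#) ≈ 0#
  ΣL-0 []       = refl
  ΣL-0 (a ∷ as) = trans (+-identityˡ _) (ΣL-0 as)

  ΣL-++ : ∀ (as bs : List A) f → ΣL (as ++ bs) f ≈ ΣL as f + ΣL bs f
  ΣL-++ []       bs f = sym (+-identityˡ _)
  ΣL-++ (a ∷ as) bs f = trans (+-congˡ (ΣL-++ as bs f)) (sym (+-assoc _ _ _))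

  ΣL-map : ∀ (h : A → B) as f → ΣL (map h as) f ≡ ΣL as (f ∘ h)
  ΣL-map h []       f = ≡.refl
  ΣL-map h (a ∷ as) f = ≡.cong (f (h a) +_) (ΣL-map h as f)

  ΠL-map : ∀ (h : A → B) as f → ΠL (map h as) f ≡ ΠL as (f ∘ h)
  ΠL-map h []       f = ≡.refl
  ΠL-map h (a ∷ as) f = ≡.cong (f (h a) *_) (ΠL-map h as f)

  ΠL-++ : ∀ (as bs : List A) f → ΠL (as ++ bs) f ≈ ΠL as f * ΠL bs f
  ΠL-++ []       bs f = sym (*-identityˡ _)
  ΠL-++ (a ∷ as) bs f = trans (*-congˡ (ΠL-++ as bs f)) (sym (*-assoc _ _ _))

  ΣL-concatMap : ∀ (h : A → List B) as f → ΣL (concatMap h as) f ≈ ΣL as (λ a → ΣL (h a) f)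
  ΣL-concatMap h []       f = refl
  ΣL-concatMap h (a ∷ as) f = trans (ΣL-++ (h a) _ f) (+-congˡ (ΣL-concatMap h as f))

  ΣL-+ : ∀ (as : List A) f g → ΣL as (λ a → f a + g a) ≈ ΣL as f + ΣL as g
  ΣL-+ []       f g = sym (+-identityˡ _)
  ΣL-+ (a ∷ as) f g = trans (+-congˡ (ΣL-+ as f g)) (interchange _ _ _ _)

  ΠL-* : ∀ (as : List A) f g → ΠL as (λ a → f a * g a) ≈ ΠL as f * ΠL as g
  ΠL-* []       f g = sym (*-identityˡ _)
  ΠL-* (a ∷ as) f g = trans (*-congˡ (ΠL-* as f g)) (*-interchange _ _ _ _)

  ΠL-1 : ∀ (as : List A) → ΠL as (λ _ → 1#) ≈ 1#
  ΠL-1 []       = refl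
  ΠL-1 (a ∷ as) = trans (*-identityˡ _) (ΠL-1 as)

  ΣL-*ˡ : ∀ c (as : List A) f → c * ΣL as f ≈ ΣL as (λ a → c * f a)
  ΣL-*ˡ c []       f = zeroʳ c
  ΣL-*ˡ c (a ∷ as) f = trans (distribˡ _ _ _) (+-congˡ (ΣL-*ˡ c as f))

  ΣL-*ʳ : ∀ c (as : List A) f → ΣL as f * c ≈ ΣL as (λ a → f a * c)
  ΣL-*ʳ c []       f = zeroˡ c
  ΣL-*ʳ c (a ∷ as) f = trans (distribʳ _ _ _) (+-congˡ (ΣL-*ʳ c as f))

  ΣL-swap : ∀ (as : List A) (bs : List B) (f : A → B → Carrier) →
            ΣL as (λ a → ΣL bs (f a)) ≈ ΣL bs (λ b → ΣL as (λ a → f a b))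
  ΣL-swap []       bs f = sym (ΣL-0 bs)
  ΣL-swap (a ∷ as) bs f = trans (+-congˡ (ΣL-swap as bs f)) (sym (ΣL-+ bs (f a) _))

  allFin-suc : ∀ n → allFin (suc n) ≡ zero ∷ map suc (allFin n)
  allFin-suc n = ≡.cong (zero ∷_) (≡.sym (List.map-tabulate id suc))

  ΣFin-suc : ∀ {n} (f : Fin (suc n) → Carrier) → ΣL (allFin (suc n)) f ≡ f zero + ΣL (allFin n) (f ∘ suc)
  ΣFin-suc {n} f = ≡.trans (≡.cong (λ as → ΣL as f) (allFin-suc n)) (≡.cong (f zero +_) (ΣL-map suc (allFin n) f))

  ΠFin-suc : ∀ {n} (f : Fin (suc n) → Carrier) → ΠL (allFin (suc n)) f ≡ f zero * ΠL (allFin n) (f ∘ suc)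
  ΠFin-suc {n} f = ≡.trans (≡.cong (λ as → ΠL as f) (allFin-suc n)) (≡.cong (f zero *_) (ΠL-map suc (allFin n) f))

  -- The sum runs over positions, and the remaining list keeps its order. Nesting it l times
  -- therefore sums over l-tuples of distinct positions.
  ΣS : List A → (A → List A → Carrier) → Carrier
  ΣS []       f = 0#
  ΣS (x ∷ xs) f = f x xs + ΣS xs (λ y ys → f y (x ∷ ys))

  ΣS-cong : ∀ (xs : List A) {f g} → (∀ y ys → Sel y ys xs → f y ys ≈ g y ys) → ΣS xs f ≈ ΣS xs g
  ΣS-cong []       e = refl
  ΣS-cong (x ∷ xs) e = +-cong (e x xs here) (ΣS-cong xs (λ y ys s → e y (x ∷ ys) (there s)))

  ΣS-+ : ∀ (xs : List A) f g → ΣS xs (λ y ys → f y ys + g y ys) ≈ ΣS xs f + ΣS xs g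
  ΣS-+ []       f g = sym (+-identityˡ _)
  ΣS-+ (x ∷ xs) f g = trans (+-congˡ (ΣS-+ xs _ _)) (interchange _ _ _ _)

  ΣS-*ˡ : ∀ c (xs : List A) f → c * ΣS xs f ≈ ΣS xs (λ y ys → c * f y ys)
  ΣS-*ˡ c []       f = zeroʳ c
  ΣS-*ˡ c (x ∷ xs) f = trans (distribˡ _ _ _) (+-congˡ (ΣS-*ˡ c xs _))

  ΣS-0 : ∀ (xs : List A) → ΣS xs (λ _ _ → 0#) ≈ 0#
  ΣS-0 []       = refl
  ΣS-0 (x ∷ xs) = trans (+-identityˡ _) (ΣS-0 xs)

  ΣS-neg : ∀ (xs : List A) f → ΣS xs (λ y ys → - f y ys) ≈ - ΣS xs f
  ΣS-neg []       f = sym ε⁻¹≈ε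
  ΣS-neg (x ∷ xs) f = trans (+-congˡ (ΣS-neg xs _)) (⁻¹-∙-comm _ _)

  ΣS-ΣL : ∀ (xs : List A) (bs : List B) (f : A → List A → B → Carrier) →
          ΣS xs (λ x xs′ → ΣL bs (f x xs′)) ≈ ΣL bs (λ b → ΣS xs (λ x xs′ → f x xs′ b))
  ΣS-ΣL []       bs f = sym (ΣL-0 bs)
  ΣS-ΣL (x ∷ xs) bs f = trans (+-congˡ (ΣS-ΣL xs bs _)) (sym (ΣL-+ bs _ _))

  ΣS-comm : ∀ (xs : List A) (ys : List B) (f : A → List A → B → List B → Carrier) →
            ΣS xs (λ x xs′ → ΣS ys (λ y ys′ → f x xs′ y ys′)) ≈ ΣS ys (λ y ys′ → ΣS xs (λ x xs′ → f x xs′ y ys′))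
  ΣS-comm []       ys f = sym (ΣS-0 ys)
  ΣS-comm (x ∷ xs) ys f = trans (+-congˡ (ΣS-comm xs ys _)) (sym (ΣS-+ ys _ _))

  -- Both sides run over ordered pairs of distinct positions, and the list left after two removals
  -- does not depend on their order.
  ΣS-twice : ∀ (xs : List A) (f : A → A → List A → Carrier) →
             ΣS xs (λ x xs′ → ΣS xs′ (λ x′ xs″ → f x x′ xs″)) ≈ ΣS xs (λ x xs′ → ΣS xs′ (λ x′ xs″ → f x′ x xs″))
  ΣS-twice []       f = refl
  ΣS-twice (a ∷ as) f = begin
    P + ΣS as (λ x as′ → f x a as′ + ΣS as′ (λ x′ xs″ → f x x′ (a ∷ xs″)))
      ≈⟨ +-congˡ (ΣS-+ as _ _) ⟩
    P + (Q + ΣS as (λ x as′ → ΣS as′ (λ x′ xs″ → f x x′ (a ∷ xs″))))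
      ≈⟨ +-assoc _ _ _ ⟨
    (P + Q) + ΣS as (λ x as′ → ΣS as′ (λ x′ xs″ → f x x′ (a ∷ xs″)))
      ≈⟨ +-cong (+-comm _ _) (ΣS-twice as _) ⟩
    (Q + P) + ΣS as (λ x as′ → ΣS as′ (λ x′ xs″ → f x′ x (a ∷ xs″)))
      ≈⟨ +-assoc _ _ _ ⟩
    Q + (P + ΣS as (λ x as′ → ΣS as′ (λ x′ xs″ → f x′ x (a ∷ xs″))))
      ≈⟨ +-congˡ (ΣS-+ as _ _) ⟨
    Q + ΣS as (λ x as′ → f a x as′ + ΣS as′ (λ x′ xs″ → f x′ x (a ∷ xs″))) ∎
    where
    P = ΣS as (λ x as′ → f a x as′)
    Q = ΣS as (λ x as′ → f x a as′)

  ΠL-Sel : ∀ {y : A} {ys xs} (f : A → Carrier) → Sel y ys xs → ΠL xs f ≈ f y * ΠL ys f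
  ΠL-Sel f here      = refl
  ΠL-Sel f (there s) = trans (*-congˡ (ΠL-Sel f s)) (*-swap _ _ _)

-- Partial fractions and the operators that remove variables

module Removals (R : CommutativeRing 0ℓ 0ℓ) where
  open CommutativeRing R hiding (zero)
  open Sums R
  open IntegerCoefficients R
  open import Relation.Binary.Reasoning.Setoid setoid

  ΣS-twice-anti : ∀ {A : Set} (xs : List A) {φ ψ : A → A → List A → Carrier} →
                  (∀ x x′ zs → φ x x′ zs ≈ - ψ x′ x zs) →
                  ΣS xs (λ x xs′ → ΣS xs′ (φ x)) ≈ - ΣS xs (λ x xs′ → ΣS xs′ (ψ x))
  ΣS-twice-anti xs {φ} {ψ} e = begin
    ΣS xs (λ x xs′ → ΣS xs′ (φ x))                     ≈⟨ ΣS-cong xs (λ x xs′ _ → ΣS-cong xs′ (λ x′ zs _ → e x x′ zs)) ⟩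
    ΣS xs (λ x xs′ → ΣS xs′ (λ x′ zs → - ψ x′ x zs))   ≈⟨ ΣS-cong xs (λ x xs′ _ → ΣS-neg xs′ _) ⟩
    ΣS xs (λ x xs′ → - ΣS xs′ (λ x′ zs → ψ x′ x zs))   ≈⟨ ΣS-neg xs _ ⟩
    - ΣS xs (λ x xs′ → ΣS xs′ (λ x′ zs → ψ x′ x zs))   ≈⟨ -‿cong (ΣS-twice xs ψ) ⟨
    - ΣS xs (λ x xs′ → ΣS xs′ (ψ x))                   ∎

  -- For r(a,b) = (a + b)/(a - b) and c x = r(x,z) this is the partial fraction expansion of ∏ (z +
  -- x)/(z - x) in z: the value at infinity is 1, and `1# + c x` is the polar part 2x/(x - z). The
  -- last hypothesis is the three-term relation with z as third point, so z itself may lie outside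
  -- the ring, as the reciprocal of a variable does.
  partialFractions : ∀ {A : Set} (r : A → A → Carrier) (D : A → A → Set) →
    (∀ x y → r x y ≈ - r y x) → (∀ {x y} → D x y → D y x) →
    (∀ {y a b} → D y a → D y b → D a b → r y a * r y b ≈ 1# + r a b * (r y a - r y b)) →
    ∀ (P : A → Set) (c : A → Carrier) →
    (∀ {y a} → P y → P a → D y a → r y a * c y ≈ 1# + c a * (r y a - c y)) →
    ∀ xs → All P xs → AllPairs D xs →
    ΠL xs (λ x → - c x) + ΣS xs (λ x xs′ → ΠL xs′ (r x) * (1# + c x)) ≈ 1#
  partialFractions {A} r D r-anti D-sym three = go
    where
    go : ∀ (P : A → Set) (c : A → Carrier) →
         (∀ {y a} → P y → P a → D y a → r y a * c y ≈ 1# + c a * (r y a - c y)) →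
         ∀ xs → All P xs → AllPairs D xs →
         ΠL xs (λ x → - c x) + ΣS xs (λ x xs′ → ΠL xs′ (r x) * (1# + c x)) ≈ 1#
    go P c h []       _          _          = +-identityʳ 1#
    go P c h (a ∷ xs) (Pa ∷ Pxs) (Da ∷ Dxs) = begin
      - c a * X + (V * (1# + c a) + ΣS xs (λ y ys → (r y a * ΠL ys (r y)) * (1# + c y)))
        ≈⟨ +-congˡ (+-congˡ (ΣS-cong xs (λ y ys s → term y ys (proj₁ (Sel-All s Pxs)) (proj₁ (Sel-All s Da))))) ⟩
      - c a * X + (V * (1# + c a) + ΣS xs (λ y ys → (1# + c a) * (ΠL ys (r y) * (1# + r y a)) + (- c a) * (ΠL ys (r y) *
          (1# + c y))))
        ≈⟨ +-congˡ (+-congˡ (trans (ΣS-+ xs _ _) (+-cong (sym (ΣS-*ˡ _ xs _)) (sym (ΣS-*ˡ _ xs _))))) ⟩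
      - c a * X + (V * (1# + c a) + ((1# + c a) * Y + (- c a) * Z))
        ≈⟨ solve 5 (λ c X V Y Z → (:- c) :* X :+ (V :* (:1 :+ c) :+ ((:1 :+ c) :* Y :+ (:- c) :* Z))
             := (:1 :+ c) :* (V :+ Y) :+ (:- c) :* (X :+ Z)) refl (c a) X V Y Z ⟩
      (1# + c a) * (V + Y) + (- c a) * (X + Z)
        ≈⟨ +-cong (*-congˡ IH₂) (*-congˡ (go P c h xs Pxs Dxs)) ⟩
      (1# + c a) * 1# + (- c a) * 1#
        ≈⟨ solve 1 (λ c → (:1 :+ c) :* :1 :+ (:- c) :* :1 := :1) refl (c a) ⟩
      1# ∎
      where
      X = ΠL xs (λ x → - c x)
      V = ΠL xs (r a)
      Y = ΣS xs (λ y ys → ΠL ys (r y) * (1# + r y a))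
      Z = ΣS xs (λ y ys → ΠL ys (r y) * (1# + c y))
      -- The same identity with the removed point `a` in the place of z; this is why the induction
      -- quantifies over `P` and `c`.
      IH₂ : V + Y ≈ 1#
      IH₂ = trans (+-congʳ (ΠL-cong xs (λ x → r-anti a x)))
        (go (D a) (λ y → r y a) (λ Dy Db Dyb → three Dyb (D-sym Dy) (D-sym Db)) xs Da Dxs)
      term : ∀ y ys → P y → D a y →
        (r y a * ΠL ys (r y)) * (1# + c y) ≈ (1# + c a) * (ΠL ys (r y) * (1# + r y a)) + (- c a) * (ΠL ys (r y) * (1# + c y))
      term y ys Py Day = begin
        (r y a * W) * (1# + c y)
          ≈⟨ solve 3 (λ r W c → (r :* W) :* (:1 :+ c) := W :* r :+ W :* (r :* c)) refl (r y a) W (c y) ⟩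
        W * r y a + W * (r y a * c y)
          ≈⟨ +-congˡ (*-congˡ (h Py Pa (D-sym Day))) ⟩
        W * r y a + W * (1# + c a * (r y a - c y))
          ≈⟨ solve 4 (λ r W c d → W :* r :+ W :* (:1 :+ d :* (r :- c))
               := (:1 :+ d) :* (W :* (:1 :+ r)) :+ (:- d) :* (W :* (:1 :+ c))) refl (r y a) W (c y) (c a) ⟩
        (1# + c a) * (W * (1# + r y a)) + (- c a) * (W * (1# + c y)) ∎
        where W = ΠL ys (r y)

  module Operators {A B : Set} (r : A → A → Carrier) (s : B → B → Carrier)
    (r-anti : ∀ x y → r x y ≈ - r y x) where

    𝓛 : (A → B → Carrier) → (List A → List B → Carrier) → List A → List B → Carrier
    𝓛 k H xs ys = ΣS xs λ x xs′ → ΣS ys λ y ys′ → (ΠL xs′ (r x) * ΠL ys′ (s y)) * (k x y * H xs′ ys′)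

    𝓤 : (A → Carrier) → (List A → List B → Carrier) → List A → List B → Carrier
    𝓤 f H xs ys = ΣS xs λ x xs′ → ΠL xs′ (r x) * (f x * H xs′ ys)

    -- In both orders two elements x and x′ leave the list, and the weights differ only in r(x,x′)
    -- against r(x′,x); antisymmetry gives the sign.
    𝓤𝓛-anti : ∀ f k H xs ys → 𝓤 f (𝓛 k H) xs ys ≈ - 𝓛 k (𝓤 f H) xs ys
    𝓤𝓛-anti f k H xs ys = begin
      𝓤 f (𝓛 k H) xs ys
        ≈⟨ ΣS-cong xs (λ x xs′ _ → trans (sym (*-assoc _ _ _)) (trans (ΣS-*ˡ _ xs′ _)
             (ΣS-cong xs′ λ x′ zs σ → trans (ΣS-*ˡ _ ys _) (ΣS-cong ys λ y ys′ _ → left x xs′ x′ zs y ys′ σ)))) ⟩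
      ΣS xs (λ x xs′ → ΣS xs′ (φ x))
        ≈⟨ ΣS-twice-anti xs (λ x x′ zs → trans (ΣS-cong ys (λ y ys′ _ → flip-sign x x′ zs y ys′)) (ΣS-neg ys _)) ⟩
      - ΣS xs (λ x xs′ → ΣS xs′ (ψ x))
        ≈⟨ -‿cong (ΣS-cong xs (λ x xs′ _ → trans (ΣS-comm xs′ ys _) (ΣS-cong ys λ y ys′ _ → sym (right x xs′ y ys′)))) ⟩
      - 𝓛 k (𝓤 f H) xs ys ∎
      where
      φ ψ : A → A → List A → Carrier
      φ x x′ zs = ΣS ys λ y ys′ → (r x x′ * (ΠL zs (r x) * ΠL zs (r x′) * ΠL ys′ (s y))) * ((f x * k x′ y) * H zs ys′)
      ψ x x′ zs = ΣS ys λ y ys′ → (r x x′ * (ΠL zs (r x) * ΠL zs (r x′) * ΠL ys′ (s y))) * ((f x′ * k x y) * H zs ys′)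
      left : ∀ x xs′ x′ zs y ys′ → Sel x′ zs xs′ →
        (ΠL xs′ (r x) * f x) * ((ΠL zs (r x′) * ΠL ys′ (s y)) * (k x′ y * H zs ys′)) ≈
        (r x x′ * (ΠL zs (r x) * ΠL zs (r x′) * ΠL ys′ (s y))) * ((f x * k x′ y) * H zs ys′)
      left x xs′ x′ zs y ys′ σ = trans (*-congʳ (*-congʳ (ΠL-Sel (r x) σ)))
        (solve 7 (λ r P Q S f k H → ((r :* P) :* f) :* ((Q :* S) :* (k :* H)) := (r :* (P :* Q :* S)) :* ((f :* k) :* H))
          refl (r x x′) (ΠL zs (r x)) (ΠL zs (r x′)) (ΠL ys′ (s y)) (f x) (k x′ y) (H zs ys′))
      flip-sign : ∀ x x′ zs y ys′ →
        (r x x′ * (ΠL zs (r x) * ΠL zs (r x′) * ΠL ys′ (s y))) * ((f x * k x′ y) * H zs ys′) ≈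
        - ((r x′ x * (ΠL zs (r x′) * ΠL zs (r x) * ΠL ys′ (s y))) * ((f x * k x′ y) * H zs ys′))
      flip-sign x x′ zs y ys′ = trans (*-congʳ (*-congʳ (r-anti x x′)))
        (solve 5 (λ r P Q S X → ((:- r) :* (P :* Q :* S)) :* X := :- ((r :* (Q :* P :* S)) :* X))
          refl (r x′ x) (ΠL zs (r x)) (ΠL zs (r x′)) (ΠL ys′ (s y)) ((f x * k x′ y) * H zs ys′))
      right : ∀ x xs′ y ys′ →
        (ΠL xs′ (r x) * ΠL ys′ (s y)) * (k x y * 𝓤 f H xs′ ys′) ≈
        ΣS xs′ (λ x′ zs → (r x x′ * (ΠL zs (r x) * ΠL zs (r x′) * ΠL ys′ (s y))) * ((f x′ * k x y) * H zs ys′))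
      right x xs′ y ys′ = trans (sym (*-assoc _ _ _)) (trans (ΣS-*ˡ _ xs′ _) (ΣS-cong xs′ λ x′ zs σ →
        trans (*-congʳ (*-congʳ (*-congʳ (ΠL-Sel (r x) σ))))
          (solve 7 (λ r P Q S f k H → (((r :* P) :* S) :* k) :* (Q :* (f :* H)) := (r :* (P :* Q :* S)) :* ((f :* k) :* H))
            refl (r x x′) (ΠL zs (r x)) (ΠL zs (r x′)) (ΠL ys′ (s y)) (f x′) (k x y) (H zs ys′))))

    -- Exchanging the two removed elements preserves the weight f x · f x′ and reverses r(x,x′).
    -- Once 2 is invertible, the square vanishes.
    𝓤²≈-𝓤² : ∀ f H xs ys → 𝓤 f (𝓤 f H) xs ys ≈ - 𝓤 f (𝓤 f H) xs ys
    𝓤²≈-𝓤² f H xs ys = trans expand (trans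
      (ΣS-twice-anti xs (λ x x′ zs → trans (*-congʳ (*-congʳ (r-anti x x′)))
        (solve 6 (λ r P Q f g H → ((:- r) :* (P :* Q)) :* ((f :* g) :* H) := :- ((r :* (Q :* P)) :* ((g :* f) :* H)))
          refl (r x′ x) (ΠL zs (r x)) (ΠL zs (r x′)) (f x) (f x′) (H zs ys))))
      (-‿cong (sym expand)))
      where
      φ : A → A → List A → Carrier
      φ x x′ zs = (r x x′ * (ΠL zs (r x) * ΠL zs (r x′))) * ((f x * f x′) * H zs ys)
      expand : 𝓤 f (𝓤 f H) xs ys ≈ ΣS xs (λ x xs′ → ΣS xs′ (φ x))
      expand = ΣS-cong xs λ x xs′ _ → trans (sym (*-assoc _ _ _)) (trans (ΣS-*ˡ _ xs′ _) (ΣS-cong xs′ λ x′ zs σ →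
        trans (*-congʳ (*-congʳ (ΠL-Sel (r x) σ)))
          (solve 6 (λ r P Q f g H → ((r :* P) :* f) :* (Q :* (g :* H)) := (r :* (P :* Q)) :* ((f :* g) :* H))
            refl (r x x′) (ΠL zs (r x)) (ΠL zs (r x′)) (f x) (f x′) (H zs ys))))

-- Adjoining one variable to the Cauchy kernel

module CauchyKernel (R : CommutativeRing 0ℓ 0ℓ) where
  open CommutativeRing R hiding (zero)
  open Sums R
  open Removals R
  open IntegerCoefficients R
  open import Algebra.Properties.AbelianGroup +-abelianGroup using (ε⁻¹≈ε)
  open import Relation.Binary.Reasoning.Setoid setoid

  matchings : ∀ {A B : Set} (r : A → A → Carrier) (s : B → B → Carrier) (k : A → B → Carrier) →
              (∀ x y → r x y ≈ - r y x) → ℕ → List A → List B → Carrier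
  matchings r s k r-anti zero    = λ _ _ → 1#
  matchings r s k r-anti (suc l) = Operators.𝓛 r s r-anti k (matchings r s k r-anti l)

  -- These hypotheses record the algebra of u = xyt/(1 - xyt) and q = (1 + xyt)/(1 - xyt). By `r-q`,
  -- -q(x,w) behaves like r(x,z) with z the reciprocal of wt. By `s-u`, the product of s(y,w) with a
  -- geometric series in y splits into one in y and one in w.
  module Identity {A B : Set} (r : A → A → Carrier) (s : B → B → Carrier)
    (Dᴬ : A → A → Set) (Dᴮ : B → B → Set)
    (r-anti : ∀ x y → r x y ≈ - r y x) (s-anti : ∀ x y → s x y ≈ - s y x)
    (Dᴬ-sym : ∀ {x y} → Dᴬ x y → Dᴬ y x) (Dᴮ-sym : ∀ {x y} → Dᴮ x y → Dᴮ y x)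
    (r-three : ∀ {y a b} → Dᴬ y a → Dᴬ y b → Dᴬ a b → r y a * r y b ≈ 1# + r a b * (r y a - r y b))
    (s-three : ∀ {y a b} → Dᴮ y a → Dᴮ y b → Dᴮ a b → s y a * s y b ≈ 1# + s a b * (s y a - s y b))
    (½ : Carrier) (½+½≈1 : ½ + ½ ≈ 1#)
    (u q : A → B → Carrier)
    (q≈1+2u : ∀ x y → q x y ≈ 1# + (u x y + u x y))
    (r-q : ∀ {x a} w → Dᴬ x a → r x a * - q x w ≈ 1# + - q a w * (r x a - - q x w))
    (s-u : ∀ x {y w} → Dᴮ y w → s y w * u x y ≈ q x w * u x y + (1# + s y w) * u x w)
    where

    open Operators r s r-anti

    ≈-x⇒≈0 : ∀ {x} → x ≈ - x → x ≈ 0#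
    ≈-x⇒≈0 {x} e = begin
      x              ≈⟨ *-identityʳ x ⟨
      x * 1#         ≈⟨ *-congˡ ½+½≈1 ⟨
      x * (½ + ½)    ≈⟨ solve 2 (λ x h → x :* (h :+ h) := (x :+ x) :* h) refl x ½ ⟩
      (x + x) * ½    ≈⟨ *-congʳ (+-congˡ e) ⟩
      (x - x) * ½    ≈⟨ trans (*-congʳ (-‿inverseʳ x)) (zeroˡ ½) ⟩
      0#             ∎

    𝓤²≈0 : ∀ f H xs ys → 𝓤 f (𝓤 f H) xs ys ≈ 0#
    𝓤²≈0 f H xs ys = ≈-x⇒≈0 (𝓤²≈-𝓤² f H xs ys)

    𝓡 : (B → Carrier) → (List A → List B → Carrier) → List A → List B → Carrier
    𝓡 g H xs ys = ΣS ys λ y ys′ → ΠL ys′ (s y) * (g y * H xs ys′)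

    𝓡𝓛-anti : ∀ g k H xs ys → 𝓡 g (𝓛 k H) xs ys ≈ - 𝓛 k (𝓡 g H) xs ys
    𝓡𝓛-anti g k H xs ys = begin
      𝓡 g (𝓛 k H) xs ys                       ≈⟨ ΣS-cong ys (λ y ys′ _ → *-congˡ (*-congˡ (transpose H xs ys′))) ⟩
      BA.𝓤 g (BA.𝓛 k′ (λ ys xs → H xs ys)) ys xs ≈⟨ BA.𝓤𝓛-anti g k′ (λ ys xs → H xs ys) ys xs ⟩
      - BA.𝓛 k′ (BA.𝓤 g (λ ys xs → H xs ys)) ys xs ≈⟨ -‿cong (transpose (𝓡 g H) xs ys) ⟨
      - 𝓛 k (𝓡 g H) xs ys                     ∎
      where
      module BA = Operators s r s-anti
      k′ : B → A → Carrier
      k′ y x = k x y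
      transpose : ∀ H xs ys → 𝓛 k H xs ys ≈ BA.𝓛 k′ (λ ys xs → H xs ys) ys xs
      transpose H xs ys = trans (ΣS-comm xs ys _) (ΣS-cong ys λ y _ _ → ΣS-cong xs λ x _ _ → *-congʳ (*-comm _ _))

    module Step (w : B) where

      infix 4 _≐_
      -- Distinctness of the variables, including `w`, is part of the relation; it is inherited when
      -- variables are removed.
      _≐_ : (H K : List A → List B → Carrier) → Set
      H ≐ K = ∀ xs ys → AllPairs Dᴬ xs → All (Dᴮ w) ys → AllPairs Dᴮ ys → H xs ys ≈ K xs ys

      infixr 6 _⊞_
      _⊞_ : (H K : List A → List B → Carrier) → List A → List B → Carrier
      (H ⊞ K) xs ys = H xs ys + K xs ys

      infix 7 ⊟_
      ⊟_ : (H : List A → List B → Carrier) → List A → List B → Carrier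
      (⊟ H) xs ys = - H xs ys

      infixr 8 _⊡_
      _⊡_ : Carrier → (H : List A → List B → Carrier) → List A → List B → Carrier
      (c ⊡ H) xs ys = c * H xs ys

      1H 0H : List A → List B → Carrier
      1H _ _ = 1#
      0H _ _ = 0#

      ≐-trans : ∀ {H K L} → H ≐ K → K ≐ L → H ≐ L
      ≐-trans e f xs ys a b c = trans (e xs ys a b c) (f xs ys a b c)

      𝓛-cong : ∀ {k H K} → H ≐ K → 𝓛 k H ≐ 𝓛 k K
      𝓛-cong e xs ys a b c = ΣS-cong xs λ x xs′ σ → ΣS-cong ys λ y ys′ τ → *-congˡ (*-congˡ
        (e xs′ ys′ (proj₂ (Sel-AllPairs Dᴬ-sym σ a)) (proj₂ (Sel-All τ b)) (proj₂ (Sel-AllPairs Dᴮ-sym τ c))))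

      𝓤-cong : ∀ {f H K} → H ≐ K → 𝓤 f H ≐ 𝓤 f K
      𝓤-cong e xs ys a b c = ΣS-cong xs λ x xs′ σ → *-congˡ (*-congˡ (e xs′ ys (proj₂ (Sel-AllPairs Dᴬ-sym σ a)) b c))

      𝓡-cong : ∀ {g H K} → H ≐ K → 𝓡 g H ≐ 𝓡 g K
      𝓡-cong e xs ys a b c = ΣS-cong ys λ y ys′ τ → *-congˡ (*-congˡ
        (e xs ys′ a (proj₂ (Sel-All τ b)) (proj₂ (Sel-AllPairs Dᴮ-sym τ c))))

      𝓤-⊞ : ∀ f H K xs ys → 𝓤 f (H ⊞ K) xs ys ≈ 𝓤 f H xs ys + 𝓤 f K xs ys
      𝓤-⊞ f H K xs ys = trans
        (ΣS-cong xs λ _ _ _ → solve 4 (λ P f H K → P :* (f :* (H :+ K)) := P :* (f :* H) :+ P :* (f :* K)) refl _ _ _ _)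
        (ΣS-+ xs _ _)

      𝓤-⊡ : ∀ f c H xs ys → 𝓤 f (c ⊡ H) xs ys ≈ c * 𝓤 f H xs ys
      𝓤-⊡ f c H xs ys = trans
        (ΣS-cong xs λ _ _ _ → solve 4 (λ P f c H → P :* (f :* (c :* H)) := c :* (P :* (f :* H))) refl _ _ _ _)
        (sym (ΣS-*ˡ c xs _))

      𝓡-⊞ : ∀ f H K xs ys → 𝓡 f (H ⊞ K) xs ys ≈ 𝓡 f H xs ys + 𝓡 f K xs ys
      𝓡-⊞ f H K xs ys = trans
        (ΣS-cong ys λ _ _ _ → solve 4 (λ P f H K → P :* (f :* (H :+ K)) := P :* (f :* H) :+ P :* (f :* K)) refl _ _ _ _)
        (ΣS-+ ys _ _)

      𝓡-⊡ : ∀ f c H xs ys → 𝓡 f (c ⊡ H) xs ys ≈ c * 𝓡 f H xs ys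
      𝓡-⊡ f c H xs ys = trans
        (ΣS-cong ys λ _ _ _ → solve 4 (λ P f c H → P :* (f :* (c :* H)) := c :* (P :* (f :* H))) refl _ _ _ _)
        (sym (ΣS-*ˡ c ys _))

      𝓛-⊞ : ∀ k H K xs ys → 𝓛 k (H ⊞ K) xs ys ≈ 𝓛 k H xs ys + 𝓛 k K xs ys
      𝓛-⊞ k H K xs ys = trans
        (ΣS-cong xs λ _ _ _ → trans
          (ΣS-cong ys λ _ _ _ → solve 4 (λ P f H K → P :* (f :* (H :+ K)) := P :* (f :* H) :+ P :* (f :* K)) refl _ _ _ _)
          (ΣS-+ ys _ _))
        (ΣS-+ xs _ _)

      𝓛-⊡ : ∀ k c H xs ys → 𝓛 k (c ⊡ H) xs ys ≈ c * 𝓛 k H xs ys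
      𝓛-⊡ k c H xs ys = trans
        (ΣS-cong xs λ _ _ _ → trans
          (ΣS-cong ys λ _ _ _ → solve 4 (λ P f c H → P :* (f :* (c :* H)) := c :* (P :* (f :* H))) refl _ _ _ _)
          (sym (ΣS-*ˡ c ys _)))
        (sym (ΣS-*ˡ c xs _))

      𝓛-0 : ∀ k xs ys → 𝓛 k 0H xs ys ≈ 0#
      𝓛-0 k xs ys = trans (ΣS-cong xs λ _ _ _ → trans (ΣS-cong ys λ _ _ _ → trans (*-congˡ (zeroʳ _)) (zeroʳ _)) (ΣS-0 ys))
          (ΣS-0 xs)

      uʷ : A → Carrier
      uʷ x = u x w

      g : B → Carrier
      g y = 1# + s y w

      v : A → B → Carrier
      v x y = q x w * u x y

      ρ σ : (List A → List B → Carrier) → List A → List B → Carrier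
      ρ H xs ys = ΠL ys (s w) * H xs ys
      σ H xs ys = ΠL xs (λ x → q x w) * H xs ys

      -- `Aₗ` is J_l with q(x,w) absorbed into the kernel of each pair. `Bₗ` has in addition, at its
      -- core, one x matched to `w`.
      J Aₗ Bₗ : ℕ → List A → List B → Carrier
      J = matchings r s u r-anti
      Aₗ = matchings r s v r-anti
      Bₗ zero    = 𝓤 uʷ 1H
      Bₗ (suc l) = 𝓛 v (Bₗ l)

      σ𝓛 : ∀ H → σ (𝓛 u H) ≐ 𝓛 v (σ H)
      σ𝓛 H xs ys _ _ _ = trans (ΣS-*ˡ _ xs _) (ΣS-cong xs λ x xs′ ς → trans (ΣS-*ˡ _ ys _) (ΣS-cong ys λ y ys′ _ →
        trans (*-congʳ (ΠL-Sel (λ x → q x w) ς))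
          (solve 5 (λ q Q P u H → (q :* Q) :* (P :* (u :* H)) := P :* ((q :* u) :* (Q :* H))) refl
            (q x w) (ΠL xs′ (λ x → q x w)) _ (u x y) (H xs′ ys′))))

      -- Partial fractions with c x = -q(x,w): the product of the -c is ∏ q(x,w), and 1 - q = -2u
      -- makes each polar term -2 times a term of `Bₗ 0`.
      σ1 : σ 1H ≐ 1H ⊞ (Bₗ 0 ⊞ Bₗ 0)
      σ1 xs ys a _ _ = begin
        Q * 1#
          ≈⟨ *-identityʳ Q ⟩
        Q
          ≈⟨ solve 2 (λ Q Z → Q := (Q :+ Z) :+ (:- Z)) refl Q (- (U + U)) ⟩
        (Q + - (U + U)) + - - (U + U)
          ≈⟨ +-congʳ pf ⟩
        1# + - - (U + U)
          ≈⟨ +-congˡ (solve 1 (λ U → :- (:- U) := U) refl (U + U)) ⟩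
        1# + (U + U) ∎
        where
        Q = ΠL xs (λ x → q x w)
        U = Bₗ 0 xs ys
        neg-neg : ∀ x → - - x ≈ x
        neg-neg x = solve 1 (λ U → :- (:- U) := U) refl x
        term : ∀ x xs′ → ΠL xs′ (r x) * (1# + - q x w) ≈ (- (1# + 1#)) * (ΠL xs′ (r x) * (u x w * 1#))
        term x xs′ = trans (*-congˡ (+-congˡ (-‿cong (q≈1+2u x w))))
          (solve 2 (λ P u → P :* (:1 :+ (:- (:1 :+ (u :+ u)))) := (:- (:1 :+ :1)) :* (P :* (u :* :1))) refl _ _)
        pf : Q + - (U + U) ≈ 1#
        pf = trans (+-cong (sym (ΠL-cong xs λ x → neg-neg (q x w)))
                 (trans (solve 1 (λ U → :- (U :+ U) := (:- (:1 :+ :1)) :* U) refl U)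
                        (trans (ΣS-*ˡ _ xs _) (ΣS-cong xs λ x xs′ _ → sym (term x xs′)))))
               (partialFractions r Dᴬ r-anti Dᴬ-sym r-three (λ _ → ⊤) (λ x → - q x w) (λ _ _ → r-q w) xs (All.universal
                   (λ _ → tt) xs) a)

      -- Each removed x takes its factor q(x,w) into the kernel of its pair; the product over the
      -- x's left at the core is expanded by `σ1`.
      pieri : ∀ l → σ (J l) ≐ Aₗ l ⊞ (Bₗ l ⊞ Bₗ l)
      pieri zero    = σ1
      pieri (suc l) = ≐-trans (σ𝓛 (J l)) (≐-trans (𝓛-cong (pieri l)) λ xs ys _ _ _ →
        trans (𝓛-⊞ v (Aₗ l) _ xs ys) (+-congˡ (𝓛-⊞ v (Bₗ l) (Bₗ l) xs ys)))

      -- The factor s(w,y) = -s(y,w) of the removed y meets u(x,y) and is split by `s-u`. The first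
      -- part keeps y as partner of x, the second matches x to `w`.
      ρ𝓛 : ∀ H → ρ (𝓛 u H) ≐ ⊟ (𝓛 v (ρ H) ⊞ 𝓤 uʷ (𝓡 g (ρ H)))
      ρ𝓛 H xs ys _ Dw _ = begin
        ρ (𝓛 u H) xs ys
          ≈⟨ trans (ΣS-*ˡ _ xs _) (ΣS-cong xs λ x xs′ _ → trans (ΣS-*ˡ _ ys _) (ΣS-cong ys λ y ys′ τ → term x xs′ y ys′ τ)) ⟩
        ΣS xs (λ x xs′ → ΣS ys λ y ys′ → - (t₁ x xs′ y ys′ + t₂ x xs′ y ys′))
          ≈⟨ ΣS-cong xs (λ x xs′ _ → trans (ΣS-neg ys _) (-‿cong (ΣS-+ ys _ _))) ⟩
        ΣS xs (λ x xs′ → - (ΣS ys (t₁ x xs′) + ΣS ys (t₂ x xs′)))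
          ≈⟨ trans (ΣS-neg xs _) (-‿cong (ΣS-+ xs _ _)) ⟩
        - (𝓛 v (ρ H) xs ys + ΣS xs (λ x xs′ → ΣS ys (t₂ x xs′)))
          ≈⟨ -‿cong (+-congˡ (ΣS-cong xs λ x xs′ _ → trans (sym (ΣS-*ˡ _ ys _)) (*-assoc _ _ _))) ⟩
        - (𝓛 v (ρ H) xs ys + 𝓤 uʷ (𝓡 g (ρ H)) xs ys) ∎
        where
        t₁ t₂ : A → List A → B → List B → Carrier
        t₁ x xs′ y ys′ = (ΠL xs′ (r x) * ΠL ys′ (s y)) * (v x y * ρ H xs′ ys′)
        t₂ x xs′ y ys′ = (ΠL xs′ (r x) * u x w) * (ΠL ys′ (s y) * (g y * ρ H xs′ ys′))
        term : ∀ x xs′ y ys′ → Sel y ys′ ys →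
          ΠL ys (s w) * ((ΠL xs′ (r x) * ΠL ys′ (s y)) * (u x y * H xs′ ys′)) ≈ - (t₁ x xs′ y ys′ + t₂ x xs′ y ys′)
        term x xs′ y ys′ τ = begin
          ΠL ys (s w) * ((P * S) * (u x y * h))
            ≈⟨ *-congʳ (trans (ΠL-Sel (s w) τ) (*-congʳ (s-anti w y))) ⟩
          (- s y w * V) * ((P * S) * (u x y * h))
            ≈⟨ solve 6 (λ s V P S u h → ((:- s) :* V) :* ((P :* S) :* (u :* h)) := :- ((V :* P :* S :* h) :* (s :* u))) refl
                (s y w) V P S (u x y) h ⟩
          - ((V * P * S * h) * (s y w * u x y))
            ≈⟨ -‿cong (*-congˡ (s-u x (Dᴮ-sym (proj₁ (Sel-All τ Dw))))) ⟩
          - ((V * P * S * h) * (q x w * u x y + (1# + s y w) * u x w))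
            ≈⟨ -‿cong (solve 7 (λ V P S h v g u → (V :* P :* S :* h) :* (v :+ g :* u)
                 := (P :* S) :* (v :* (V :* h)) :+ (P :* u) :* (S :* (g :* (V :* h)))) refl V P S h (v x y) (g y) (u x w)) ⟩
          - (t₁ x xs′ y ys′ + t₂ x xs′ y ys′) ∎
          where
          V = ΠL ys′ (s w) ; P = ΠL xs′ (r x) ; S = ΠL ys′ (s y) ; h = H xs′ ys′

      with-w : (List A → List B → Carrier) → List A → List B → Carrier
      with-w H xs ys = H xs (w ∷ ys)

      -- Either `w` is the removed variable, giving the `ρ` term, or some y is, with an extra factor
      -- s(y,w) that `s-u` splits.
      𝓛-with-w : ∀ H → with-w (𝓛 u H) ≐ 𝓛 v (with-w H) ⊞ 𝓤 uʷ (ρ H ⊞ 𝓡 g (with-w H))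
      𝓛-with-w H xs ys _ Dw _ = begin
        with-w (𝓛 u H) xs ys
          ≈⟨ ΣS-cong xs (λ x xs′ _ → +-cong
               (solve 4 (λ P V u h → (P :* V) :* (u :* h) := (P :* u) :* (V :* h)) refl (ΠL xs′ (r x)) (ΠL ys (s w)) (u x w)
                   (H xs′ ys))
               (ΣS-cong ys λ y ys′ τ → term x xs′ y ys′ τ)) ⟩
        ΣS xs (λ x xs′ → t₀ x xs′ + ΣS ys (λ y ys′ → t₁ x xs′ y ys′ + t₂ x xs′ y ys′))
          ≈⟨ ΣS-cong xs (λ x xs′ _ → trans (+-congˡ (ΣS-+ ys _ _))
               (solve 3 (λ a b c → a :+ (b :+ c) := b :+ (a :+ c)) refl _ _ _)) ⟩
        ΣS xs (λ x xs′ → ΣS ys (t₁ x xs′) + (t₀ x xs′ + ΣS ys (t₂ x xs′)))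
          ≈⟨ ΣS-+ xs _ _ ⟩
        𝓛 v (with-w H) xs ys + ΣS xs (λ x xs′ → t₀ x xs′ + ΣS ys (t₂ x xs′))
          ≈⟨ +-congˡ (ΣS-cong xs λ x xs′ _ → trans (+-congˡ (sym (ΣS-*ˡ _ ys _)))
               (trans (sym (distribˡ _ _ _)) (*-assoc _ _ _))) ⟩
        𝓛 v (with-w H) xs ys + 𝓤 uʷ (ρ H ⊞ 𝓡 g (with-w H)) xs ys ∎
        where
        t₀ : A → List A → Carrier
        t₀ x xs′ = (ΠL xs′ (r x) * u x w) * ρ H xs′ ys
        t₁ t₂ : A → List A → B → List B → Carrier
        t₁ x xs′ y ys′ = (ΠL xs′ (r x) * ΠL ys′ (s y)) * (v x y * with-w H xs′ ys′)
        t₂ x xs′ y ys′ = (ΠL xs′ (r x) * u x w) * (ΠL ys′ (s y) * (g y * with-w H xs′ ys′))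
        term : ∀ x xs′ y ys′ → Sel y ys′ ys →
          (ΠL xs′ (r x) * (s y w * ΠL ys′ (s y))) * (u x y * H xs′ (w ∷ ys′)) ≈ t₁ x xs′ y ys′ + t₂ x xs′ y ys′
        term x xs′ y ys′ τ = begin
          (P * (s y w * S)) * (u x y * h)
            ≈⟨ solve 5 (λ s P S u h → (P :* (s :* S)) :* (u :* h) := (P :* S :* h) :* (s :* u)) refl (s y w) P S (u x y) h ⟩
          (P * S * h) * (s y w * u x y)
            ≈⟨ *-congˡ (s-u x (Dᴮ-sym (proj₁ (Sel-All τ Dw)))) ⟩
          (P * S * h) * (q x w * u x y + (1# + s y w) * u x w)
            ≈⟨ solve 6 (λ P S h v g u → (P :* S :* h) :* (v :+ g :* u)
                 := (P :* S) :* (v :* h) :+ (P :* u) :* (S :* (g :* h))) refl P S h (v x y) (g y) (u x w) ⟩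
          t₁ x xs′ y ys′ + t₂ x xs′ y ys′ ∎
          where
          P = ΠL xs′ (r x) ; S = ΠL ys′ (s y) ; h = H xs′ (w ∷ ys′)

      -- Partial fractions among the y's with `w` as the additional point.
      ρ1⊞𝓡1 : ρ 1H ⊞ 𝓡 g 1H ≐ 1H
      ρ1⊞𝓡1 xs ys _ b c = trans (+-cong
        (trans (*-identityʳ _) (ΠL-cong ys (s-anti w)))
        (ΣS-cong ys λ y ys′ _ → *-congˡ (*-identityʳ _)))
        (partialFractions s Dᴮ s-anti Dᴮ-sym s-three (Dᴮ w) (λ y → s y w)
          (λ {y} {a} Dy Da Dya → s-three Dya (Dᴮ-sym Dy) (Dᴮ-sym Da)) ys b c)

      𝓤𝓡 : ∀ f g H xs ys → 𝓤 f (𝓡 g H) xs ys ≈ 𝓡 g (𝓤 f H) xs ys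
      𝓤𝓡 f g H xs ys = begin
        𝓤 f (𝓡 g H) xs ys
          ≈⟨ ΣS-cong xs (λ x xs′ _ → trans (sym (*-assoc _ _ _)) (ΣS-*ˡ _ ys _)) ⟩
        ΣS xs (λ x xs′ → ΣS ys λ y ys′ → (ΠL xs′ (r x) * f x) * (ΠL ys′ (s y) * (g y * H xs′ ys′)))
          ≈⟨ ΣS-comm xs ys _ ⟩
        ΣS ys (λ y ys′ → ΣS xs λ x xs′ → (ΠL xs′ (r x) * f x) * (ΠL ys′ (s y) * (g y * H xs′ ys′)))
          ≈⟨ ΣS-cong ys (λ y ys′ _ → trans (ΣS-cong xs λ x xs′ _ →
               solve 5 (λ P f S g H → (P :* f) :* (S :* (g :* H)) := (S :* g) :* (P :* (f :* H))) refl _ _ _ _ _)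
               (trans (sym (ΣS-*ˡ _ xs _)) (*-assoc _ _ _))) ⟩
        𝓡 g (𝓤 f H) xs ys ∎

      -- `𝓤` commutes with `𝓡`, and both anticommute with `𝓛`, so the pair passes through every `𝓛`
      -- to the core of `Bₗ`. There it meets a second `𝓤` with the same weight, and the square is
      -- zero.
      𝓤𝓡Bₗ : ∀ l → 𝓤 uʷ (𝓡 g (Bₗ l)) ≐ 0H
      𝓤𝓡Bₗ zero = λ xs ys a b c → trans
        (𝓤-cong (λ xs ys _ _ _ → sym (𝓤𝓡 uʷ g 1H xs ys)) xs ys a b c)
        (𝓤²≈0 uʷ (𝓡 g 1H) xs ys)
      𝓤𝓡Bₗ (suc l) xs ys a b c = begin
        𝓤 uʷ (𝓡 g (𝓛 v (Bₗ l))) xs ys        ≈⟨ 𝓤𝓡 uʷ g _ xs ys ⟩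
        𝓡 g (𝓤 uʷ (𝓛 v (Bₗ l))) xs ys        ≈⟨ 𝓡-cong (λ xs ys _ _ _ → 𝓤𝓛-anti uʷ v (Bₗ l) xs ys) xs ys a b c ⟩
        𝓡 g (⊟ 𝓛 v (𝓤 uʷ (Bₗ l))) xs ys      ≈⟨ 𝓡-cong (λ xs ys _ _ _ → minus (𝓛 v (𝓤 uʷ (Bₗ l)) xs ys)) xs ys a b c ⟩
        𝓡 g ((- 1#) ⊡ 𝓛 v (𝓤 uʷ (Bₗ l))) xs ys ≈⟨ 𝓡-⊡ g (- 1#) (𝓛 v (𝓤 uʷ (Bₗ l))) xs ys ⟩
        - 1# * 𝓡 g (𝓛 v (𝓤 uʷ (Bₗ l))) xs ys ≈⟨ minus _ ⟨
        - 𝓡 g (𝓛 v (𝓤 uʷ (Bₗ l))) xs ys      ≈⟨ -‿cong (𝓡𝓛-anti g v _ xs ys) ⟩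
        - - 𝓛 v (𝓡 g (𝓤 uʷ (Bₗ l))) xs ys    ≈⟨ -‿cong (-‿cong (𝓛-cong (λ xs ys a b c → trans (sym (𝓤𝓡 uʷ g (Bₗ l) xs ys))
            (𝓤𝓡Bₗ l xs ys a b c)) xs ys a b c)) ⟩
        - - 𝓛 v 0H xs ys                     ≈⟨ -‿cong (-‿cong (𝓛-0 v xs ys)) ⟩
        - - 0#                               ≈⟨ trans (-‿cong ε⁻¹≈ε) ε⁻¹≈ε ⟩
        0#                                   ∎
        where
        minus : ∀ x → - x ≈ - 1# * x
        minus x = solve 1 (λ x → :- x := (:- :1) :* x) refl x

      -- One more pair changes X into -(𝓛 X + 𝓤 Y). The outer `𝓤` kills the second term and
      -- anticommutes past `𝓛` in the first, so the signs cancel and the induction proceeds under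
      -- `𝓛`.
      𝓤X : ∀ l → 𝓤 uʷ (ρ (J l) ⊞ 𝓡 g (Aₗ l)) ≐ Bₗ l
      𝓤X zero    = 𝓤-cong ρ1⊞𝓡1
      𝓤X (suc l) xs ys a b c = begin
        𝓤 uʷ (ρ (𝓛 u (J l)) ⊞ 𝓡 g (𝓛 v (Aₗ l))) xs ys
          ≈⟨ 𝓤-cong inner xs ys a b c ⟩
        𝓤 uʷ ((- 1#) ⊡ (𝓛 v X ⊞ 𝓤 uʷ Y)) xs ys
          ≈⟨ 𝓤-⊡ uʷ (- 1#) (𝓛 v X ⊞ 𝓤 uʷ Y) xs ys ⟩
        - 1# * 𝓤 uʷ (𝓛 v X ⊞ 𝓤 uʷ Y) xs ys
          ≈⟨ *-congˡ (trans (𝓤-⊞ uʷ (𝓛 v X) (𝓤 uʷ Y) xs ys) (+-cong (𝓤𝓛-anti uʷ v X xs ys) (𝓤²≈0 uʷ Y xs ys))) ⟩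
        - 1# * (- 𝓛 v (𝓤 uʷ X) xs ys + 0#)
          ≈⟨ solve 1 (λ x → (:- :1) :* ((:- x) :+ :0) := x) refl _ ⟩
        𝓛 v (𝓤 uʷ X) xs ys
          ≈⟨ 𝓛-cong (𝓤X l) xs ys a b c ⟩
        𝓛 v (Bₗ l) xs ys ∎
        where
        X Y : List A → List B → Carrier
        X = ρ (J l) ⊞ 𝓡 g (Aₗ l)
        Y = 𝓡 g (ρ (J l))
        inner : ρ (𝓛 u (J l)) ⊞ 𝓡 g (𝓛 v (Aₗ l)) ≐ (- 1#) ⊡ (𝓛 v X ⊞ 𝓤 uʷ Y)
        inner xs ys a b c = trans (+-cong (ρ𝓛 (J l) xs ys a b c) (𝓡𝓛-anti g v (Aₗ l) xs ys))
          (trans (solve 3 (λ a b c → (:- (a :+ b)) :+ (:- c) := (:- :1) :* ((a :+ c) :+ b)) refl _ _ _)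
            (*-congˡ (+-congʳ (sym (𝓛-⊞ v (ρ (J l)) (𝓡 g (Aₗ l)) xs ys)))))

      -- The factor l + 1 counts the steps at which `w` can be removed; by `𝓤X` each of them
      -- contributes one copy of `Bₗ`.
      branching : ∀ l → with-w (J (suc l)) ≐ Aₗ (suc l) ⊞ fromℕ (suc l) ⊡ Bₗ l
      branching zero    xs ys a b c = trans (𝓛-with-w 1H xs ys a b c)
        (+-congˡ (trans (𝓤X 0 xs ys a b c) (solve 1 (λ B → B := (:1 :+ :0) :* B) refl _)))
      branching (suc l) xs ys a b c = begin
        with-w (𝓛 u (J (suc l))) xs ys
          ≈⟨ 𝓛-with-w (J (suc l)) xs ys a b c ⟩
        𝓛 v (with-w (J (suc l))) xs ys + 𝓤 uʷ (ρ (J (suc l)) ⊞ 𝓡 g (with-w (J (suc l)))) xs ys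
          ≈⟨ +-cong (trans (𝓛-cong (branching l) xs ys a b c) (trans (𝓛-⊞ v _ _ xs ys) (+-congˡ (𝓛-⊡ v m (Bₗ l) xs ys)))) second ⟩
        (𝓛 v (Aₗ (suc l)) xs ys + m * 𝓛 v (Bₗ l) xs ys) + (Bₗ (suc l) xs ys + m * 0#)
          ≈⟨ solve 3 (λ A m B → (A :+ m :* B) :+ (B :+ m :* :0) := A :+ (:1 :+ m) :* B) refl _ m _ ⟩
        Aₗ (suc (suc l)) xs ys + (1# + m) * Bₗ (suc l) xs ys ∎
        where
        m = fromℕ (suc l)
        -- The `Bₗ` part of the induction hypothesis is annihilated by `𝓤𝓡Bₗ`; the rest is `𝓤X`.
        second : 𝓤 uʷ (ρ (J (suc l)) ⊞ 𝓡 g (with-w (J (suc l)))) xs ys ≈ Bₗ (suc l) xs ys + m * 0#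
        second = begin
          𝓤 uʷ (ρ (J (suc l)) ⊞ 𝓡 g (with-w (J (suc l)))) xs ys
            ≈⟨ 𝓤-cong (λ xs ys a b c → trans (+-congˡ (trans (𝓡-cong (branching l) xs ys a b c)
                 (trans (𝓡-⊞ g (Aₗ (suc l)) (m ⊡ Bₗ l) xs ys) (+-congˡ (𝓡-⊡ g m (Bₗ l) xs ys))))) (sym (+-assoc (ρ (J
                     (suc l)) xs ys) (𝓡 g (Aₗ (suc l)) xs ys) (m * 𝓡 g (Bₗ l) xs ys)))) xs ys a b c ⟩
          𝓤 uʷ ((ρ (J (suc l)) ⊞ 𝓡 g (Aₗ (suc l))) ⊞ m ⊡ 𝓡 g (Bₗ l)) xs ys
            ≈⟨ trans (𝓤-⊞ uʷ (ρ (J (suc l)) ⊞ 𝓡 g (Aₗ (suc l))) (m ⊡ 𝓡 g (Bₗ l)) xs ys) (+-cong (𝓤X (suc l) xs ys a b c) (trans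
                (𝓤-⊡ uʷ m (𝓡 g (Bₗ l)) xs ys) (*-congˡ (𝓤𝓡Bₗ l xs ys a b c)))) ⟩
          Bₗ (suc l) xs ys + m * 0# ∎

      Bₗ-vanishes : ∀ l xs ys → length xs ℕ.≤ l → Bₗ l xs ys ≈ 0#
      Bₗ-vanishes zero    []       ys _ = refl
      Bₗ-vanishes (suc l) xs       ys h = trans
        (ΣS-cong xs λ x xs′ σ → trans (ΣS-cong ys λ y ys′ _ → trans (*-congˡ (trans (*-congˡ
          (Bₗ-vanishes l xs′ ys′ (ℕ.≤-pred (≡.subst (ℕ._≤ suc l) (Sel-length σ) h)))) (zeroʳ _))) (zeroʳ _)) (ΣS-0 ys))
        (ΣS-0 xs)

    J : ℕ → List A → List B → Carrier
    J = matchings r s u r-anti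

    module _ (c : ℕ → Carrier) (c₀ : c 0 ≈ 1#) (c₊ : ∀ l → c (suc l) * fromℕ (suc l) ≈ c l + c l) where

      weighted : ℕ → List A → List B → Carrier
      weighted L xs ys = ΣL (downFrom (suc L)) λ l → c l * J l xs ys

      -- By `c₊`, the (l + 1) B_l that `branching` gives at length l + 1 becomes the 2 B_l that
      -- `pieri` requires at length l. The sums agree up to the top term 2 c_L B_L, which vanishes
      -- because B_L uses L + 1 of the x's; it is added at the start to make the telescoping exact.
      weighted-∷ : ∀ L xs w ys → length xs ℕ.≤ L → AllPairs Dᴬ xs → All (Dᴮ w) ys → AllPairs Dᴮ ys →
                   weighted L xs (w ∷ ys) ≈ ΠL xs (λ x → q x w) * weighted L xs ys
      weighted-∷ L xs w ys L≥ a b d = begin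
        weighted L xs (w ∷ ys)
          ≈⟨ +-identityʳ _ ⟨
        weighted L xs (w ∷ ys) + 0#
          ≈⟨ +-congˡ (trans (sym (zeroʳ _)) (*-congˡ (sym (Bₗ-vanishes L xs ys L≥)))) ⟩
        weighted L xs (w ∷ ys) + (c L + c L) * Bₗ L xs ys
          ≈⟨ partial L ⟩
        ΣL (downFrom (suc L)) (λ l → c l * (Aₗ l xs ys + (Bₗ l xs ys + Bₗ l xs ys)))
          ≈⟨ ΣL-cong (downFrom (suc L)) (λ l → trans (*-congˡ (sym (pieri l xs ys a b d))) (x∙yz≈y∙xz _ _ _)) ⟩
        ΣL (downFrom (suc L)) (λ l → ΠL xs (λ x → q x w) * (c l * J l xs ys))
          ≈⟨ ΣL-*ˡ _ (downFrom (suc L)) _ ⟨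
        ΠL xs (λ x → q x w) * weighted L xs ys ∎
        where
        open Step w hiding (J)
        open import Algebra.Properties.CommutativeSemigroup *-commutativeSemigroup using (x∙yz≈y∙xz)
        partial : ∀ L → weighted L xs (w ∷ ys) + (c L + c L) * Bₗ L xs ys ≈
                        ΣL (downFrom (suc L)) (λ l → c l * (Aₗ l xs ys + (Bₗ l xs ys + Bₗ l xs ys)))
        partial zero    = solve 3 (λ c A B → (c :* A :+ :0) :+ (c :+ c) :* B := c :* (A :+ (B :+ B)) :+ :0) refl (c 0) 1#
            (Bₗ 0 xs ys)
        partial (suc L) = begin
          (c (suc L) * J (suc L) xs (w ∷ ys) + weighted L xs (w ∷ ys)) + (c (suc L) + c (suc L)) * β′
            ≈⟨ +-congʳ (+-congʳ (*-congˡ (branching L xs ys a b d))) ⟩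
          (c (suc L) * (α′ + fromℕ (suc L) * β) + weighted L xs (w ∷ ys)) + (c (suc L) + c (suc L)) * β′
            ≈⟨ solve 6 (λ c A m B W B′ → (c :* (A :+ m :* B) :+ W) :+ (c :+ c) :* B′ := c :* (A :+ (B′ :+ B′)) :+ (W :+
                (c :* m) :* B)) refl
                 (c (suc L)) α′ (fromℕ (suc L)) β (weighted L xs (w ∷ ys)) β′ ⟩
          c (suc L) * (α′ + (β′ + β′)) + (weighted L xs (w ∷ ys) + (c (suc L) * fromℕ (suc L)) * β)
            ≈⟨ +-congˡ (+-congˡ (*-congʳ (c₊ L))) ⟩
          c (suc L) * (α′ + (β′ + β′)) + (weighted L xs (w ∷ ys) + (c L + c L) * β)
            ≈⟨ +-congˡ (partial L) ⟩
          c (suc L) * (α′ + (β′ + β′)) + ΣL (downFrom (suc L)) (λ l → c l * (Aₗ l xs ys + (Bₗ l xs ys + Bₗ l xs ys))) ∎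
          where
          α′ = Aₗ (suc L) xs ys ; β = Bₗ L xs ys ; β′ = Bₗ (suc L) xs ys

      weighted≈ΠΠ : ∀ L xs ys → length xs ℕ.≤ L → AllPairs Dᴬ xs → AllPairs Dᴮ ys →
                    weighted L xs ys ≈ ΠL ys (λ y → ΠL xs (λ x → q x y))
      weighted≈ΠΠ L xs []       L≥ a _       = base L
        where
        J-[] : ∀ l → J (suc l) xs [] ≈ 0#
        J-[] l = ΣS-0 xs
        base : ∀ L → weighted L xs [] ≈ 1#
        base zero    = trans (+-identityʳ _) (trans (*-identityʳ _) c₀)
        base (suc L) = trans (+-congʳ (trans (*-congˡ (J-[] L)) (zeroʳ _))) (trans (+-identityˡ _) (base L))
      weighted≈ΠΠ L xs (w ∷ ys) L≥ a (b ∷ d) =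
        trans (weighted-∷ L xs w ys L≥ a b d) (*-congˡ (weighted≈ΠΠ L xs ys L≥ a d))

-- Power series and the total ring of fractions

module PowerSeries (R : CommutativeRing 0ℓ 0ℓ) where
  open CommutativeRing R hiding (zero)
  open Sums R
  open IntegerCoefficients R
  open import Relation.Binary.Reasoning.Setoid setoid

  Series : Set
  Series = ℕ → Carrier

  infixl 7 _∙_
  -- The Cauchy product, by recursion on f = f(0) + t · (f ∘ suc), which replaces sums over the
  -- splittings of n.
  _∙_ : Series → Series → Series
  (f ∙ g) zero    = f 0 * g 0
  (f ∙ g) (suc n) = f 0 * g (suc n) + ((f ∘ suc) ∙ g) n

  constant : Carrier → Series
  constant c zero    = c
  constant c (suc n) = 0#

  monomial : Carrier → Series
  monomial c zero          = 0#
  monomial c (suc zero)    = c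
  monomial c (suc (suc n)) = 0#

  geometric : Carrier → Series
  geometric c n = c ^ n

  ∙-cong : ∀ {f f′ g g′} → (∀ n → f n ≈ f′ n) → (∀ n → g n ≈ g′ n) → ∀ n → (f ∙ g) n ≈ (f′ ∙ g′) n
  ∙-cong e h zero    = *-cong (e 0) (h 0)
  ∙-cong e h (suc n) = +-cong (*-cong (e 0) (h (suc n))) (∙-cong (e ∘ suc) h n)

  ∙-zeroˡ : ∀ g n → ((λ _ → 0#) ∙ g) n ≈ 0#
  ∙-zeroˡ g zero    = zeroˡ _
  ∙-zeroˡ g (suc n) = trans (+-cong (zeroˡ _) (∙-zeroˡ g n)) (+-identityʳ _)

  constant-∙ : ∀ c f n → (constant c ∙ f) n ≈ c * f n
  constant-∙ c f zero    = refl
  constant-∙ c f (suc n) = trans (+-congˡ (∙-zeroˡ f n)) (+-identityʳ _)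

  monomial-∙-zero : ∀ c f → (monomial c ∙ f) 0 ≈ 0#
  monomial-∙-zero c f = zeroˡ _

  monomial-∙-suc : ∀ c f n → (monomial c ∙ f) (suc n) ≈ c * f n
  monomial-∙-suc c f n = trans (+-cong (zeroˡ _) (trans (∙-cong {g = f} lower (λ _ → refl) n) (constant-∙ c f n))) (+-identityˡ _)
    where
    lower : ∀ n → monomial c (suc n) ≈ constant c n
    lower zero    = refl
    lower (suc n) = refl

  ∙-sucʳ : ∀ f g n → (f ∙ g) (suc n) ≈ f (suc n) * g 0 + (f ∙ (g ∘ suc)) n
  ∙-sucʳ f g zero    = +-comm _ _
  ∙-sucʳ f g (suc n) = trans (+-congˡ (∙-sucʳ (f ∘ suc) g n))
    (solve 3 (λ a b c → a :+ (b :+ c) := b :+ (a :+ c)) refl _ _ _)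

  ∙-comm : ∀ f g n → (f ∙ g) n ≈ (g ∙ f) n
  ∙-comm f g zero    = *-comm _ _
  ∙-comm f g (suc n) = trans (+-cong (*-comm _ _) (∙-comm (f ∘ suc) g n)) (sym (∙-sucʳ g f n))

  ∙-distribʳ : ∀ h f g n → ((λ k → f k + g k) ∙ h) n ≈ (f ∙ h) n + (g ∙ h) n
  ∙-distribʳ h f g zero    = distribʳ _ _ _
  ∙-distribʳ h f g (suc n) = trans (+-cong (distribʳ _ _ _) (∙-distribʳ h (f ∘ suc) (g ∘ suc) n))
    (solve 4 (λ a b c d → (a :+ b) :+ (c :+ d) := (a :+ c) :+ (b :+ d)) refl _ _ _ _)

  ∙-distribˡ : ∀ h f g n → (h ∙ (λ k → f k + g k)) n ≈ (h ∙ f) n + (h ∙ g) n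
  ∙-distribˡ h f g n = trans (∙-comm h _ n) (trans (∙-distribʳ h f g n) (+-cong (∙-comm f h n) (∙-comm g h n)))

  ∙-scale : ∀ c f g n → ((λ k → c * f k) ∙ g) n ≈ c * (f ∙ g) n
  ∙-scale c f g zero    = *-assoc _ _ _
  ∙-scale c f g (suc n) = trans (+-cong (*-assoc _ _ _) (∙-scale c (f ∘ suc) g n)) (sym (distribˡ _ _ _))

  ∙-assoc : ∀ f g h n → ((f ∙ g) ∙ h) n ≈ (f ∙ (g ∙ h)) n
  ∙-assoc f g h zero    = *-assoc _ _ _
  ∙-assoc f g h (suc n) = begin
    f 0 * g 0 * h (suc n) + (((f ∙ g) ∘ suc) ∙ h) n
      ≈⟨ +-congˡ (trans (∙-distribʳ h _ _ n) (+-cong (∙-scale (f 0) (g ∘ suc) h n) (∙-assoc (f ∘ suc) g h n))) ⟩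
    f 0 * g 0 * h (suc n) + (f 0 * ((g ∘ suc) ∙ h) n + ((f ∘ suc) ∙ (g ∙ h)) n)
      ≈⟨ solve 5 (λ a b c d e → a :* b :* c :+ (a :* d :+ e) := a :* (b :* c :+ d) :+ e) refl _ _ _ _ _ ⟩
    f 0 * (g 0 * h (suc n) + ((g ∘ suc) ∙ h) n) + ((f ∘ suc) ∙ (g ∙ h)) n ∎

  powerSeriesRing : CommutativeRing 0ℓ 0ℓ
  powerSeriesRing = record
    { Carrier = Series ; _≈_ = λ f g → ∀ n → f n ≈ g n
    ; _+_ = λ f g n → f n + g n ; _*_ = _∙_ ; -_ = λ f n → - f n ; 0# = λ _ → 0# ; 1# = constant 1#
    ; isCommutativeRing = record
      { isRing = record
        { +-isAbelianGroup = record
          { isGroup = record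
            { isMonoid = record
              { isSemigroup = record
                { isMagma = record
                  { isEquivalence = record
                    { refl = λ n → refl ; sym = λ e n → sym (e n) ; trans = λ e h n → trans (e n) (h n) }
                  ; ∙-cong = λ e h n → +-cong (e n) (h n) }
                ; assoc = λ f g h n → +-assoc _ _ _ }
              ; identity = (λ f n → +-identityˡ _) , (λ f n → +-identityʳ _) }
            ; inverse = (λ f n → -‿inverseˡ _) , (λ f n → -‿inverseʳ _)
            ; ⁻¹-cong = λ e n → -‿cong (e n) }
          ; comm = λ f g n → +-comm _ _ }
        ; *-cong = ∙-cong
        ; *-assoc = ∙-assoc
        ; *-identity = 1-∙ , (λ f n → trans (∙-comm f _ n) (1-∙ f n))
        ; distrib = ∙-distribˡ , ∙-distribʳ }
      ; *-comm = ∙-comm } }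
    where
    1-∙ : ∀ f n → (constant 1# ∙ f) n ≈ f n
    1-∙ f n = trans (constant-∙ 1# f n) (*-identityˡ _)

  private module PS = CommutativeRing powerSeriesRing

  geometric-inverse : ∀ c → (PS.1# PS.- monomial c) ∙ geometric c PS.≈ PS.1#
  geometric-inverse c n = trans (∙-distribʳ (geometric c) (constant 1#) _ n)
    (trans (+-cong (trans (constant-∙ 1# (geometric c) n) (*-identityˡ _))
        (trans (∙-cong {g = geometric c} (λ k → solve 1 (λ x → :- x := (:- :1) :* x) refl (monomial c k)) (λ _ → refl) n)
               (∙-scale (- 1#) (monomial c) (geometric c) n)))
      (finish n))
    where
    finish : ∀ n → c ^ n + - 1# * (monomial c ∙ geometric c) n ≈ constant 1# n
    finish zero    = trans (+-congˡ (trans (*-congˡ (monomial-∙-zero c (geometric c))) (zeroʳ _))) (+-identityʳ _)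
    finish (suc n) = trans (+-congˡ (*-congˡ (monomial-∙-suc c (geometric c) n)))
      (solve 1 (λ x → x :+ (:- :1) :* x := :0) refl _)

module Fractions (R : CommutativeRing 0ℓ 0ℓ) where
  open CommutativeRing R hiding (zero)
  open IntegerCoefficients R
  open import Relation.Binary.Reasoning.Setoid setoid
  open import Algebra.Properties.AbelianGroup +-abelianGroup using (x∙y⁻¹≈ε⇒x≈y)

  -- Non-zero-divisors, the denominators of the total ring of fractions.
  Regular : Carrier → Set
  Regular d = ∀ f → d * f ≈ 0# → f ≈ 0#

  Regular-* : ∀ {d e} → Regular d → Regular e → Regular (d * e)
  Regular-* p q f h = q f (p _ (trans (sym (*-assoc _ _ _)) h))

  Regular-1 : Regular 1#
  Regular-1 f h = trans (sym (*-identityˡ f)) h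

  Regular-cancel : ∀ {d} → Regular d → ∀ {f g} → d * f ≈ d * g → f ≈ g
  Regular-cancel {d} p {f} {g} h = x∙y⁻¹≈ε⇒x≈y f g (p (f - g) (begin
    d * (f - g)      ≈⟨ solve 3 (λ d f g → d :* (f :- g) := d :* f :- d :* g) refl d f g ⟩
    d * f - d * g    ≈⟨ +-congʳ h ⟩
    d * g - d * g    ≈⟨ -‿inverseʳ _ ⟩
    0#               ∎))

  infix 5 _/_[_]
  record Fraction : Set where
    constructor _/_[_]
    field
      num     : Carrier
      den     : Carrier
      regular : Regular den
  open Fraction

  infix 4 _≃_
  _≃_ : Fraction → Fraction → Set
  a ≃ b = num a * den b ≈ num b * den a

  -- Cross-multiplication proves the claim times the middle denominator, which is then cancelled by
  -- its regularity.
  ≃-trans : ∀ {a b c} → a ≃ b → b ≃ c → a ≃ c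
  ≃-trans {n / d [ p ]} {m / e [ q ]} {k / f [ r ]} h h′ = Regular-cancel q (begin
    e * (n * f)    ≈⟨ solve 3 (λ e n f → e :* (n :* f) := (n :* e) :* f) refl e n f ⟩
    (n * e) * f    ≈⟨ *-congʳ h ⟩
    (m * d) * f    ≈⟨ solve 3 (λ m d f → (m :* d) :* f := (m :* f) :* d) refl m d f ⟩
    (m * f) * d    ≈⟨ *-congʳ h′ ⟩
    (k * e) * d    ≈⟨ solve 3 (λ k e d → (k :* e) :* d := e :* (k :* d)) refl k e d ⟩
    e * (k * d)    ∎)

  infixl 6 _⊹_
  infixl 7 _⋆_
  _⊹_ _⋆_ : Fraction → Fraction → Fraction
  (n / d [ p ]) ⊹ (m / e [ q ]) = n * e + m * d / d * e [ Regular-* p q ]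
  (n / d [ p ]) ⋆ (m / e [ q ]) = n * m / d * e [ Regular-* p q ]

  ι : Carrier → Fraction
  ι f = f / 1# [ Regular-1 ]

  fractionRing : CommutativeRing 0ℓ 0ℓ
  fractionRing = record
    { Carrier = Fraction ; _≈_ = _≃_ ; _+_ = _⊹_ ; _*_ = _⋆_
    ; -_ = λ a → - num a / den a [ regular a ]
    ; 0# = ι 0# ; 1# = ι 1#
    ; isCommutativeRing = record
      { isRing = record
        { +-isAbelianGroup = record
          { isGroup = record
            { isMonoid = record
              { isSemigroup = record
                { isMagma = record
                  { isEquivalence = record { refl = refl ; sym = sym ; trans = λ {a} {b} {c} → ≃-trans {a} {b} {c} }
                  ; ∙-cong = λ {a} {b} {c} {d} → ⊹-cong a b c d }
                ; assoc = λ a b c → solve 6 (λ n d m e k f →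
                    ((n :* e :+ m :* d) :* f :+ k :* (d :* e)) :* (d :* (e :* f)) :=
                    (n :* (e :* f) :+ (m :* f :+ k :* e) :* d) :* ((d :* e) :* f)) refl
                    (num a) (den a) (num b) (den b) (num c) (den c) }
              ; identity = (λ a → idˡ (num a) (den a))
                         , (λ a → solve 2 (λ n d → (n :* :1 :+ :0 :* d) :* d := n :* (d :* :1)) refl (num a) (den a)) }
            ; inverse = (λ a → solve 2 (λ n d → ((:- n) :* d :+ n :* d) :* :1 := :0 :* (d :* d)) refl (num a) (den a))
                      , (λ a → solve 2 (λ n d → (n :* d :+ (:- n) :* d) :* :1 := :0 :* (d :* d)) refl (num a) (den a))
            ; ⁻¹-cong = λ {a} {b} h → trans (solve 2 (λ n d → (:- n) :* d := :- (n :* d)) refl (num a) (den b))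
                (trans (-‿cong h) (solve 2 (λ n d → :- (n :* d) := (:- n) :* d) refl (num b) (den a))) }
          ; comm = λ a b → solve 4 (λ n d m e → (n :* e :+ m :* d) :* (e :* d) := (m :* d :+ n :* e) :* (d :* e)) refl
              (num a) (den a) (num b) (den b) }
        ; *-cong = λ {a} {b} {c} {d} h h′ → trans
            (solve 4 (λ n d m e → (n :* m) :* (d :* e) := (n :* d) :* (m :* e)) refl (num a) (den b) (num c) (den d))
            (trans (*-cong h h′)
            (solve 4 (λ n d m e → (n :* d) :* (m :* e) := (n :* m) :* (d :* e)) refl (num b) (den a) (num d) (den c)))
        ; *-assoc = λ a b c → solve 6 (λ n d m e k f →
            ((n :* m) :* k) :* (d :* (e :* f)) := (n :* (m :* k)) :* ((d :* e) :* f)) refl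
            (num a) (den a) (num b) (den b) (num c) (den c)
        ; *-identity = (λ a → solve 2 (λ n d → (:1 :* n) :* d := n :* (:1 :* d)) refl (num a) (den a))
                     , (λ a → solve 2 (λ n d → (n :* :1) :* d := n :* (d :* :1)) refl (num a) (den a))
        ; distrib = (λ a b c → solve 6 (λ n d m e k f →
              (n :* (m :* f :+ k :* e)) :* ((d :* e) :* (d :* f)) :=
              ((n :* m) :* (d :* f) :+ (n :* k) :* (d :* e)) :* (d :* (e :* f))) refl
              (num a) (den a) (num b) (den b) (num c) (den c))
                  , (λ a b c → solve 6 (λ n d m e k f →
              ((m :* f :+ k :* e) :* n) :* ((e :* d) :* (f :* d)) :=
              ((m :* n) :* (f :* d) :+ (k :* n) :* (e :* d)) :* ((e :* f) :* d)) refl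
              (num a) (den a) (num b) (den b) (num c) (den c)) }
      ; *-comm = λ a b → solve 4 (λ n d m e → (n :* m) :* (e :* d) := (m :* n) :* (d :* e)) refl
          (num a) (den a) (num b) (den b) } }
    where
    idˡ : ∀ n d → (0# * d + n * 1#) * d ≈ n * (1# * d)
    idˡ = solve 2 (λ n d → (:0 :* d :+ n :* :1) :* d := n :* (:1 :* d)) refl
    ⊹-cong : ∀ a b c d → a ≃ b → c ≃ d → a ⊹ c ≃ b ⊹ d
    ⊹-cong (n / d [ _ ]) (n′ / d′ [ _ ]) (m / e [ _ ]) (m′ / e′ [ _ ]) h h′ = begin
      (n * e + m * d) * (d′ * e′)
        ≈⟨ solve 6 (λ n d m e d′ e′ → (n :* e :+ m :* d) :* (d′ :* e′) := (n :* d′) :* (e :* e′) :+ (m :* e′) :*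
            (d :* d′)) refl n d m e d′ e′ ⟩
      (n * d′) * (e * e′) + (m * e′) * (d * d′)
        ≈⟨ +-cong (*-congʳ h) (*-congʳ h′) ⟩
      (n′ * d) * (e * e′) + (m′ * e) * (d * d′)
        ≈⟨ solve 6 (λ n′ d m′ e d′ e′ → (n′ :* d) :* (e :* e′) :+ (m′ :* e) :* (d :* d′) := (n′ :* e′ :+ m′ :* d′) :*
            (d :* e)) refl n′ d m′ e d′ e′ ⟩
      (n′ * e′ + m′ * d′) * (d * e) ∎

  private module Q = CommutativeRing fractionRing

  ι-cong : ∀ {f g} → f ≈ g → ι f ≃ ι g
  ι-cong = *-congʳ

  ι-injective : ∀ {f g} → ι f ≃ ι g → f ≈ g
  ι-injective h = trans (sym (*-identityʳ _)) (trans h (*-identityʳ _))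

  ι-+ : ∀ f g → ι (f + g) ≃ ι f Q.+ ι g
  ι-+ = solve 2 (λ f g → (f :+ g) :* (:1 :* :1) := (f :* :1 :+ g :* :1) :* :1) refl

  ι-* : ∀ f g → ι (f * g) ≃ ι f Q.* ι g
  ι-* = solve 2 (λ f g → (f :* g) :* (:1 :* :1) := (f :* g) :* :1) refl

  inverse : ∀ d → Regular d → Fraction
  inverse d p = 1# / d [ p ]

  *-inverse : ∀ d p → ι d Q.* inverse d p ≃ ι 1#
  *-inverse d p = solve 1 (λ d → (d :* :1) :* :1 := :1 :* (:1 :* d)) refl d

open import Defs using (boundedStrict; strictPartitions)

-- From compositions to strict partitions

module WordSums (R : CommutativeRing 0ℓ 0ℓ) (T : ℕ → CommutativeRing.Carrier R) where
  open CommutativeRing R hiding (zero)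
  open Sums R
  open IntegerCoefficients R
  open import Relation.Binary.Reasoning.Setoid setoid

  -- `T i` is the weight of the letter `suc i`. With `T i` = t^(i+1) these are generating functions
  -- by sum of letters: of words of length l over {1,...,m} here, of strict partitions with parts at
  -- most m in `strictSum`.
  wordSum : ℕ → ℕ → (List ℕ → Carrier) → Carrier
  wordSum m zero    H = H []
  wordSum m (suc l) H = ΣL (downFrom m) λ i → T i * wordSum m l (H ∘ (suc i ∷_))

  strictSum : ℕ → (List ℕ → Carrier) → Carrier
  strictSum zero    H = H []
  strictSum (suc m) H = T m * strictSum m (H ∘ (suc m ∷_)) + strictSum m H

  wordSum-cong : ∀ m l {H K} → (∀ α → length α ≡ l → H α ≈ K α) → wordSum m l H ≈ wordSum m l K
  wordSum-cong m zero    e = e [] ≡.refl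
  wordSum-cong m (suc l) e = ΣL-cong (downFrom m) λ i → *-congˡ (wordSum-cong m l λ α h → e (suc i ∷ α) (≡.cong suc h))

  wordSum-0 : ∀ m l → wordSum m l (λ _ → 0#) ≈ 0#
  wordSum-0 m zero    = refl
  wordSum-0 m (suc l) = trans (ΣL-cong (downFrom m) λ i → trans (*-congˡ (wordSum-0 m l)) (zeroʳ _)) (ΣL-0 (downFrom m))

  wordSum-* : ∀ m l c H → wordSum m l (λ α → c * H α) ≈ c * wordSum m l H
  wordSum-* m zero    c H = refl
  wordSum-* m (suc l) c H = trans
    (ΣL-cong (downFrom m) λ i → trans (*-congˡ (wordSum-* m l c _)) (solve 3 (λ t c w → t :* (c :* w) := c :*
        (t :* w)) refl _ _ _))
    (sym (ΣL-*ˡ c (downFrom m) _))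

  wordSum-ΣS : ∀ {A : Set} m l (xs : List A) (H : A → List A → List ℕ → Carrier) →
               wordSum m l (λ α → ΣS xs λ x xs′ → H x xs′ α) ≈ ΣS xs (λ x xs′ → wordSum m l (H x xs′))
  wordSum-ΣS m zero    xs H = refl
  wordSum-ΣS m (suc l) xs H = trans
    (ΣL-cong (downFrom m) λ i → trans (*-congˡ (wordSum-ΣS m l xs _)) (ΣS-*ˡ (T i) xs _))
    (sym (ΣS-ΣL xs (downFrom m) _))

  strictSum-cong : ∀ m {H K} → (∀ α → H α ≈ K α) → strictSum m H ≈ strictSum m K
  strictSum-cong zero    e = e []
  strictSum-cong (suc m) e = +-cong (*-congˡ (strictSum-cong m (e ∘ (suc m ∷_)))) (strictSum-cong m e)

  strictSum-* : ∀ m c H → strictSum m (λ α → c * H α) ≈ c * strictSum m H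
  strictSum-* zero    c H = refl
  strictSum-* (suc m) c H = trans (+-cong (*-congˡ (strictSum-* m c _)) (strictSum-* m c H))
    (solve 4 (λ t c a b → t :* (c :* a) :+ c :* b := c :* (t :* a :+ b)) refl (T m) c _ _)

  module _ (H : List ℕ → Carrier)
    (symmetric : ∀ γ a b α → H (γ ʳ++ a ∷ b ∷ α) ≈ H (γ ʳ++ b ∷ a ∷ α))
    (alternating : ∀ γ a α → H (γ ʳ++ a ∷ a ∷ α) ≈ 0#) where

    private
      -- `γ` is the prefix already read, in reverse, so that symmetry can be applied at any depth of
      -- a word.
      H[_] : List ℕ → List ℕ → Carrier
      H[ γ ] α = H (γ ʳ++ α)

    repeated : ∀ γ a α β → H (γ ʳ++ a ∷ α ++ a ∷ β) ≈ 0#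
    repeated γ a []      β = alternating γ a β
    repeated γ a (b ∷ α) β = trans (symmetric γ a b (α ++ a ∷ β)) (repeated (b ∷ γ) a α β)

    drop-letter : ∀ m l γ → (∀ α β → H (γ ʳ++ (α ++ suc m ∷ β)) ≈ 0#) → wordSum (suc m) l H[ γ ] ≈ wordSum m l H[ γ ]
    drop-letter m zero    γ z = refl
    drop-letter m (suc l) γ z = trans (+-cong
      (trans (*-congˡ (trans (wordSum-cong (suc m) l (λ α _ → z [] α)) (wordSum-0 (suc m) l))) (zeroʳ _))
      (ΣL-cong (downFrom m) λ i → *-congˡ (drop-letter m l (suc i ∷ γ) λ α β → z (suc i ∷ α) β)))
      (+-identityˡ _)

    -- The letter m + 1 occurs at most once, since repetitions make `H` vanish. It has l + 1
    -- possible places, and symmetry moves it from each of them to the front.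
    split-letter : ∀ m l γ → wordSum (suc m) (suc l) H[ γ ] ≈
                   wordSum m (suc l) H[ γ ] + fromℕ (suc l) * (T m * wordSum m l H[ suc m ∷ γ ])
    split-letter m l γ = begin
      T m * wordSum (suc m) l H[ suc m ∷ γ ] + ΣL (downFrom m) (λ i → T i * wordSum (suc m) l H[ suc i ∷ γ ])
        ≈⟨ +-cong (*-congˡ (drop-letter m l (suc m ∷ γ) (repeated γ (suc m)))) (others l) ⟩
      T m * wordSum m l H[ suc m ∷ γ ] + (wordSum m (suc l) H[ γ ] + fromℕ l * (T m * wordSum m l H[ suc m ∷ γ ]))
        ≈⟨ solve 3 (λ a b m → a :+ (b :+ m :* a) := b :+ (:1 :+ m) :* a) refl _ _ (fromℕ l) ⟩
      wordSum m (suc l) H[ γ ] + fromℕ (suc l) * (T m * wordSum m l H[ suc m ∷ γ ]) ∎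
      where
      others : ∀ l → ΣL (downFrom m) (λ i → T i * wordSum (suc m) l H[ suc i ∷ γ ]) ≈
                     wordSum m (suc l) H[ γ ] + fromℕ l * (T m * wordSum m l H[ suc m ∷ γ ])
      others zero    = solve 2 (λ a b → a := a :+ :0 :* b) refl _ _
      others (suc l) = begin
        ΣL (downFrom m) (λ i → T i * wordSum (suc m) (suc l) H[ suc i ∷ γ ])
          ≈⟨ ΣL-cong (downFrom m) (λ i → trans (*-congˡ (trans (split-letter m l (suc i ∷ γ))
               (+-congˡ (*-congˡ (*-congˡ (wordSum-cong m l λ α _ → symmetric γ (suc i) (suc m) α))))))
               (solve 5 (λ t a f s w → t :* (a :+ f :* (s :* w)) := t :* a :+ (f :* s) :* (t :* w)) refl _ _ _ _ _)) ⟩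
        ΣL (downFrom m) (λ i → T i * wordSum m (suc l) H[ suc i ∷ γ ] + (fromℕ (suc l) * T m) * (T i * wordSum m l
            (H[ suc m ∷ γ ] ∘ (suc i ∷_))))
          ≈⟨ trans (ΣL-+ (downFrom m) _ _) (+-congˡ (trans (sym (ΣL-*ˡ _ (downFrom m) _)) (*-assoc _ _ _))) ⟩
        wordSum m (suc (suc l)) H[ γ ] + fromℕ (suc l) * (T m * wordSum m (suc l) H[ suc m ∷ γ ]) ∎

    module _ (c : ℕ → Carrier) (c₀ : c 0 ≈ 1#) (c₊ : ∀ l → c (suc l) * fromℕ (suc l) ≈ c l + c l)
      (2^ : List ℕ → Carrier) (2^[] : 2^ [] ≈ 1#) (2^∷ : ∀ a α → 2^ (a ∷ α) ≈ (1# + 1#) * 2^ α) where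

      -- By `c₊` the l + 1 places of the largest letter become a factor 2 and the weight of the
      -- shorter word, so every part of a strict partition collects one 2. The unmatched top term
      -- belongs to words of length L + 1, where `H` is zero.
      words-to-strict : ∀ L m γ → (∀ α → L ℕ.< length α → H (γ ʳ++ α) ≈ 0#) →
                        ΣL (downFrom (suc L)) (λ l → c l * wordSum m l H[ γ ]) ≈ strictSum m (λ α → 2^ α * H (γ ʳ++ α))
      words-to-strict L zero    γ z = trans (base L) (*-congʳ (trans c₀ (sym 2^[])))
        where
        base : ∀ L → ΣL (downFrom (suc L)) (λ l → c l * wordSum 0 l H[ γ ]) ≈ c 0 * H[ γ ] []
        base zero    = +-identityʳ _
        base (suc L) = trans (+-congʳ (zeroʳ _)) (trans (+-identityˡ _) (base L))
      words-to-strict L (suc m) γ z = begin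
        ΣL (downFrom (suc L)) (λ l → c l * wordSum (suc m) l H[ γ ])
          ≈⟨ +-identityʳ _ ⟨
        ΣL (downFrom (suc L)) (λ l → c l * wordSum (suc m) l H[ γ ]) + 0#
          ≈⟨ +-congˡ (trans (sym (zeroʳ _)) (*-congˡ (trans (sym (zeroʳ _)) (*-congˡ (sym top))))) ⟩
        ΣL (downFrom (suc L)) (λ l → c l * wordSum (suc m) l H[ γ ]) + (c L + c L) * (T m * wordSum m L H[ suc m ∷ γ ])
          ≈⟨ partial L ⟩
        ΣL (downFrom (suc L)) (λ l → c l * wordSum m l H[ γ ]) + (T m * (1# + 1#)) * ΣL (downFrom (suc L))
            (λ l → c l * wordSum m l H[ suc m ∷ γ ])
          ≈⟨ +-cong (words-to-strict L m γ z) (*-congˡ (words-to-strict L m (suc m ∷ γ) λ α h → z (suc m ∷ α) (ℕ.m≤n⇒m≤1+n h))) ⟩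
        strictSum m (λ α → 2^ α * H (γ ʳ++ α)) + (T m * (1# + 1#)) * strictSum m (λ α → 2^ α * H (γ ʳ++ suc m ∷ α))
          ≈⟨ trans (+-comm _ _) (+-congʳ (trans (*-assoc _ _ _) (*-congˡ (sym (trans
               (strictSum-cong m (λ α → trans (*-congʳ (2^∷ (suc m) α)) (*-assoc _ _ _)))
               (strictSum-* m (1# + 1#) _)))))) ⟩
        T m * strictSum m (λ α → 2^ (suc m ∷ α) * H (γ ʳ++ suc m ∷ α)) + strictSum m (λ α → 2^ α * H (γ ʳ++ α)) ∎
        where
        top : wordSum m L H[ suc m ∷ γ ] ≈ 0#
        top = trans (wordSum-cong m L λ α h → z (suc m ∷ α) (ℕ.≤-reflexive (≡.cong suc (≡.sym h)))) (wordSum-0 m L)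
        partial : ∀ L → ΣL (downFrom (suc L)) (λ l → c l * wordSum (suc m) l H[ γ ]) + (c L + c L) *
            (T m * wordSum m L H[ suc m ∷ γ ]) ≈
          ΣL (downFrom (suc L)) (λ l → c l * wordSum m l H[ γ ]) + (T m * (1# + 1#)) * ΣL (downFrom (suc L))
              (λ l → c l * wordSum m l H[ suc m ∷ γ ])
        partial zero    = solve 4 (λ c h t k → (c :* h :+ :0) :+ (c :+ c) :* (t :* k) :=
          (c :* h :+ :0) :+ (t :* (:1 :+ :1)) :* (c :* k :+ :0)) refl (c 0) (H[ γ ] []) (T m) (H[ suc m ∷ γ ] [])
        partial (suc L) = begin
          (c (suc L) * wordSum (suc m) (suc L) H[ γ ] + Σ₁) + (c (suc L) + c (suc L)) * (T m * V)
            ≈⟨ +-congʳ (+-congʳ (*-congˡ (split-letter m L γ))) ⟩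
          (c (suc L) * (W + fromℕ (suc L) * (T m * U)) + Σ₁) + (c (suc L) + c (suc L)) * (T m * V)
            ≈⟨ solve 7 (λ c W f t U S V → (c :* (W :+ f :* (t :* U)) :+ S) :+ (c :+ c) :* (t :* V) :=
                 (c :* W :+ (S :+ (c :* f) :* (t :* U))) :+ (c :+ c) :* (t :* V)) refl (c (suc L)) W (fromℕ (suc L))
                     (T m) U Σ₁ V ⟩
          (c (suc L) * W + (Σ₁ + (c (suc L) * fromℕ (suc L)) * (T m * U))) + (c (suc L) + c (suc L)) * (T m * V)
            ≈⟨ +-congʳ (+-congˡ (trans (+-congˡ (*-congʳ (c₊ L))) (partial L))) ⟩
          (c (suc L) * W + (Σ₂ + (T m * (1# + 1#)) * Σ₃)) + (c (suc L) + c (suc L)) * (T m * V)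
            ≈⟨ solve 6 (λ c W S t Z V → (c :* W :+ (S :+ (t :* (:1 :+ :1)) :* Z)) :+ (c :+ c) :* (t :* V) :=
                 (c :* W :+ S) :+ (t :* (:1 :+ :1)) :* (c :* V :+ Z)) refl (c (suc L)) W Σ₂ (T m) Σ₃ V ⟩
          (c (suc L) * W + Σ₂) + (T m * (1# + 1#)) * (c (suc L) * V + Σ₃) ∎
          where
          W = wordSum m (suc L) H[ γ ]
          U = wordSum m L H[ suc m ∷ γ ]
          V = wordSum m (suc L) H[ suc m ∷ γ ]
          Σ₁ = ΣL (downFrom (suc L)) (λ l → c l * wordSum (suc m) l H[ γ ])
          Σ₂ = ΣL (downFrom (suc L)) (λ l → c l * wordSum m l H[ γ ])
          Σ₃ = ΣL (downFrom (suc L)) (λ l → c l * wordSum m l H[ suc m ∷ γ ])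

-- Symmetrisation over fractions and the ratios r(a,b)

module RowRemoval (F : CommutativeRing 0ℓ 0ℓ) {A : Set} (x : A → CommutativeRing.Carrier F)
  (r : A → A → CommutativeRing.Carrier F) where
  open CommutativeRing F hiding (zero)
  open Sums F
  open Removals F
  open IntegerCoefficients F

  -- For strict μ this is the symmetrisation formula of P_μ at t = -1, one row at a time: a row
  -- chooses a variable and pairs it with all those left. It is defined for arbitrary words because
  -- words are what the Cauchy sum produces first.
  rowSum : List ℕ → List A → Carrier
  rowSum []      xs = 1#
  rowSum (l ∷ μ) xs = ΣS xs λ a as → (x a ^ l) * (ΠL as (r a) * rowSum μ as)

  rowSum-vanishes : ∀ μ xs → length xs ℕ.< length μ → rowSum μ xs ≈ 0#
  rowSum-vanishes (l ∷ μ) xs h = trans (ΣS-cong xs λ a as σ → trans (*-congˡ (trans (*-congˡ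
    (rowSum-vanishes μ as (≡.subst (ℕ._≤ length μ) (Sel-length σ) (ℕ.≤-pred h)))) (zeroʳ _))) (zeroʳ _)) (ΣS-0 xs)

  module _ (r-anti : ∀ a b → r a b ≈ - r b a) where

    -- Two adjacent rows choose u and v; exchanging the roles of u and v changes the weight only in
    -- r(u,v).
    rowSum-swap : ∀ γ a b α xs → rowSum (γ ʳ++ a ∷ b ∷ α) xs ≈ - rowSum (γ ʳ++ b ∷ a ∷ α) xs
    rowSum-swap γ a b α = under γ head-swap
      where
      under : ∀ γ {α β} → (∀ xs → rowSum α xs ≈ - rowSum β xs) → ∀ xs → rowSum (γ ʳ++ α) xs ≈ - rowSum (γ ʳ++ β) xs
      under []      e = e
      under (c ∷ γ) e = under γ λ xs → trans
        (ΣS-cong xs λ a as _ → trans (*-congˡ (*-congˡ (e as))) (solve 3 (λ a b c → a :* (b :* (:- c)) := :- (a :*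
            (b :* c))) refl _ _ _))
        (ΣS-neg xs _)
      head-swap : ∀ xs → rowSum (a ∷ b ∷ α) xs ≈ - rowSum (b ∷ a ∷ α) xs
      head-swap xs = trans (expand a b) (trans (ΣS-twice-anti xs λ u v zs → trans (*-congʳ (*-congʳ (r-anti u v)))
        (solve 6 (λ r P Q X Y G → ((:- r) :* (P :* Q)) :* (X :* Y :* G) := :- ((r :* (Q :* P)) :* (Y :* X :* G))) refl
          (r v u) (ΠL zs (r u)) (ΠL zs (r v)) (x u ^ a) (x v ^ b) (rowSum α zs))) (-‿cong (sym (expand b a))))
        where
        expand : ∀ a b → rowSum (a ∷ b ∷ α) xs ≈
          ΣS xs (λ u us → ΣS us λ v zs → (r u v * (ΠL zs (r u) * ΠL zs (r v))) * (x u ^ a * x v ^ b * rowSum α zs))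
        expand a b = ΣS-cong xs λ u us _ → trans (sym (*-assoc _ _ _)) (trans (ΣS-*ˡ _ us _) (ΣS-cong us λ v zs σ →
          trans (*-congʳ (*-congˡ (ΠL-Sel (r u) σ)))
            (solve 6 (λ r P Q X Y G → (X :* (r :* P)) :* (Y :* (Q :* G)) := (r :* (P :* Q)) :* (X :* Y :* G)) refl
              (r u v) (ΠL zs (r u)) (ΠL zs (r v)) (x u ^ a) (x v ^ b) (rowSum α zs))))

-- The family `inverse` is total and antisymmetric even on the diagonal, so that ratios are
-- antisymmetric unconditionally; only the inverse law asks for distinct indices.
record InvertibleDifferences (F : CommutativeRing 0ℓ 0ℓ) {A : Set} (x : A → CommutativeRing.Carrier F) : Set where
  open CommutativeRing F
  field
    inverse      : A → A → Carrier
    inverse-anti : ∀ a b → inverse a b ≈ - inverse b a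
    *-inverse    : ∀ {a b} → a ≢ b → (x a - x b) * inverse a b ≈ 1#

module DifferenceRatios (F : CommutativeRing 0ℓ 0ℓ) {A : Set} {x : A → CommutativeRing.Carrier F}
  (differences : InvertibleDifferences F x) where
  open CommutativeRing F hiding (zero)
  open IntegerCoefficients F
  open InvertibleDifferences differences
  open import Relation.Binary.Reasoning.Setoid setoid

  ratio : A → A → Carrier
  ratio a b = (x a + x b) * inverse a b

  ratio-anti : ∀ a b → ratio a b ≈ - ratio b a
  ratio-anti a b = trans (*-congˡ (inverse-anti a b))
    (solve 3 (λ a b i → (a :+ b) :* (:- i) := :- ((b :+ a) :* i)) refl (x a) (x b) (inverse b a))

  ratio-difference : ∀ {a b} → a ≢ b → ratio a b * (x a - x b) ≈ x a + x b
  ratio-difference {a} {b} d = trans (solve 3 (λ s i d → (s :* i) :* d := s :* (d :* i)) refl _ _ _)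
    (trans (*-congˡ (*-inverse d)) (*-identityʳ _))

  -- The addition theorem of coth: for a = e^(2α) and b = e^(2β) the ratio is coth(α - β). The proof
  -- clears denominators with the three inverse laws.
  ratio-three : ∀ {y a b} → y ≢ a → y ≢ b → a ≢ b →
                ratio y a * ratio y b ≈ 1# + ratio a b * (ratio y a - ratio y b)
  ratio-three {y} {a} {b} d e f = begin
    (Y + P) * i₁ * ((Y + Q) * i₂)
      ≈⟨ solve 5 (λ Y P Q i j → (Y :+ P) :* i :* ((Y :+ Q) :* j) := :1 :* ((Y :+ P) :* i :* ((Y :+ Q) :* j))) refl Y P Q i₁ i₂ ⟩
    1# * ((Y + P) * i₁ * ((Y + Q) * i₂))
      ≈⟨ *-congʳ (*-inverse f) ⟨
    ((P - Q) * i₃) * ((Y + P) * i₁ * ((Y + Q) * i₂))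
      ≈⟨ solve 6 (λ Y P Q i j k → ((P :- Q) :* k) :* ((Y :+ P) :* i :* ((Y :+ Q) :* j)) :=
           ((Y :- P) :* i) :* ((Y :- Q) :* j) :* ((P :- Q) :* k) :+
           (P :+ Q) :* k :* (((Y :- Q) :* j) :* ((Y :+ P) :* i) :- ((Y :- P) :* i) :* ((Y :+ Q) :* j)))
           refl Y P Q i₁ i₂ i₃ ⟩
    ((Y - P) * i₁) * ((Y - Q) * i₂) * ((P - Q) * i₃) + (P + Q) * i₃ * (((Y - Q) * i₂) * ((Y + P) * i₁) - ((Y - P) * i₁) *
        ((Y + Q) * i₂))
      ≈⟨ +-cong (*-cong (*-cong (*-inverse d) (*-inverse e)) (*-inverse f)) (*-congˡ (+-cong (*-congʳ (*-inverse e)) (-‿cong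
          (*-congʳ (*-inverse d))))) ⟩
    1# * 1# * 1# + (P + Q) * i₃ * (1# * ((Y + P) * i₁) - 1# * ((Y + Q) * i₂))
      ≈⟨ solve 3 (λ a b c → :1 :* :1 :* :1 :+ a :* (:1 :* b :- :1 :* c) := :1 :+ a :* (b :- c)) refl _ _ _ ⟩
    1# + (P + Q) * i₃ * ((Y + P) * i₁ - (Y + Q) * i₂) ∎
    where
    Y = x y ; P = x a ; Q = x b ; i₁ = inverse y a ; i₂ = inverse y b ; i₃ = inverse a b

module Cayley (R : CommutativeRing 0ℓ 0ℓ) where
  open CommutativeRing R hiding (zero)
  open IntegerCoefficients R
  open import Relation.Binary.Reasoning.Setoid setoid

  module _ (X g Y h r : Carrier) (X-inv : (1# - X) * g ≈ 1#) (Y-inv : (1# - Y) * h ≈ 1#) (r-XY : r * (X - Y) ≈ X + Y) where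

    cancel : ∀ {a b} → (1# - X) * (1# - Y) * a ≈ (1# - X) * (1# - Y) * b → a ≈ b
    cancel {a} {b} e = begin
      a                                                  ≈⟨ unit a ⟩
      (g * h) * ((1# - X) * (1# - Y) * a)                ≈⟨ *-congˡ e ⟩
      (g * h) * ((1# - X) * (1# - Y) * b)                ≈⟨ unit b ⟨
      b                                                  ∎
      where
      unit : ∀ a → a ≈ (g * h) * ((1# - X) * (1# - Y) * a)
      unit a = begin
        a                ≈⟨ solve 1 (λ a → a := (:1 :* :1) :* a) refl a ⟩
        (1# * 1#) * a    ≈⟨ *-congʳ (*-cong X-inv Y-inv) ⟨
        (((1# - X) * g) * ((1# - Y) * h)) * a
          ≈⟨ solve 5 (λ X g Y h a → ((X :* g) :* (Y :* h)) :* a := (g :* h) :* (X :* Y :* a)) refl (1# - X) g (1# - Y) h a ⟩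
        (g * h) * ((1# - X) * (1# - Y) * a) ∎

    -- Since -(1 + X)/(1 - X) is (X + 1)/(X - 1), this is the three-term relation at the points X, Y
    -- and 1. In the application X - Y is a multiple of t and not invertible as a series, so r
    -- enters through r (X - Y) = X + Y.
    cayley-ratio : r * - ((1# + X) * g) ≈ 1# + - ((1# + Y) * h) * (r - - ((1# + X) * g))
    cayley-ratio = cancel (begin
      (1# - X) * (1# - Y) * (r * - ((1# + X) * g))
        ≈⟨ solve 4 (λ X g Y r → (:1 :- X) :* (:1 :- Y) :* (r :* (:- ((:1 :+ X) :* g))) :=
             (:- (r :* (:1 :+ X) :* (:1 :- Y))) :* ((:1 :- X) :* g)) refl X g Y r ⟩
      (- (r * (1# + X) * (1# - Y))) * ((1# - X) * g)
        ≈⟨ *-congˡ X-inv ⟩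
      (- (r * (1# + X) * (1# - Y))) * 1#
        ≈⟨ solve 3 (λ X Y r → (:- (r :* (:1 :+ X) :* (:1 :- Y))) :* :1 :=
             (:1 :- X) :* (:1 :- Y) :- (:1 :+ Y) :* (r :* (:1 :- X) :+ (:1 :+ X))
             :+ (X :+ Y :- r :* (X :- Y)) :* :2) refl X Y r ⟩
      (1# - X) * (1# - Y) - (1# + Y) * (r * (1# - X) + (1# + X)) + (X + Y - r * (X - Y)) * (1# + 1#)
        -- After clearing 1 - X and 1 - Y the two sides differ by exactly 2 (X + Y - r (X - Y)).
        ≈⟨ +-congˡ (trans (*-congʳ (trans (+-congˡ (-‿cong r-XY)) (-‿inverseʳ _))) (zeroˡ _)) ⟩
      (1# - X) * (1# - Y) - (1# + Y) * (r * (1# - X) + (1# + X)) + 0#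
        ≈⟨ solve 3 (λ X Y r → (:1 :- X) :* (:1 :- Y) :- (:1 :+ Y) :* (r :* (:1 :- X) :+ (:1 :+ X)) :+ :0 :=
             (:1 :- X) :* (:1 :- Y) :- (:1 :+ Y) :* :1 :* (r :* (:1 :- X) :+ (:1 :+ X) :* :1)) refl X Y r ⟩
      (1# - X) * (1# - Y) - (1# + Y) * 1# * (r * (1# - X) + (1# + X) * 1#)
        ≈⟨ +-congˡ (-‿cong (*-cong (*-congˡ (sym Y-inv)) (+-congˡ (*-congˡ (sym X-inv))))) ⟩
      (1# - X) * (1# - Y) - (1# + Y) * ((1# - Y) * h) * (r * (1# - X) + (1# + X) * ((1# - X) * g))
        ≈⟨ solve 5 (λ X g Y h r → (:1 :- X) :* (:1 :- Y) :- (:1 :+ Y) :* ((:1 :- Y) :* h) :* (r :* (:1 :- X) :+ (:1 :+ X) :*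
            ((:1 :- X) :* g)) :=
             (:1 :- X) :* (:1 :- Y) :* (:1 :+ (:- ((:1 :+ Y) :* h)) :* (r :- (:- ((:1 :+ X) :* g))))) refl X g Y h r ⟩
      (1# - X) * (1# - Y) * (1# + - ((1# + Y) * h) * (r - - ((1# + X) * g))) ∎)

    -- With 1 - X and 1 - Y cleared, the two sides differ by r (X - Y) - (X + Y).
    geometric-ratio : r * (X * g) ≈ ((1# + Y) * h) * (X * g) + (1# + r) * (Y * h)
    geometric-ratio = cancel (begin
      (1# - X) * (1# - Y) * (r * (X * g))
        ≈⟨ solve 4 (λ X g Y r → (:1 :- X) :* (:1 :- Y) :* (r :* (X :* g)) := (r :* X :* (:1 :- Y)) :*
            ((:1 :- X) :* g)) refl X g Y r ⟩
      (r * X * (1# - Y)) * ((1# - X) * g)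
        ≈⟨ trans (*-congˡ X-inv) (*-identityʳ _) ⟩
      r * X * (1# - Y)
        ≈⟨ solve 3 (λ X Y r → r :* X :* (:1 :- Y) :=
             (:1 :+ Y) :* X :+ (:1 :+ r) :* Y :* (:1 :- X) :+ (r :* (X :- Y) :- (X :+ Y))) refl X Y r ⟩
      (1# + Y) * X + (1# + r) * Y * (1# - X) + (r * (X - Y) - (X + Y))
        ≈⟨ +-congˡ (trans (+-congʳ r-XY) (-‿inverseʳ _)) ⟩
      (1# + Y) * X + (1# + r) * Y * (1# - X) + 0#
        ≈⟨ solve 3 (λ X Y r → (:1 :+ Y) :* X :+ (:1 :+ r) :* Y :* (:1 :- X) :+ :0 :=
             (:1 :+ Y) :* X :* (:1 :* :1) :+ (:1 :+ r) :* Y :* (:1 :- X) :* :1) refl X Y r ⟩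
      (1# + Y) * X * (1# * 1#) + (1# + r) * Y * (1# - X) * 1#
        ≈⟨ +-cong (*-congˡ (*-cong (sym X-inv) (sym Y-inv))) (*-congˡ (sym Y-inv)) ⟩
      (1# + Y) * X * (((1# - X) * g) * ((1# - Y) * h)) + (1# + r) * Y * (1# - X) * ((1# - Y) * h)
        ≈⟨ solve 5 (λ X g Y h r → (:1 :+ Y) :* X :* (((:1 :- X) :* g) :* ((:1 :- Y) :* h)) :+ (:1 :+ r) :* Y :* (:1 :- X) :*
            ((:1 :- Y) :* h) :=
             (:1 :- X) :* (:1 :- Y) :* (((:1 :+ Y) :* h) :* (X :* g) :+ (:1 :+ r) :* (Y :* h))) refl X g Y h r ⟩
      (1# - X) * (1# - Y) * (((1# + Y) * h) * (X * g) + (1# + r) * (Y * h)) ∎)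

  cayley : ∀ X g → (1# - X) * g ≈ 1# → (1# + X) * g ≈ 1# + (X * g + X * g)
  cayley X g e = begin
    (1# + X) * g                        ≈⟨ solve 2 (λ X g → (:1 :+ X) :* g := (:1 :- X) :* g :+ (X :* g :+ X :* g)) refl X g ⟩
    (1# - X) * g + (X * g + X * g)      ≈⟨ +-congʳ e ⟩
    1# + (X * g + X * g)                ∎

-- Coefficient extraction and the Cauchy identity for row sums

module Shifts (F : CommutativeRing 0ℓ 0ℓ) where
  open CommutativeRing F hiding (zero)
  open Sums F
  open PowerSeries F
  private
    P = powerSeriesRing
    module PS = Sums P
    module P = CommutativeRing P

  t : Series
  t = monomial 1#

  shift : ℕ → Series → Series
  shift zero    f n       = f n
  shift (suc k) f zero    = 0#
  shift (suc k) f (suc n) = shift k f n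

  shift-cong : ∀ k {f g} n → (∀ j → j ℕ.≤ n → f j ≈ g j) → shift k f n ≈ shift k g n
  shift-cong zero    n       e = e n ℕ.≤-refl
  shift-cong (suc k) zero    e = refl
  shift-cong (suc k) (suc n) e = shift-cong k n λ j h → e j (ℕ.m≤n⇒m≤1+n h)

  shift-* : ∀ k c f n → shift k (λ j → c * f j) n ≈ c * shift k f n
  shift-* zero    c f n       = refl
  shift-* (suc k) c f zero    = sym (zeroʳ c)
  shift-* (suc k) c f (suc n) = shift-* k c f n

  t^-∙ : ∀ k f n → (t PS.^ k ∙ f) n ≈ shift k f n
  t^-∙ zero    f n       = trans (constant-∙ 1# f n) (*-identityˡ _)
  t^-∙ (suc k) f zero    = trans (*-congʳ (monomial-∙-zero 1# (t PS.^ k))) (zeroˡ _)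
  t^-∙ (suc k) f (suc n) = trans (∙-assoc t (t PS.^ k) f (suc n))
    (trans (monomial-∙-suc 1# _ n) (trans (*-identityˡ _) (t^-∙ k f n)))

  shift-∸ : ∀ k f n → shift k f n ≈ (if does (k ℕ.≤? n) then f (n ℕ.∸ k) else 0#)
  shift-∸ zero          f n       = refl
  shift-∸ (suc k)       f zero    = refl
  shift-∸ (suc zero)    f (suc n) = refl
  shift-∸ (suc (suc k)) f (suc n) = shift-∸ (suc k) f n

  ΣL-downFrom-suc : ∀ m (f : ℕ → Carrier) → ΣL (downFrom (suc m)) f ≈ f 0 + ΣL (downFrom m) (f ∘ suc)
  ΣL-downFrom-suc zero    f = refl
  ΣL-downFrom-suc (suc m) f = trans (+-congˡ (ΣL-downFrom-suc m f)) (x∙yz≈y∙xz _ _ _)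
    where open import Algebra.Properties.CommutativeSemigroup +-commutativeSemigroup using (x∙yz≈y∙xz)

  -- Powers of t beyond n do not reach the coefficient of t^n, so the geometric series may be cut at
  -- any m ≥ n. This permits one fixed alphabet {1,...,m} throughout the induction on words.
  geometric-coefficient : ∀ s h m n → n ℕ.≤ m →
    ((monomial s ∙ geometric s) ∙ h) n ≈ ΣL (downFrom m) (λ i → s ^ suc i * shift (suc i) h n)
  geometric-coefficient s h m       zero    _         = trans (trans (*-congʳ (zeroˡ _)) (zeroˡ _))
    (sym (trans (ΣL-cong (downFrom m) λ i → zeroʳ _) (ΣL-0 (downFrom m))))
  geometric-coefficient s h (suc m) (suc n) (ℕ.s≤s n≤m) = begin
    ((monomial s ∙ geometric s) ∙ h) (suc n)
      ≈⟨ trans (∙-assoc (monomial s) (geometric s) h (suc n)) (monomial-∙-suc s (geometric s ∙ h) n) ⟩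
    s * (geometric s ∙ h) n
      ≈⟨ *-congˡ (trans (∙-cong {g = h} unfold (λ _ → refl) n) (trans (∙-distribʳ h _ _ n)
           (+-cong (trans (constant-∙ 1# h n) (*-identityˡ _)) (geometric-coefficient s h m n n≤m)))) ⟩
    s * (h n + ΣL (downFrom m) (λ i → s ^ suc i * shift (suc i) h n))
      ≈⟨ trans (distribˡ _ _ _) (+-cong (*-congʳ (sym (*-identityʳ s))) (trans (ΣL-*ˡ s (downFrom m) _) (ΣL-cong (downFrom m)
          λ i → sym (*-assoc _ _ _)))) ⟩
    s * 1# * h n + ΣL (downFrom m) (λ i → s ^ suc (suc i) * shift (suc i) h n)
      ≈⟨ ΣL-downFrom-suc m (λ i → s ^ suc i * shift i h n) ⟨
    ΣL (downFrom (suc m)) (λ i → s ^ suc i * shift i h n) ∎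
    where
    open import Relation.Binary.Reasoning.Setoid setoid
    unfold : ∀ n → geometric s n ≈ constant 1# n + (monomial s ∙ geometric s) n
    unfold zero    = sym (trans (+-congˡ (zeroˡ _)) (+-identityʳ _))
    unfold (suc n) = sym (trans (+-identityˡ _) (monomial-∙-suc s (geometric s) n))

  ΣL-coefficient : ∀ {A : Set} (as : List A) (f : A → Series) n → PS.ΣL as f n ≈ ΣL as (λ a → f a n)
  ΣL-coefficient []       f n = refl
  ΣL-coefficient (a ∷ as) f n = +-congˡ (ΣL-coefficient as f n)

  ΣS-coefficient : ∀ {A : Set} (as : List A) (f : A → List A → Series) n → PS.ΣS as f n ≈ ΣS as (λ a bs → f a bs n)
  ΣS-coefficient []       f n = refl
  ΣS-coefficient (a ∷ as) f n = +-congˡ (ΣS-coefficient as _ n)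

  constant-+ : ∀ a b → constant (a + b) P.≈ constant a P.+ constant b
  constant-+ a b zero    = refl
  constant-+ a b (suc n) = sym (+-identityˡ _)

  constant-* : ∀ a b → constant (a * b) P.≈ constant a P.* constant b
  constant-* a b n = trans (split n) (sym (constant-∙ a (constant b) n))
    where
    split : ∀ n → constant (a * b) n ≈ a * constant b n
    split zero    = refl
    split (suc n) = sym (zeroʳ _)

  constant-neg : ∀ a → constant (- a) P.≈ P.- constant a
  constant-neg a zero    = refl
  constant-neg a (suc n) = sym ε⁻¹≈ε
    where open import Algebra.Properties.AbelianGroup +-abelianGroup using (ε⁻¹≈ε)

  constant-cong : ∀ {a b} → a ≈ b → constant a P.≈ constant b
  constant-cong e zero    = e
  constant-cong e (suc n) = refl

  constant-ΠL : ∀ {A : Set} (as : List A) f → PS.ΠL as (λ a → constant (f a)) P.≈ constant (ΠL as f)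
  constant-ΠL []       f = P.refl {P.1#}
  constant-ΠL (a ∷ as) f = P.trans {constant (f a) ∙ PS.ΠL as (λ a → constant (f a))}
    (P.*-congˡ {constant (f a)} (constant-ΠL as f)) (P.sym {constant (f a * ΠL as f)} (constant-* _ _))

  constant-ΣS : ∀ {A : Set} (as : List A) f → PS.ΣS as (λ a bs → constant (f a bs)) P.≈ constant (ΣS as f)
  constant-ΣS as f zero    = ΣS-coefficient as _ 0
  constant-ΣS as f (suc n) = trans (ΣS-coefficient as _ (suc n)) (ΣS-0 as)

  fromℕ-constant : ∀ n → PS.fromℕ n P.≈ constant (fromℕ n)
  fromℕ-constant zero    zero    = refl
  fromℕ-constant zero    (suc n) = refl
  fromℕ-constant (suc n) k       = trans (+-congˡ (fromℕ-constant n k)) (sym (constant-+ 1# (fromℕ n) k))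

  open WordSums P (λ i → t PS.^ suc i) public

  -- The recursion on the largest part is that of `boundedStrict`; multiplication by t^(m+1) lowers
  -- the remaining sum by m + 1, or gives zero when the part is too large.
  strictSum-coefficient : ∀ m (h : List ℕ → Carrier) n →
    strictSum m (constant ∘ h) n ≈ ΣL (boundedStrict m n) h
  strictSum-coefficient zero    h zero    = sym (+-identityʳ _)
  strictSum-coefficient zero    h (suc n) = refl
  strictSum-coefficient (suc m) h n = trans
    (+-cong (trans (t^-∙ (suc m) _ n) (trans (shift-∸ (suc m) _ n) first)) (strictSum-coefficient m h n))
    (sym (ΣL-++ (if does (suc m ℕ.≤? n) then map (suc m ∷_) (boundedStrict m (n ℕ.∸ suc m)) else []) (boundedStrict m n) h))
    where
    first : (if does (suc m ℕ.≤? n) then strictSum m (constant ∘ h ∘ (suc m ∷_)) (n ℕ.∸ suc m) else 0#) ≈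
            ΣL (if does (suc m ℕ.≤? n) then map (suc m ∷_) (boundedStrict m (n ℕ.∸ suc m)) else []) h
    first with does (suc m ℕ.≤? n)
    ... | true  = trans (strictSum-coefficient m (h ∘ (suc m ∷_)) (n ℕ.∸ suc m))
      (reflexive (≡.sym (ΣL-map (suc m ∷_) (boundedStrict m (n ℕ.∸ suc m)) h)))
    ... | false = refl

module CauchyIdentity (F : CommutativeRing 0ℓ 0ℓ) {A B : Set}
  {x : A → CommutativeRing.Carrier F} {y : B → CommutativeRing.Carrier F}
  (x-differences : InvertibleDifferences F x) (y-differences : InvertibleDifferences F y) where

  open CommutativeRing F hiding (zero)
  open Sums F
  open PowerSeries F
  open Shifts F
  open DifferenceRatios F x-differences using () renaming (ratio to r; ratio-anti to r-anti; ratio-difference to r-difference; ratio-three to r-three)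
  open DifferenceRatios F y-differences using () renaming (ratio to s; ratio-anti to s-anti; ratio-difference to s-difference; ratio-three to s-three)
  open IntegerCoefficients F
  open import Relation.Binary.Reasoning.Setoid setoid
  private
    P = powerSeriesRing
    module PS = Sums P
    module P = CommutativeRing P
    module C = Cayley P

  open RowRemoval F x r public using () renaming (rowSum to G; rowSum-swap to G-swap; rowSum-vanishes to G-vanishes)
  open RowRemoval F y s public using () renaming (rowSum to H; rowSum-swap to H-swap)

  kernel : Carrier → Series
  kernel z = (P.1# P.+ monomial z) ∙ geometric z

  private
    r̂ : A → A → Series
    r̂ a b = constant (r a b)
    ŝ : B → B → Series
    ŝ a b = constant (s a b)
    u q : A → B → Series
    u a b = monomial (x a * y b) ∙ geometric (x a * y b)
    q a b = kernel (x a * y b)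

    constant-anti : ∀ {a b} → a ≈ - b → constant a P.≈ P.- constant b
    constant-anti {a} {b} e n = trans (constant-cong e n) (constant-neg b n)

    constant-three : ∀ {a b c} → a * b ≈ 1# + c * (a - b) →
      constant a P.* constant b P.≈ P.1# P.+ constant c P.* (constant a P.- constant b)
    constant-three {a} {b} {c} e n = begin
      (constant a ∙ constant b) n                            ≈⟨ constant-* a b n ⟨
      constant (a * b) n                                     ≈⟨ constant-cong e n ⟩
      constant (1# + c * (a - b)) n                          ≈⟨ constant-+ 1# (c * (a - b)) n ⟩
      constant 1# n + constant (c * (a - b)) n               ≈⟨ +-congˡ (constant-* c (a - b) n) ⟩
      constant 1# n + (constant c ∙ constant (a - b)) n      ≈⟨ +-congˡ (∙-cong {constant c} (λ _ → refl) (λ k → trans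
          (constant-+ a (- b) k) (+-congˡ (constant-neg b k))) n) ⟩
      constant 1# n + (constant c ∙ (λ k → constant a k - constant b k)) n ∎

    constant-monomials : ∀ {a b b′} → a * (b - b′) ≈ b + b′ →
      constant a P.* (monomial b P.- monomial b′) P.≈ monomial b P.+ monomial b′
    constant-monomials {a} {b} {b′} e n = trans (constant-∙ a _ n) (go n)
      where
      go : ∀ n → a * (monomial b n - monomial b′ n) ≈ monomial b n + monomial b′ n
      go zero          = solve 1 (λ a → a :* (:0 :- :0) := :0 :+ :0) refl a
      go (suc zero)    = e
      go (suc (suc n)) = solve 1 (λ a → a :* (:0 :- :0) := :0 :+ :0) refl a

    r-q : ∀ {a b} w → a ≢ b → r̂ a b P.* (P.- q a w) P.≈ P.1# P.+ (P.- q b w) P.* (r̂ a b P.- (P.- q a w))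
    r-q {a} {b} w d = C.cayley-ratio (monomial (x a * y w)) (geometric (x a * y w)) (monomial (x b * y w)) (geometric (x b * y w))
        (r̂ a b)
      (geometric-inverse _) (geometric-inverse _)
      (constant-monomials (trans (solve 4 (λ r a b w → r :* (a :* w :- b :* w) := (r :* (a :- b)) :* w) refl (r a b) (x a) (x b)
          (y w))
        (trans (*-congʳ (r-difference d)) (distribʳ _ _ _))))

    s-u : ∀ a {b w} → b ≢ w → ŝ b w P.* u a b P.≈ q a w P.* u a b P.+ (P.1# P.+ ŝ b w) P.* u a w
    s-u a {b} {w} d = C.geometric-ratio (monomial (x a * y b)) (geometric (x a * y b)) (monomial (x a * y w)) (geometric
        (x a * y w)) (ŝ b w)
      (geometric-inverse _) (geometric-inverse _)
      (constant-monomials (trans (solve 4 (λ s a b w → s :* (a :* b :- a :* w) := a :* (s :* (b :- w))) refl (s b w) (x a) (y b)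
          (y w))
        (trans (*-congˡ (s-difference d)) (distribˡ _ _ _))))

  GH : List A → List B → List ℕ → Carrier
  GH xs ys α = G α xs * H α ys

  two^ : List ℕ → Carrier
  two^ α = (1# + 1#) ^ length α

  module _ (½ : Carrier) (½+½≈1 : ½ + ½ ≈ 1#)
    (c : ℕ → Carrier) (c₀ : c 0 ≈ 1#) (c₊ : ∀ l → c (suc l) * fromℕ (suc l) ≈ c l + c l) where

    private
      half : constant ½ P.+ constant ½ P.≈ P.1#
      half n = trans (sym (constant-+ ½ ½ n)) (constant-cong ½+½≈1 n)

      c₀′ : constant (c 0) P.≈ P.1#
      c₀′ = constant-cong c₀

      c₊′ : ∀ l → constant (c (suc l)) P.* PS.fromℕ (suc l) P.≈ constant (c l) P.+ constant (c l)
      c₊′ l n = begin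
        (constant (c (suc l)) ∙ PS.fromℕ (suc l)) n              ≈⟨ ∙-cong {constant (c (suc l))} (λ _ → refl) (fromℕ-constant
            (suc l)) n ⟩
        (constant (c (suc l)) ∙ constant (fromℕ (suc l))) n      ≈⟨ constant-* _ _ n ⟨
        constant (c (suc l) * fromℕ (suc l)) n                   ≈⟨ trans (constant-cong (c₊ l) n) (constant-+ _ _ n) ⟩
        constant (c l) n + constant (c l) n                      ∎

      module I = CauchyKernel.Identity P r̂ ŝ _≢_ _≢_ (λ a b → constant-anti (r-anti a b)) (λ a b → constant-anti (s-anti a b))
        (λ ne → ne ∘ ≡.sym) (λ ne → ne ∘ ≡.sym)
        (λ d e f → constant-three (r-three d e f))
        (λ d e f → constant-three (s-three d e f))
        (constant ½) half u q (λ a b → C.cayley (monomial (x a * y b)) (geometric (x a * y b)) (geometric-inverse _))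
        r-q (λ a {b} {w} → s-u a {b} {w})

    private
      -- Expanding xyt/(1 - xyt) gives the removed pair a common exponent k + 1. So removing l pairs
      -- is removing rows from the x's and from the y's simultaneously, for the same word of
      -- exponents.
      J-coefficient : ∀ m l xs ys n → n ℕ.≤ m → I.J l xs ys n ≈ wordSum m l (constant ∘ GH xs ys) n
      J-coefficient m zero    xs ys n _   = sym (constant-cong (*-identityˡ 1#) n)
      J-coefficient m (suc l) xs ys n n≤m = begin
        I.J (suc l) xs ys n
          ≈⟨ trans (ΣS-coefficient xs _ n) (ΣS-cong xs λ a as _ → ΣS-coefficient ys _ n) ⟩
        ΣS xs (λ a as → ΣS ys λ b bs → ((PS.ΠL as (r̂ a) ∙ PS.ΠL bs (ŝ b)) ∙ (u a b ∙ I.J l as bs)) n)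
          ≈⟨ ΣS-cong xs (λ a as _ → ΣS-cong ys λ b bs _ → term a as b bs) ⟩
        ΣS xs (λ a as → ΣS ys λ b bs → ΣL (downFrom m) λ k → κ a as b bs k * shift (suc k) (wordSum m l (constant ∘ GH as bs)) n)
          ≈⟨ trans (ΣS-cong xs λ a as _ → ΣS-ΣL ys (downFrom m) _) (ΣS-ΣL xs (downFrom m) _) ⟩
        ΣL (downFrom m) (λ k → ΣS xs λ a as → ΣS ys λ b bs → κ a as b bs k * shift (suc k) (wordSum m l (constant ∘ GH as bs)) n)
          ≈⟨ ΣL-cong (downFrom m) (λ k → sym (letter k)) ⟩
        ΣL (downFrom m) (λ k → (t PS.^ suc k ∙ wordSum m l (constant ∘ GH xs ys ∘ (suc k ∷_))) n)
          ≈⟨ ΣL-coefficient (downFrom m) _ n ⟨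
        wordSum m (suc l) (constant ∘ GH xs ys) n ∎
        where
        κ : A → List A → B → List B → ℕ → Carrier
        κ a as b bs k = (ΠL as (r a) * ΠL bs (s b)) * (x a * y b) ^ suc k

        term : ∀ a as b bs → ((PS.ΠL as (r̂ a) ∙ PS.ΠL bs (ŝ b)) ∙ (u a b ∙ I.J l as bs)) n ≈
          ΣL (downFrom m) (λ k → κ a as b bs k * shift (suc k) (wordSum m l (constant ∘ GH as bs)) n)
        term a as b bs = begin
          ((PS.ΠL as (r̂ a) ∙ PS.ΠL bs (ŝ b)) ∙ (u a b ∙ I.J l as bs)) n
            ≈⟨ ∙-cong {g = u a b ∙ I.J l as bs} (λ k → trans (∙-cong (constant-ΠL as (r a)) (constant-ΠL bs (s b)) k) (sym
                (constant-* _ _ k))) (λ _ → refl) n ⟩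
          (constant (ΠL as (r a) * ΠL bs (s b)) ∙ (u a b ∙ I.J l as bs)) n
            ≈⟨ constant-∙ _ _ n ⟩
          ΠL as (r a) * ΠL bs (s b) * (u a b ∙ I.J l as bs) n
            ≈⟨ *-congˡ (geometric-coefficient (x a * y b) (I.J l as bs) m n n≤m) ⟩
          ΠL as (r a) * ΠL bs (s b) * ΣL (downFrom m) (λ k → (x a * y b) ^ suc k * shift (suc k) (I.J l as bs) n)
            ≈⟨ trans (ΣL-*ˡ _ (downFrom m) _) (ΣL-cong (downFrom m) λ k → trans (sym (*-assoc _ _ _))
                 (*-congˡ (shift-cong (suc k) n λ k′ h → J-coefficient m l as bs k′ (ℕ.≤-trans h n≤m)))) ⟩
          ΣL (downFrom m) (λ k → κ a as b bs k * shift (suc k) (wordSum m l (constant ∘ GH as bs)) n) ∎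

        expand : ∀ k α → GH xs ys (suc k ∷ α) ≈ ΣS xs (λ a as → ΣS ys λ b bs → κ a as b bs k * GH as bs α)
        expand k α = trans (*-comm _ _) (trans (ΣS-*ˡ _ xs _) (ΣS-cong xs λ a as _ → trans (*-comm _ _) (trans (ΣS-*ˡ _ ys _)
            (ΣS-cong ys λ b bs _ →
          trans (solve 6 (λ X P G Y Q H → (X :* (P :* G)) :* (Y :* (Q :* H)) := ((P :* Q) :* (X :* Y)) :* (G :* H)) refl
            (x a ^ suc k) (ΠL as (r a)) (G α as) (y b ^ suc k) (ΠL bs (s b)) (H α bs))
            (*-congʳ (*-congˡ (sym (*-^ (x a) (y b) (suc k)))))))))

        letter : ∀ k → (t PS.^ suc k ∙ wordSum m l (constant ∘ GH xs ys ∘ (suc k ∷_))) n ≈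
          ΣS xs (λ a as → ΣS ys λ b bs → κ a as b bs k * shift (suc k) (wordSum m l (constant ∘ GH as bs)) n)
        letter k = begin
          (t PS.^ suc k ∙ wordSum m l (constant ∘ GH xs ys ∘ (suc k ∷_))) n
            ≈⟨ t^-∙ (suc k) _ n ⟩
          shift (suc k) (wordSum m l (constant ∘ GH xs ys ∘ (suc k ∷_))) n
            ≈⟨ shift-cong (suc k) n (λ e _ → wordSum-cong m l (λ α _ e′ → trans (constant-cong (expand k α) e′)
                 (sym (trans (PS.ΣS-cong xs (λ a as _ → λ e″ → trans (PS.ΣS-cong ys (λ b bs _ → P.sym {constant
                     (κ a as b bs k * GH as bs α)} (constant-* _ _)) e″) (constant-ΣS ys _ e″)) e′)
                   (constant-ΣS xs _ e′)))) e) ⟩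
          shift (suc k) (wordSum m l (λ α → PS.ΣS xs λ a as → PS.ΣS ys λ b bs → constant (κ a as b bs k) ∙ constant
              (GH as bs α))) n
            ≈⟨ shift-cong (suc k) n (λ e _ → trans (wordSum-ΣS m l xs (λ a as α → PS.ΣS ys λ b bs → constant
                (κ a as b bs k) ∙ constant (GH as bs α)) e)
                 (PS.ΣS-cong xs (λ a as _ e′ → trans (wordSum-ΣS m l ys (λ b bs α → constant (κ a as b bs k) ∙ constant
                     (GH as bs α)) e′)
                   (PS.ΣS-cong ys (λ b bs _ → wordSum-* m l (constant (κ a as b bs k)) (constant ∘ GH as bs)) e′)) e)) ⟩
          shift (suc k) (PS.ΣS xs λ a as → PS.ΣS ys λ b bs → constant (κ a as b bs k) ∙ wordSum m l (constant ∘ GH as bs)) n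
            ≈⟨ trans (shift-ΣS (suc k) xs _ n) (ΣS-cong xs λ a as _ → trans (shift-ΣS (suc k) ys _ n) (ΣS-cong ys λ b bs _ →
                 trans (shift-cong (suc k) n (λ e _ → constant-∙ (κ a as b bs k) (wordSum m l (constant ∘ GH as bs)) e)) (shift-*
                     (suc k) _ _ n))) ⟩
          ΣS xs (λ a as → ΣS ys λ b bs → κ a as b bs k * shift (suc k) (wordSum m l (constant ∘ GH as bs)) n) ∎
          where
          shift-ΣS : ∀ {A : Set} k (as : List A) (f : A → List A → Series) n → shift k (PS.ΣS as f) n ≈ ΣS as (λ a bs → shift k
              (f a bs) n)
          shift-ΣS zero    as f n       = ΣS-coefficient as f n
          shift-ΣS (suc k) as f zero    = sym (ΣS-0 as)
          shift-ΣS (suc k) as f (suc n) = shift-ΣS k as f n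

    cauchy : ∀ n xs ys → Unique xs → Unique ys →
             PS.ΠL ys (λ b → PS.ΠL xs (λ a → kernel (x a * y b))) n ≈
             ΣL (strictPartitions n) (λ μ → two^ μ * (G μ xs * H μ ys))
    cauchy n xs ys dx dy = begin
      PS.ΠL ys (λ b → PS.ΠL xs (λ a → kernel (x a * y b))) n
        ≈⟨ I.weighted≈ΠΠ (constant ∘ c) c₀′ c₊′ (length xs) xs ys ℕ.≤-refl dx dy n ⟨
      PS.ΣL (downFrom (suc L)) (λ l → constant (c l) ∙ I.J l xs ys) n
        ≈⟨ ΣL-coefficient (downFrom (suc L)) _ n ⟩
      ΣL (downFrom (suc L)) (λ l → (constant (c l) ∙ I.J l xs ys) n)
        ≈⟨ ΣL-cong (downFrom (suc L)) (λ l → trans (constant-∙ (c l) (I.J l xs ys) n)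
             (trans (*-congˡ (J-coefficient n l xs ys n ℕ.≤-refl)) (sym (constant-∙ (c l) _ n)))) ⟩
      ΣL (downFrom (suc L)) (λ l → (constant (c l) ∙ wordSum n l (constant ∘ GH xs ys)) n)
        ≈⟨ ΣL-coefficient (downFrom (suc L)) _ n ⟨
      PS.ΣL (downFrom (suc L)) (λ l → constant (c l) ∙ wordSum n l (constant ∘ GH xs ys)) n
        -- A word longer than `xs` asks for more variables than there are, so `G` vanishes on it;
        -- two signs cancel in the product of `G` and `H`, which makes it symmetric.
        ≈⟨ words-to-strict (constant ∘ GH xs ys) (λ γ a b α → constant-cong (GH-sym γ a b α)) (λ γ a α → P.trans {constant
            (GH xs ys (γ ʳ++ a ∷ a ∷ α))} (constant-cong (GH-alt γ a α)) constant-0)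
             (constant ∘ c) c₀′ c₊′ (constant ∘ two^) (constant-cong {two^ []} {1#} refl)
             (λ a α → P.trans {constant ((1# + 1#) * two^ α)} (constant-* _ _) (∙-cong {g = constant (two^ α)} (constant-+ 1# 1#)
                 (λ _ → refl)))
             L n [] (λ α h → P.trans {constant (GH xs ys α)} (constant-cong (trans (*-congʳ (G-vanishes α xs h))
                 (zeroˡ _))) constant-0) n ⟩
      strictSum n (λ α → constant (two^ α) ∙ constant (GH xs ys α)) n
        ≈⟨ strictSum-cong n (λ α → P.sym {constant (two^ α * GH xs ys α)} (constant-* _ _)) n ⟩
      strictSum n (constant ∘ (λ α → two^ α * GH xs ys α)) n
        ≈⟨ strictSum-coefficient n (λ α → two^ α * GH xs ys α) n ⟩
      ΣL (strictPartitions n) (λ μ → two^ μ * (G μ xs * H μ ys)) ∎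
      where
      L = length xs
      constant-0 : constant 0# P.≈ P.0#
      constant-0 zero    = refl
      constant-0 (suc n) = refl
      GH-sym : ∀ γ a b α → GH xs ys (γ ʳ++ a ∷ b ∷ α) ≈ GH xs ys (γ ʳ++ b ∷ a ∷ α)
      GH-sym γ a b α = trans (*-cong (G-swap r-anti γ a b α xs) (H-swap s-anti γ a b α ys))
        (solve 2 (λ a b → (:- a) :* (:- b) := a :* b) refl _ _)
      GH-alt : ∀ γ a α → GH xs ys (γ ʳ++ a ∷ a ∷ α) ≈ 0#
      GH-alt γ a α = trans (*-congʳ (begin
        g                ≈⟨ trans (sym (*-identityʳ g)) (*-congˡ (sym ½+½≈1)) ⟩
        g * (½ + ½)      ≈⟨ solve 2 (λ g h → g :* (h :+ h) := (g :+ g) :* h) refl g ½ ⟩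
        (g + g) * ½      ≈⟨ *-congʳ (trans (+-congˡ (G-swap r-anti γ a a α xs)) (-‿inverseʳ g)) ⟩
        0# * ½           ≈⟨ zeroˡ ½ ⟩
        0#               ∎)) (zeroˡ _)
        where g = G (γ ʳ++ a ∷ a ∷ α) xs

-- Alternants

data Swap {A : Set} : List A → List A → Set where
  head : ∀ {a b as} → Swap (a ∷ b ∷ as) (b ∷ a ∷ as)
  tail : ∀ {a as bs} → Swap as bs → Swap (a ∷ as) (a ∷ bs)

prefix-Swap : ∀ {A : Set} γ {as bs : List A} → Swap as bs → Swap (γ ʳ++ as) (γ ʳ++ bs)
prefix-Swap []      s = s
prefix-Swap (c ∷ γ) s = prefix-Swap γ (tail s)

module Alternants (R : CommutativeRing 0ℓ 0ℓ) where
  open CommutativeRing R hiding (zero)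
  open Sums R
  open IntegerCoefficients R
  open import Relation.Binary.Reasoning.Setoid setoid

  -- Laplace expansion: the sign alternates with the position of the selected entry.
  altS : ∀ {A : Set} → List A → (A → List A → Carrier) → Carrier
  altS []       f = 0#
  altS (a ∷ as) f = f a as - altS as (λ b bs → f b (a ∷ bs))

  altS-cong : ∀ {A : Set} (as : List A) {f g} → (∀ b bs → Sel b bs as → f b bs ≈ g b bs) → altS as f ≈ altS as g
  altS-cong []       e = refl
  altS-cong (a ∷ as) e = +-cong (e a as here) (-‿cong (altS-cong as λ b bs s → e b (a ∷ bs) (there s)))

  altS-*ˡ : ∀ {A : Set} c (as : List A) f → c * altS as f ≈ altS as (λ b bs → c * f b bs)
  altS-*ˡ c []       f = zeroʳ c
  altS-*ˡ c (a ∷ as) f = trans (solve 3 (λ c x y → c :* (x :- y) := c :* x :- c :* y) refl _ _ _)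
    (+-congˡ (-‿cong (altS-*ˡ c as _)))

  altS-map : ∀ {A B : Set} (h : A → B) as f → altS (map h as) f ≡ altS as (λ b bs → f (h b) (map h bs))
  altS-map h []       f = ≡.refl
  altS-map h (a ∷ as) f = ≡.cong (λ z → f (h a) (map h as) - z) (altS-map h as _)

  vandermonde : List Carrier → Carrier
  vandermonde []       = 1#
  vandermonde (x ∷ xs) = ΠL xs (λ y → x - y) * vandermonde xs

  -- For strict μ with at most as many parts as variables, this is Δ · P_μ, the numerator over the
  -- common denominator. It contains no division, so ring homomorphisms preserve it, and it links
  -- the polynomial definition to row sums over fractions.
  alternant : List ℕ → List Carrier → Carrier
  alternant []      xs = vandermonde xs
  alternant (l ∷ μ) xs = altS xs λ x ys → x ^ l * ΠL ys (λ y → x + y) * alternant μ ys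

  altS-neg : ∀ {A : Set} (as : List A) f → altS as (λ b bs → - f b bs) ≈ - altS as f
  altS-neg as f = trans (altS-cong as λ _ _ _ → minus _) (trans (sym (altS-*ˡ (- 1#) as f)) (sym (minus _)))
    where
    minus : ∀ x → - x ≈ - 1# * x
    minus x = solve 1 (λ x → :- x := (:- :1) :* x) refl x

  altS-Swap : ∀ {A : Set} {as bs : List A} {f} → Swap as bs →
              (∀ c cs ds → Swap cs ds → f c cs ≈ - f c ds) → altS as f ≈ - altS bs f
  altS-Swap {as = a ∷ b ∷ as} {f = f} head e = begin
    f a (b ∷ as) - (f b (a ∷ as) - altS as (λ c cs → f c (a ∷ b ∷ cs)))
      ≈⟨ +-congˡ (-‿cong (+-congˡ (-‿cong (trans (altS-cong as λ c cs _ → e c _ _ head) (altS-neg as _))))) ⟩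
    f a (b ∷ as) - (f b (a ∷ as) - - altS as (λ c cs → f c (b ∷ a ∷ cs)))
      ≈⟨ solve 3 (λ x y z → x :- (y :- (:- z)) := :- (y :- (x :- z))) refl _ _ _ ⟩
    - (f b (a ∷ as) - (f a (b ∷ as) - altS as (λ c cs → f c (b ∷ a ∷ cs)))) ∎
  altS-Swap {as = a ∷ as} {bs = _ ∷ bs} {f = f} (tail s) e = begin
    f a as - altS as (λ c cs → f c (a ∷ cs))
      ≈⟨ +-cong (e a as bs s) (-‿cong (altS-Swap s λ c cs ds t → e c _ _ (tail t))) ⟩
    - f a bs - - altS bs (λ c cs → f c (a ∷ cs))
      ≈⟨ solve 2 (λ x y → (:- x) :- (:- y) := :- (x :- y)) refl _ _ ⟩
    - (f a bs - altS bs (λ c cs → f c (a ∷ cs))) ∎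

  ΠL-Swap : ∀ {A : Set} {as bs : List A} f → Swap as bs → ΠL as f ≈ ΠL bs f
  ΠL-Swap f head     = solve 3 (λ a b c → a :* (b :* c) := b :* (a :* c)) refl _ _ _
  ΠL-Swap f (tail s) = *-congˡ (ΠL-Swap f s)

  vandermonde-Swap : ∀ {as bs} → Swap as bs → vandermonde as ≈ - vandermonde bs
  vandermonde-Swap {as = a ∷ b ∷ as} head = solve 5
    (λ a b A B V → ((a :- b) :* A) :* (B :* V) := :- (((b :- a) :* B) :* (A :* V))) refl
    a b (ΠL as (λ y → a - y)) (ΠL as (λ y → b - y)) (vandermonde as)
  vandermonde-Swap (tail s) = trans (*-cong (ΠL-Swap _ s) (vandermonde-Swap s))
    (solve 2 (λ x y → x :* (:- y) := :- (x :* y)) refl _ _)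

  alternant-Swap : ∀ μ {as bs} → Swap as bs → alternant μ as ≈ - alternant μ bs
  alternant-Swap []      s = vandermonde-Swap s
  alternant-Swap (l ∷ μ) s = altS-Swap s λ c cs ds t →
    trans (*-cong (*-congˡ (ΠL-Swap _ t)) (alternant-Swap μ t))
      (solve 2 (λ x y → x :* (:- y) := :- (x :* y)) refl _ _)

  -- Adjacent swaps bring the equal entries together; swapping those two then shows that the value
  -- is its own negative.
  alternant-repeated : ∀ (½ : Carrier) → ½ + ½ ≈ 1# → ∀ μ γ x ys zs → alternant μ (γ ʳ++ x ∷ ys ++ x ∷ zs) ≈ 0#
  alternant-repeated ½ half μ γ x (y ∷ ys) zs = trans (alternant-Swap μ (prefix-Swap γ head))
    (trans (-‿cong (alternant-repeated ½ half μ (y ∷ γ) x ys zs)) (solve 0 (:- :0 := :0) refl))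
  alternant-repeated ½ half μ γ x [] zs = begin
    g                ≈⟨ trans (sym (*-identityʳ g)) (*-congˡ (sym half)) ⟩
    g * (½ + ½)      ≈⟨ solve 2 (λ g h → g :* (h :+ h) := (g :+ g) :* h) refl g ½ ⟩
    (g + g) * ½      ≈⟨ *-congʳ (trans (+-congˡ (alternant-Swap μ (prefix-Swap γ head))) (-‿inverseʳ g)) ⟩
    0# * ½           ≈⟨ zeroˡ ½ ⟩
    0#               ∎
    where g = alternant μ (γ ʳ++ x ∷ x ∷ zs)

  -- Moving the selected entry to the front of the Vandermonde product costs one sign per entry
  -- passed, which are precisely the signs in `altS`.
  altS-vandermonde : ∀ {A : Set} (x : A → Carrier) as (g : A → List A → Carrier) →
    altS as (λ b bs → (ΠL bs (λ c → x b - x c) * vandermonde (map x bs)) * g b bs) ≈ vandermonde (map x as) * ΣS as g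
  altS-vandermonde x []       g = sym (zeroʳ _)
  altS-vandermonde {A} x (a ∷ as) g = begin
    (P * V) * g a as - altS as (λ b bs → ((x b - x a) * ΠL bs (λ c → x b - x c) * (ΠL (map x bs) (λ y → x a - y) * vandermonde
        (map x bs))) * g b (a ∷ bs))
      ≈⟨ +-congˡ (-‿cong (trans (altS-cong as λ b bs s → trans
           (solve 6 (λ b a B A V G → ((b :- a) :* B :* (A :* V)) :* G := (:- ((a :- b) :* A)) :* ((B :* V) :* G)) refl
             (x b) (x a) (ΠL bs (λ c → x b - x c)) (ΠL (map x bs) (λ y → x a - y)) (vandermonde (map x bs)) (g b (a ∷ bs)))
           (*-congʳ (-‿cong (trans (*-congˡ (reflexive (ΠL-map x bs _))) (sym (ΠL-Sel (λ c → x a - x c) s))))))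
           (sym (altS-*ˡ (- P) as _)))) ⟩
    (P * V) * g a as - - P * altS as (λ b bs → (ΠL bs (λ c → x b - x c) * vandermonde (map x bs)) * g b (a ∷ bs))
      ≈⟨ +-congˡ (-‿cong (*-congˡ (altS-vandermonde x as (λ b bs → g b (a ∷ bs))))) ⟩
    (P * V) * g a as - - P * (V * ΣS as (λ b bs → g b (a ∷ bs)))
      ≈⟨ solve 4 (λ P V G S → (P :* V) :* G :- (:- P) :* (V :* S) := (P :* V) :* (G :+ S)) refl P V (g a as) _ ⟩
    (P * V) * (g a as + ΣS as (λ b bs → g b (a ∷ bs)))
      ≈⟨ *-congʳ (*-congʳ (reflexive (≡.sym (ΠL-map x as _)))) ⟩
    vandermonde (map x (a ∷ as)) * ΣS (a ∷ as) g ∎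
    where
    P = ΠL as (λ c → x a - x c)
    V = vandermonde (map x as)

  module _ {A : Set} {x : A → Carrier} (differences : InvertibleDifferences R x) where
    open DifferenceRatios R differences
    open RowRemoval R x ratio

    -- Writing x_b + x_c as (x_b - x_c) r(b,c) in each row releases the differences needed to
    -- complete the Vandermonde product of the remaining variables.
    alternant-rowSum : ∀ μ as → Unique as → alternant μ (map x as) ≈ vandermonde (map x as) * rowSum μ as
    alternant-rowSum []      as _ = sym (*-identityʳ _)
    alternant-rowSum (l ∷ μ) as d = begin
      altS (map x as) (λ y ys → y ^ l * ΠL ys (λ z → y + z) * alternant μ ys)
        ≡⟨ altS-map x as _ ⟩
      altS as (λ b bs → x b ^ l * ΠL (map x bs) (λ z → x b + z) * alternant μ (map x bs))
        ≈⟨ altS-cong as (λ b bs s → term b bs (proj₁ (Sel-AllPairs (λ ne → ne ∘ ≡.sym) s d)) (proj₂ (Sel-AllPairs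
            (λ ne → ne ∘ ≡.sym) s d))) ⟩
      altS as (λ b bs → (ΠL bs (λ c → x b - x c) * vandermonde (map x bs)) * (x b ^ l * (ΠL bs (ratio b) * rowSum μ bs)))
        ≈⟨ altS-vandermonde x as _ ⟩
      vandermonde (map x as) * rowSum (l ∷ μ) as ∎
      where
      term : ∀ b bs → All (b ≢_) bs → Unique bs →
        x b ^ l * ΠL (map x bs) (λ z → x b + z) * alternant μ (map x bs) ≈
        (ΠL bs (λ c → x b - x c) * vandermonde (map x bs)) * (x b ^ l * (ΠL bs (ratio b) * rowSum μ bs))
      term b bs Db Dbs = begin
        x b ^ l * ΠL (map x bs) (λ z → x b + z) * alternant μ (map x bs)
          ≈⟨ *-cong (*-congˡ (trans (reflexive (ΠL-map x bs _)) (trans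
               (ΠL-congᴬ Db λ c Dbc → trans (sym (ratio-difference Dbc)) (*-comm _ _))
               (ΠL-* bs _ _)))) (alternant-rowSum μ bs Dbs) ⟩
        x b ^ l * (ΠL bs (λ c → x b - x c) * ΠL bs (ratio b)) * (vandermonde (map x bs) * rowSum μ bs)
          ≈⟨ solve 5 (λ X P Q V G → X :* (P :* Q) :* (V :* G) := (P :* V) :* (X :* (Q :* G))) refl _ _ _ _ _ ⟩
        (ΠL bs (λ c → x b - x c) * vandermonde (map x bs)) * (x b ^ l * (ΠL bs (ratio b) * rowSum μ bs)) ∎

record Homomorphism (R S : CommutativeRing 0ℓ 0ℓ) : Set where
  private
    module R = CommutativeRing R
    module S = CommutativeRing S
  field
    φ      : R.Carrier → S.Carrier
    φ-cong : ∀ {a b} → a R.≈ b → φ a S.≈ φ b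
    φ-+    : ∀ a b → φ (a R.+ b) S.≈ φ a S.+ φ b
    φ-*    : ∀ a b → φ (a R.* b) S.≈ φ a S.* φ b
    φ-neg  : ∀ a → φ (R.- a) S.≈ S.- φ a
    φ-0    : φ R.0# S.≈ S.0#
    φ-1    : φ R.1# S.≈ S.1#

module RingMap {R S : CommutativeRing 0ℓ 0ℓ} (h : Homomorphism R S) where
  open Homomorphism h public
  private
    module R = CommutativeRing R
    module S = CommutativeRing S
    module ΣR = Sums R
    module ΣS = Sums S
    module AR = Alternants R
    module AS = Alternants S
  open S using (trans; reflexive; *-cong; +-congˡ; *-congˡ; -‿cong)

  φ-^ : ∀ a n → φ (a ΣR.^ n) S.≈ φ a ΣS.^ n
  φ-^ a zero    = φ-1
  φ-^ a (suc n) = trans (φ-* _ _) (*-congˡ (φ-^ a n))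

  φ-ΣL : ∀ {A : Set} (as : List A) f → φ (ΣR.ΣL as f) S.≈ ΣS.ΣL as (φ ∘ f)
  φ-ΣL []       f = φ-0
  φ-ΣL (a ∷ as) f = trans (φ-+ _ _) (+-congˡ (φ-ΣL as f))

  φ-ΠL : ∀ {A : Set} (as : List A) f → φ (ΣR.ΠL as f) S.≈ ΣS.ΠL as (φ ∘ f)
  φ-ΠL []       f = φ-1
  φ-ΠL (a ∷ as) f = trans (φ-* _ _) (*-congˡ (φ-ΠL as f))

  φ-minus : ∀ a b → φ (a R.- b) S.≈ φ a S.- φ b
  φ-minus a b = trans (φ-+ _ _) (+-congˡ (φ-neg b))

  φ-vandermonde : ∀ xs → φ (AR.vandermonde xs) S.≈ AS.vandermonde (map φ xs)
  φ-vandermonde []       = φ-1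
  φ-vandermonde (x ∷ xs) = trans (φ-* _ _) (*-cong
    (trans (φ-ΠL xs _) (trans (ΣS.ΠL-cong xs λ y → φ-minus x y) (reflexive (≡.sym (ΣS.ΠL-map φ xs _)))))
    (φ-vandermonde xs))

  φ-altS : ∀ {A : Set} (as : List A) f → φ (AR.altS as f) S.≈ AS.altS as (λ b bs → φ (f b bs))
  φ-altS []       f = φ-0
  φ-altS (a ∷ as) f = trans (φ-minus _ _) (+-congˡ (-‿cong (φ-altS as _)))

  φ-alternant : ∀ μ xs → φ (AR.alternant μ xs) S.≈ AS.alternant μ (map φ xs)
  φ-alternant []      xs = φ-vandermonde xs
  φ-alternant (l ∷ μ) xs = trans (φ-altS xs _) (trans
    (AS.altS-cong xs λ y ys _ → trans (φ-* _ _) (*-cong (trans (φ-* _ _) (*-cong (φ-^ y l)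
      (trans (φ-ΠL ys _) (trans (ΣS.ΠL-cong ys λ z → φ-+ y z) (reflexive (≡.sym (ΣS.ΠL-map φ ys _)))))))
      (φ-alternant μ ys)))
    (reflexive (≡.sym (AS.altS-map φ xs _))))

module VandermondeUnit (R : CommutativeRing 0ℓ 0ℓ) where
  open CommutativeRing R hiding (zero)
  open Sums R
  open Alternants R
  open Fractions R using (Regular; Regular-*; Regular-1)

  unit-regular : ∀ {d e} → d * e ≈ 1# → Regular d
  unit-regular {d} {e} h f z = trans (sym (*-identityˡ f)) (trans (*-congʳ (sym h))
    (trans (trans (*-congʳ (*-comm d e)) (*-assoc e d f)) (trans (*-congˡ z) (zeroʳ e))))

  vandermonde-regular : ∀ {A : Set} {x : A → Carrier} → InvertibleDifferences R x →
                        ∀ as → Unique as → Regular (vandermonde (map x as))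
  vandermonde-regular differences []       _        = Regular-1
  vandermonde-regular {A} {x} differences (a ∷ as) (d ∷ ds) = Regular-* (row as d) (vandermonde-regular differences as ds)
    where
    row : ∀ as → All (a ≢_) as → Regular (ΠL (map x as) (λ y → x a - y))
    row []       _        = Regular-1
    row (b ∷ as) (d ∷ ds) = Regular-* (unit-regular (InvertibleDifferences.*-inverse differences d)) (row as ds)

module _ (R : CommutativeRing 0ℓ 0ℓ) where
  open CommutativeRing R hiding (zero)
  open Alternants R

  alternant-tabulate-repeated : ∀ (½ : Carrier) → ½ + ½ ≈ 1# → ∀ μ γ {N} (u : Fin N → Carrier) i j → i Fin.< j → u i ≡ u j →
                                alternant μ (γ ʳ++ tabulate u) ≈ 0#
  alternant-tabulate-repeated h half μ γ u zero    (suc j) _ e with split (u ∘ suc) j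
    where
    split : ∀ {N} (u : Fin N → Carrier) j → ∃₂ λ ys zs → tabulate u ≡ ys ++ u j ∷ zs
    split u zero    = [] , tabulate (u ∘ suc) , ≡.refl
    split u (suc j) with split (u ∘ suc) j
    ... | ys , zs , e = u zero ∷ ys , zs , ≡.cong (u zero ∷_) e
  ... | ys , zs , e′ rewrite e′ | ≡.sym e = alternant-repeated h half μ γ (u zero) ys zs
  alternant-tabulate-repeated h half μ γ u (suc i) (suc j) (ℕ.s≤s i<j) e =
    alternant-tabulate-repeated h half μ (u zero ∷ γ) (u ∘ suc) i j i<j e

-- Sums over permutations and the logarithmic derivative of the kernel

data VecSwap : ∀ {n} → Vec ℕ n → Vec ℕ n → Set where
  head : ∀ {n a b} {m : Vec ℕ n} → VecSwap (a ∷ b ∷ m) (b ∷ a ∷ m)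
  tail : ∀ {n a} {m m′ : Vec ℕ n} → VecSwap m m′ → VecSwap (a ∷ m) (a ∷ m′)

module CycleSums (R : CommutativeRing 0ℓ 0ℓ) where
  open CommutativeRing R hiding (zero)
  open Sums R
  open IntegerCoefficients R
  open import Relation.Binary.Reasoning.Setoid setoid

  bumpSum : ∀ {n} → ℕ → Vec ℕ n → (Vec ℕ n → Carrier) → Carrier
  bumpSum a []      F = 0#
  bumpSum a (b ∷ m) F = F ((a ℕ.+ b) ∷ m) + bumpSum a m (λ m′ → F (b ∷ m′))

  -- The sum over all permutations of ∏ f(weight of the cycle) when the points carry the weights m:
  -- the first point is fixed or is merged into its successor.
  cycleSum : (ℕ → Carrier) → ∀ n → Vec ℕ n → Carrier
  cycleSum f zero    []      = 1#
  cycleSum f (suc n) (a ∷ m) = f a * cycleSum f n m + bumpSum a m (cycleSum f n)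

  bumpSum-cong : ∀ {n} a (m : Vec ℕ n) {F G} → (∀ m → F m ≈ G m) → bumpSum a m F ≈ bumpSum a m G
  bumpSum-cong a []      e = refl
  bumpSum-cong a (b ∷ m) e = +-cong (e _) (bumpSum-cong a m λ m′ → e (b ∷ m′))

  bumpSum-+ : ∀ {n} a (m : Vec ℕ n) F G → bumpSum a m (λ m′ → F m′ + G m′) ≈ bumpSum a m F + bumpSum a m G
  bumpSum-+ a []      F G = sym (+-identityˡ 0#)
  bumpSum-+ a (b ∷ m) F G = trans (+-congˡ (bumpSum-+ a m _ _))
    (solve 4 (λ a b c d → (a :+ b) :+ (c :+ d) := (a :+ c) :+ (b :+ d)) refl _ _ _ _)

  bumpSum-* : ∀ {n} a (m : Vec ℕ n) c F → bumpSum a m (λ m′ → c * F m′) ≈ c * bumpSum a m F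
  bumpSum-* a []      c F = sym (zeroʳ c)
  bumpSum-* a (b ∷ m) c F = trans (+-congˡ (bumpSum-* a m c _)) (sym (distribˡ _ _ _))

  bumpSum-comm : ∀ {n} a b (m : Vec ℕ n) F → bumpSum a m (λ m′ → bumpSum b m′ F) ≈ bumpSum b m (λ m′ → bumpSum a m′ F)
  bumpSum-comm a b []      F = refl
  bumpSum-comm a b (c ∷ m) F = begin
    (F (b ℕ.+ (a ℕ.+ c) ∷ m) + A) + bumpSum a m (λ m′ → F (b ℕ.+ c ∷ m′) + bumpSum b m′ (λ m″ → F (c ∷ m″)))
      ≈⟨ +-cong (+-congʳ (reflexive (≡.cong (λ z → F (z ∷ m)) shuffle))) (bumpSum-+ a m _ _) ⟩
    (F (a ℕ.+ (b ℕ.+ c) ∷ m) + A) + (B + bumpSum a m (λ m′ → bumpSum b m′ (λ m″ → F (c ∷ m″))))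
      ≈⟨ solve 4 (λ f a b d → (f :+ a) :+ (b :+ d) := (f :+ b) :+ (a :+ d)) refl _ _ _ _ ⟩
    (F (a ℕ.+ (b ℕ.+ c) ∷ m) + B) + (A + bumpSum a m (λ m′ → bumpSum b m′ (λ m″ → F (c ∷ m″))))
      ≈⟨ +-congˡ (trans (+-congˡ (bumpSum-comm a b m _)) (sym (bumpSum-+ b m _ _))) ⟩
    (F (a ℕ.+ (b ℕ.+ c) ∷ m) + B) + bumpSum b m (λ m′ → F (a ℕ.+ c ∷ m′) + bumpSum a m′ (λ m″ → F (c ∷ m″))) ∎
    where
    A = bumpSum b m (λ m′ → F (a ℕ.+ c ∷ m′))
    B = bumpSum a m (λ m′ → F (b ℕ.+ c ∷ m′))
    shuffle : b ℕ.+ (a ℕ.+ c) ≡ a ℕ.+ (b ℕ.+ c)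
    shuffle = ≡.trans (≡.sym (ℕ.+-assoc b a c)) (≡.trans (≡.cong (ℕ._+ c) (ℕ.+-comm b a)) (ℕ.+-assoc a b c))

  SwapInvariant : ∀ {n} → (Vec ℕ n → Carrier) → Set
  SwapInvariant F = ∀ {m m′} → VecSwap m m′ → F m ≈ F m′

  bumpSum-swap : ∀ {n} a {m m′ : Vec ℕ n} {F} → SwapInvariant F → VecSwap m m′ → bumpSum a m F ≈ bumpSum a m′ F
  bumpSum-swap a {b ∷ c ∷ m} inv head = trans
    (+-cong (inv head) (+-cong (inv head) (bumpSum-cong a m λ _ → inv head)))
    (solve 3 (λ a b c → a :+ (b :+ c) := b :+ (a :+ c)) refl _ _ _)
  bumpSum-swap a inv (tail s) = +-cong (inv (tail s)) (bumpSum-swap a (λ t → inv (tail t)) s)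

  -- Expanding at the first two points gives five terms, which exchanging a and b only permutes.
  -- This allows a point that has absorbed weight to be moved to the front.
  cycleSum-swap : ∀ f n → SwapInvariant (cycleSum f n)
  cycleSum-swap f (suc (suc n)) {a ∷ b ∷ m} head = trans (expand a b) (trans
    (solve 6 (λ F A B X Y Z → (F :* A :+ B) :+ (X :+ (Y :+ Z)) := (F :* A :+ Y) :+ (X :+ (B :+ Z))) refl _ _ _ _ _ _)
    (trans (+-cong (+-congʳ (*-congʳ (*-comm _ _)))
      (+-cong (reflexive (≡.cong (λ z → cycleSum f (suc n) (z ∷ m)) (ℕ.+-comm a b))) (+-congˡ (bumpSum-comm a b m _))))
      (sym (expand b a))))
    where
    expand : ∀ a b → cycleSum f (suc (suc n)) (a ∷ b ∷ m) ≈
      ((f a * f b) * cycleSum f n m + f a * bumpSum b m (cycleSum f n)) +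
      (cycleSum f (suc n) ((a ℕ.+ b) ∷ m) + (f b * bumpSum a m (cycleSum f n) + bumpSum a m (λ m′ → bumpSum b m′ (cycleSum f n))))
    expand a b = +-cong (solve 4 (λ a b c d → a :* (b :* c :+ d) := (a :* b) :* c :+ a :* d) refl _ _ _ _)
      (+-congˡ (trans (bumpSum-+ a m _ _) (+-congʳ (bumpSum-* a m (f b) _))))
  cycleSum-swap f (suc n) (tail s) = +-cong (*-congˡ (cycleSum-swap f n s)) (bumpSum-swap _ (cycleSum-swap f n) s)

  ones : ∀ n → Vec ℕ n
  ones n = Vec.replicate n 1

  bumpSum-ones : ∀ k j (F : Vec ℕ (suc j) → Carrier) → SwapInvariant F →
                 bumpSum k (ones (suc j)) F ≈ fromℕ (suc j) * F ((k ℕ.+ 1) ∷ ones j)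
  bumpSum-ones k zero    F inv = solve 1 (λ a → a :+ :0 := (:1 :+ :0) :* a) refl _
  bumpSum-ones k (suc j) F inv = trans
    (+-congˡ (trans (bumpSum-ones k j (λ m → F (1 ∷ m)) (λ s → inv (tail s))) (*-congˡ (inv head))))
    (solve 2 (λ a n → a :+ n :* a := (:1 :+ n) :* a) refl _ (fromℕ (suc j)))

  -- The sum of f(k + i) K(j - i) over 0 ≤ i ≤ j.
  convolve : (ℕ → Carrier) → (ℕ → Carrier) → ℕ → ℕ → Carrier
  convolve f K k zero    = f k * K 0
  convolve f K k (suc j) = f k * K (suc j) + convolve f K (suc k) j

  module _ (f K : ℕ → Carrier) (K₀ : K 0 ≈ 1#) (K₊ : ∀ n → fromℕ (suc n) * K (suc n) ≈ convolve f K 1 n) where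

    -- If i of the j unit points share the cycle of the first point, they can be arranged in j!/(j -
    -- i)! ways, and the others contribute (j - i)! K(j - i); the factorials combine to j!.
    cycleSum-ones-∷ : ∀ k j → cycleSum f (suc j) (k ∷ ones j) ≈ fromℕ (j !) * convolve f K k j
    cycleSum-ones-∷ k zero    = trans (+-congʳ (*-congˡ (sym K₀)))
      (solve 1 (λ a → a :+ :0 := (:1 :+ :0) :* a) refl _)
    cycleSum-ones-∷ k (suc j) = begin
      f k * cycleSum f (suc j) (ones (suc j)) + bumpSum k (ones (suc j)) (cycleSum f (suc j))
        ≈⟨ +-cong (*-congˡ (trans (cycleSum-ones-∷ 1 j) (*-congˡ (sym (K₊ j)))))
                  (trans (bumpSum-ones k j (cycleSum f (suc j)) (cycleSum-swap f (suc j)))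
                         (*-congˡ (trans (reflexive (≡.cong (λ z → cycleSum f (suc j) (z ∷ ones j)) (ℕ.+-comm k 1)))
                             (cycleSum-ones-∷ (suc k) j)))) ⟩
      f k * (fromℕ (j !) * (fromℕ (suc j) * K (suc j))) + fromℕ (suc j) * (fromℕ (j !) * convolve f K (suc k) j)
        ≈⟨ solve 5 (λ f a b K C → f :* (a :* (b :* K)) :+ b :* (a :* C) := (b :* a) :* (f :* K :+ C)) refl _ _ _ _ _ ⟩
      (fromℕ (suc j) * fromℕ (j !)) * convolve f K k (suc j)
        ≈⟨ *-congʳ (fromℕ-* (suc j) (j !)) ⟨
      fromℕ (suc j !) * convolve f K k (suc j) ∎

    cycleSum-ones : ∀ n → cycleSum f n (ones n) ≈ fromℕ (n !) * K n
    cycleSum-ones zero    = trans (sym K₀) (solve 1 (λ a → a := (:1 :+ :0) :* a) refl _)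
    cycleSum-ones (suc n) = trans (cycleSum-ones-∷ 1 n) (trans (*-congˡ (sym (K₊ n)))
      (trans (solve 3 (λ a b K → a :* (b :* K) := (b :* a) :* K) refl (fromℕ (n !)) (fromℕ (suc n)) (K (suc n)))
        (*-congʳ (sym (fromℕ-* (suc n) (n !))))))

module LogarithmicDerivative (R : CommutativeRing 0ℓ 0ℓ) where
  open CommutativeRing R hiding (zero)
  open Sums R
  open PowerSeries R
  open CycleSums R using (convolve)
  open IntegerCoefficients R
  open import Relation.Binary.Reasoning.Setoid setoid
  private
    P = powerSeriesRing
    module PS = Sums P
    module P = CommutativeRing P

  δ : Series → Series
  δ f n = fromℕ (suc n) * f (suc n)

  δ-∙ : ∀ f g n → δ (f ∙ g) n ≈ (δ f ∙ g) n + (f ∙ δ g) n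
  δ-∙ f g zero    = solve 4 (λ a b c d → (:1 :+ :0) :* (a :* b :+ c :* d) :=
    ((:1 :+ :0) :* c) :* d :+ a :* ((:1 :+ :0) :* b)) refl (f 0) (g 1) (f 1) (g 0)
  δ-∙ f g (suc n) = begin
    (1# + fromℕ (suc n)) * (f 0 * g (suc (suc n)) + (f′ ∙ g) (suc n))
      ≈⟨ solve 4 (λ m a b c → (:1 :+ m) :* (a :* b :+ c) := a :* ((:1 :+ m) :* b) :+ (c :+ m :* c)) refl (fromℕ (suc n)) (f 0) (g
          (suc (suc n))) _ ⟩
    f 0 * δ g (suc n) + ((f′ ∙ g) (suc n) + δ (f′ ∙ g) n)
      ≈⟨ +-congˡ (+-congˡ (δ-∙ f′ g n)) ⟩
    f 0 * δ g (suc n) + ((f 1 * g (suc n) + ((f′ ∘ suc) ∙ g) n) + ((δ f′ ∙ g) n + (f′ ∙ δ g) n))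
      ≈⟨ solve 5 (λ a b c d e → a :+ ((b :+ c) :+ (d :+ e)) := (b :+ (c :+ d)) :+ (a :+ e)) refl _ _ _ _ _ ⟩
    (f 1 * g (suc n) + (((f′ ∘ suc) ∙ g) n + (δ f′ ∙ g) n)) + (f 0 * δ g (suc n) + (f′ ∙ δ g) n)
      ≈⟨ +-congʳ (+-cong (*-congʳ (solve 1 (λ a → a := (:1 :+ :0) :* a) refl (f 1)))
           (trans (sym (∙-distribʳ g _ _ n)) (∙-cong {g = g} (λ k → solve 2 (λ m a → a :+ m :* a := (:1 :+ m) :* a) refl (fromℕ
               (suc k)) (f (suc (suc k)))) (λ _ → refl) n))) ⟩
    (δ f ∙ g) (suc n) + (f ∙ δ g) (suc n) ∎
    where
    f′ : Series
    f′ = f ∘ suc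

  -- The equation g′ = h g, a logarithmic derivative without division.
  LogDerivative : Series → Series → Set
  LogDerivative g h = ∀ n → δ g n ≈ (h ∙ g) n

  logDerivative-∙ : ∀ {f g h k} → LogDerivative f h → LogDerivative g k → LogDerivative (f ∙ g) (h P.+ k)
  logDerivative-∙ {f} {g} {h} {k} Lf Lg n = begin
    δ (f ∙ g) n                          ≈⟨ δ-∙ f g n ⟩
    (δ f ∙ g) n + (f ∙ δ g) n            ≈⟨ +-cong (∙-cong {g = g} Lf (λ _ → refl) n) (∙-cong {f = f} (λ _ → refl) Lg n) ⟩
    ((h ∙ f) ∙ g) n + (f ∙ (k ∙ g)) n    ≈⟨ +-cong (∙-assoc h f g n) (trans (P.sym {(f ∙ k) ∙ g} (∙-assoc f k g) n) (trans
        (∙-cong {g = g} (∙-comm f k) (λ _ → refl) n) (∙-assoc k f g n))) ⟩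
    (h ∙ (f ∙ g)) n + (k ∙ (f ∙ g)) n    ≈⟨ ∙-distribʳ (f ∙ g) h k n ⟨
    ((h P.+ k) ∙ (f ∙ g)) n              ∎

  logDerivative-ΠL : ∀ {A : Set} (as : List A) {g h : A → Series} → (∀ a → LogDerivative (g a) (h a)) →
                     LogDerivative (PS.ΠL as g) (PS.ΣL as h)
  logDerivative-ΠL []       L n = trans (zeroʳ _) (sym (∙-zeroˡ P.1# n))
  logDerivative-ΠL (a ∷ as) L = logDerivative-∙ (L a) (logDerivative-ΠL as L)

  logDerivative-geometric : ∀ s → LogDerivative (geometric s) (λ n → s ^ suc n)
  logDerivative-geometric s n = trans (*-congˡ (reflexive (≡.cong (λ z → s ^ suc z) (≡.sym (ℕ.+-identityʳ n))))) (trans (go n 0)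
      (∙-cong {g = geometric s} (λ k → reflexive (≡.cong (λ z → s ^ suc z) (ℕ.+-identityʳ k))) (λ _ → refl) n))
    where
    ^-+ : ∀ a b → s ^ (a ℕ.+ b) ≈ s ^ a * s ^ b
    ^-+ zero    b = sym (*-identityˡ _)
    ^-+ (suc a) b = trans (*-congˡ (^-+ a b)) (sym (*-assoc _ _ _))
    go : ∀ n j → fromℕ (suc n) * s ^ (suc n ℕ.+ j) ≈ ((λ k → s ^ suc (k ℕ.+ j)) ∙ geometric s) n
    go zero    j = solve 1 (λ a → (:1 :+ :0) :* a := a :* :1) refl _
    go (suc n) j = trans (solve 2 (λ m a → (:1 :+ m) :* a := a :+ m :* a) refl (fromℕ (suc n)) _)
      (+-cong (trans (reflexive (≡.cong (s ^_) (ℕ.+-comm (suc (suc n)) j))) (trans (^-+ j (suc (suc n))) (trans (*-congˡ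
          (*-comm _ _)) (rearrange n j))))
        (trans (*-congˡ (reflexive (≡.cong (λ z → s ^ suc z) (≡.sym (ℕ.+-suc n j))))) (trans (go n (suc j))
          (∙-cong {g = geometric s} (λ k → reflexive (≡.cong (λ z → s ^ suc z) (ℕ.+-suc k j))) (λ _ → refl) n))))
      where
      rearrange : ∀ n j → s ^ j * (s ^ suc n * s) ≈ s ^ suc j * s ^ suc n
      rearrange n j = solve 3 (λ a b c → a :* (b :* c) := (c :* a) :* b) refl _ _ _

  -- The series s/(1 + st).
  signed : Carrier → Series
  signed s zero    = s
  signed s (suc n) = - (s * signed s n)

  logDerivative-1+monomial : ∀ s → LogDerivative (P.1# P.+ monomial s) (signed s)
  logDerivative-1+monomial s n = sym (trans (∙-comm (signed s) _ n) (trans (∙-distribʳ (signed s) P.1# (monomial s) n)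
    (trans (+-congʳ (trans (constant-∙ 1# (signed s) n) (*-identityˡ _))) (telescope n))))
    where
    telescope : ∀ n → signed s n + (monomial s ∙ signed s) n ≈ δ (P.1# P.+ monomial s) n
    telescope zero    = trans (+-congˡ (monomial-∙-zero s (signed s)))
      (solve 1 (λ s → s :+ :0 := (:1 :+ :0) :* (:0 :+ s)) refl s)
    telescope (suc n) = trans (+-congˡ (monomial-∙-suc s (signed s) n))
      (solve 2 (λ a m → (:- a) :+ a := m :* (:0 :+ :0)) refl _ (fromℕ (suc (suc n))))

  -- The factor by which shiftification multiplies p_k; it arises here because s/(1 + st) + s/(1 -
  -- st) keeps only odd powers of s, doubled.
  oddTwo : ℕ → Carrier
  oddTwo zero          = 0#
  oddTwo (suc zero)    = 1# + 1#
  oddTwo (suc (suc n)) = oddTwo n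

  kernel : Carrier → Series
  kernel z = (P.1# P.+ monomial z) ∙ geometric z

  logDerivative-kernel : ∀ s → LogDerivative (kernel s) (λ n → oddTwo (suc n) * s ^ suc n)
  logDerivative-kernel s n = trans
    (logDerivative-∙ (logDerivative-1+monomial s) (logDerivative-geometric s) n)
    (∙-cong {g = kernel s} combine (λ _ → refl) n)
    where
    combine : ∀ n → signed s n + s ^ suc n ≈ oddTwo (suc n) * s ^ suc n
    combine zero          = solve 1 (λ s → s :+ s :* :1 := (:1 :+ :1) :* (s :* :1)) refl s
    combine (suc zero)    = solve 1 (λ s → (:- (s :* s)) :+ s :* (s :* :1) := :0 :* (s :* (s :* :1))) refl s
    combine (suc (suc n)) = begin
      - (s * - (s * signed s n)) + s * (s * s ^ suc n)
        ≈⟨ solve 3 (λ s a b → (:- (s :* (:- (s :* a)))) :+ s :* (s :* b) := s :* (s :* (a :+ b))) refl s _ _ ⟩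
      s * (s * (signed s n + s ^ suc n))
        ≈⟨ *-congˡ (*-congˡ (combine n)) ⟩
      s * (s * (oddTwo (suc n) * s ^ suc n))
        ≈⟨ solve 3 (λ s a b → s :* (s :* (a :* b)) := a :* (s :* (s :* b))) refl s _ _ ⟩
      oddTwo (suc n) * (s * (s * s ^ suc n)) ∎

  -- Comparing coefficients in g′ = h g gives a recurrence of Newton type, n K_n = Σ f_k K_(n-k).
  logDerivative-convolve : ∀ {g h} f → LogDerivative g h → (∀ n → h n ≈ f (suc n)) → ∀ n → fromℕ (suc n) * g
      (suc n) ≈ convolve f g 1 n
  logDerivative-convolve {g} f L e n = trans (L n) (trans (∙-cong {g = g} e (λ _ → refl) n) (go 1 n))
    where
    go : ∀ k j → ((λ i → f (k ℕ.+ i)) ∙ g) j ≈ convolve f g k j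
    go k zero    = *-congʳ (reflexive (≡.cong f (ℕ.+-identityʳ k)))
    go k (suc j) = +-cong (*-congʳ (reflexive (≡.cong f (ℕ.+-identityʳ k))))
      (trans (∙-cong {g = g} (λ i → reflexive (≡.cong f (ℕ.+-suc k i))) (λ _ → refl) j) (go (suc k) j))

module CycleSumMap {R S : CommutativeRing 0ℓ 0ℓ} (h : Homomorphism R S) where
  open Homomorphism h
  private
    module S = CommutativeRing S
  open S using (trans; +-cong; +-congˡ; *-congˡ)
  private
    module CR = CycleSums R
    module CS = CycleSums S

  φ-bumpSum : ∀ {n} a (m : Vec ℕ n) F → φ (CR.bumpSum a m F) S.≈ CS.bumpSum a m (φ ∘ F)
  φ-bumpSum a []      F = φ-0
  φ-bumpSum a (b ∷ m) F = trans (φ-+ _ _) (+-congˡ (φ-bumpSum a m _))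

  φ-cycleSum : ∀ f n m → φ (CR.cycleSum f n m) S.≈ CS.cycleSum (φ ∘ f) n m
  φ-cycleSum f zero    []      = φ-1
  φ-cycleSum f (suc n) (a ∷ m) = trans (φ-+ _ _) (+-cong (trans (φ-* _ _) (*-congˡ (φ-cycleSum f n m)))
    (trans (φ-bumpSum a m _) (CS.bumpSum-cong a m (φ-cycleSum f n))))

  φ-fromℕ : ∀ n → φ (Sums.fromℕ R n) S.≈ Sums.fromℕ S n
  φ-fromℕ zero    = φ-0
  φ-fromℕ (suc n) = trans (φ-+ _ _) (+-cong φ-1 (φ-fromℕ n))

  φ-oddTwo : ∀ n → φ (LogarithmicDerivative.oddTwo R n) S.≈ LogarithmicDerivative.oddTwo S n
  φ-oddTwo zero          = φ-0
  φ-oddTwo (suc zero)    = trans (φ-+ _ _) (+-cong φ-1 φ-1)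
  φ-oddTwo (suc (suc n)) = φ-oddTwo n

module CycleSumCongruence (R : CommutativeRing 0ℓ 0ℓ) where
  open CommutativeRing R hiding (zero)
  open CycleSums R
  cycleSum-cong : ∀ {f g} → (∀ k → f k ≈ g k) → ∀ n m → cycleSum f n m ≈ cycleSum g n m
  cycleSum-cong e zero    []      = refl
  cycleSum-cong {f} {g} e (suc n) (a ∷ m) = +-cong (*-cong (e a) (cycleSum-cong e n m)) (bumpSum-cong a m (cycleSum-cong e n))

module KernelCoefficients (F : CommutativeRing 0ℓ 0ℓ) {A B : Set} (z : A → B → CommutativeRing.Carrier F) where
  open CommutativeRing F hiding (zero)
  open Sums F
  open PowerSeries F
  open LogarithmicDerivative F
  open CycleSums F
  open Shifts F using (ΣL-coefficient)
  private
    module PS = Sums powerSeriesRing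

  kernelPowerSum : List A → List B → ℕ → Carrier
  kernelPowerSum as bs k = oddTwo k * ΣL bs (λ b → ΣL as (λ a → z a b ^ k))

  cauchyKernel : List A → List B → Series
  cauchyKernel as bs = PS.ΠL bs (λ b → PS.ΠL as (λ a → kernel (z a b)))

  cycleSum-kernel : ∀ as bs n → cycleSum (kernelPowerSum as bs) n (ones n) ≈ fromℕ (n !) * cauchyKernel as bs n
  cycleSum-kernel as bs = cycleSum-ones (kernelPowerSum as bs) (cauchyKernel as bs) K₀
    (logDerivative-convolve (kernelPowerSum as bs)
      (logDerivative-ΠL bs λ b → logDerivative-ΠL as λ a → logDerivative-kernel (z a b)) coefficient)
    where
    ΠL-0 : ∀ {C : Set} (cs : List C) (g : C → Series) → (∀ c → g c 0 ≈ 1#) → PS.ΠL cs g 0 ≈ 1#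
    ΠL-0 []       g e = refl
    ΠL-0 (c ∷ cs) g e = trans (*-cong (e c) (ΠL-0 cs g e)) (*-identityˡ 1#)
    K₀ : cauchyKernel as bs 0 ≈ 1#
    K₀ = ΠL-0 bs _ λ b → ΠL-0 as _ λ a → trans (*-congʳ (+-identityʳ 1#)) (*-identityˡ 1#)
    coefficient : ∀ n → PS.ΣL bs (λ b → PS.ΣL as (λ a n → oddTwo (suc n) * z a b ^ suc n)) n ≈ kernelPowerSum as bs (suc n)
    coefficient n = trans (ΣL-coefficient bs _ n) (trans
      (ΣL-cong bs λ b → trans (ΣL-coefficient as _ n) (sym (ΣL-*ˡ (oddTwo (suc n)) as _)))
      (sym (ΣL-*ˡ (oddTwo (suc n)) bs _)))

module PositiveWeights (R : CommutativeRing 0ℓ 0ℓ) where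
  open CommutativeRing R hiding (zero)
  open CycleSums R

  Positive : ∀ {n} → Vec ℕ n → Set
  Positive = VecAll.All (0 ℕ.<_)

  bumpSum-cong⁺ : ∀ {n} a {m : Vec ℕ n} {F G} → Positive m → (∀ m → Positive m → F m ≈ G m) → bumpSum a m F ≈ bumpSum a m G
  bumpSum-cong⁺ a []           e = refl
  bumpSum-cong⁺ a {b ∷ m} (p ∷ ps) e = +-cong (e _ (ℕ.<-≤-trans p (ℕ.m≤n+m b a) ∷ ps)) (bumpSum-cong⁺ a ps λ m′ ps′ → e (b ∷ m′)
      (p ∷ ps′))

  -- Truncated subtraction makes `p 0` equal to `p 1`, so the weight functions to be compared are
  -- matched only at positive arguments. Weights start at 1 and merging keeps them positive.
  cycleSum-cong⁺ : ∀ {f g} → (∀ k → f (suc k) ≈ g (suc k)) → ∀ n m → Positive m → cycleSum f n m ≈ cycleSum g n m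
  cycleSum-cong⁺ e zero    []          _        = refl
  cycleSum-cong⁺ e (suc n) (suc a ∷ m) (p ∷ ps) = +-cong (*-cong (e a) (cycleSum-cong⁺ e n m ps)) (bumpSum-cong⁺ (suc a) ps
      (cycleSum-cong⁺ e n))

  ones-positive : ∀ n → Positive (ones n)
  ones-positive zero    = []
  ones-positive (suc n) = ℕ.z<s ∷ ones-positive n

-- Sums and products over pairs, permutations and positions

open import Defs using (pairs; permutations)

module FiniteSums (R : CommutativeRing 0ℓ 0ℓ) where
  open CommutativeRing R hiding (zero)
  open Sums R
  open import Relation.Binary.Reasoning.Setoid setoid

  ΣL-filter : ∀ {A : Set} {P : A → Set} (P? : Decidable P) as f →
              ΣL (filter P? as) f ≈ ΣL as (λ a → if does (P? a) then f a else 0#)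
  ΣL-filter P? []       f = refl
  ΣL-filter P? (a ∷ as) f with does (P? a)
  ... | true  = +-congˡ (ΣL-filter P? as f)
  ... | false = trans (ΣL-filter P? as f) (sym (+-identityˡ _))

  ΠL-filter : ∀ {A : Set} {P : A → Set} (P? : Decidable P) as f →
              ΠL (filter P? as) f ≈ ΠL as (λ a → if does (P? a) then f a else 1#)
  ΠL-filter P? []       f = refl
  ΠL-filter P? (a ∷ as) f with does (P? a)
  ... | true  = *-congˡ (ΠL-filter P? as f)
  ... | false = trans (ΠL-filter P? as f) (sym (*-identityˡ _))

  ΠL-cartesianProduct : ∀ {A B : Set} (as : List A) (bs : List B) f →
                        ΠL (cartesianProduct as bs) f ≈ ΠL as (λ a → ΠL bs (λ b → f (a , b)))
  ΠL-cartesianProduct []       bs f = refl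
  ΠL-cartesianProduct (a ∷ as) bs f = trans (ΠL-++ (map (a ,_) bs) _ f)
    (*-cong (reflexive (ΠL-map (a ,_) bs f)) (ΠL-cartesianProduct as bs f))

  ΠL-pairs-suc : ∀ {n} (f : Fin (suc n) × Fin (suc n) → Carrier) →
    ΠL (pairs (suc n)) f ≈ ΠL (allFin n) (λ j → f (zero , suc j)) * ΠL (pairs n) (λ ij → f (suc (proj₁ ij) , suc (proj₂ ij)))
  ΠL-pairs-suc {n} f = begin
    ΠL (pairs (suc n)) f
      ≈⟨ pairs-product f ⟩
    ΠL (allFin (suc n)) (λ i → ΠL (allFin (suc n)) (λ j → g f i j))
      ≡⟨ ΠFin-suc (λ i → ΠL (allFin (suc n)) (λ j → g f i j)) ⟩
    ΠL (allFin (suc n)) (λ j → g f zero j) * ΠL (allFin n) (λ i → ΠL (allFin (suc n)) (λ j → g f (suc i) j))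
      ≈⟨ *-cong (trans (reflexive (ΠFin-suc (g f zero))) (*-identityˡ _))
                (ΠL-cong (allFin n) λ i → trans (reflexive (ΠFin-suc (g f (suc i)))) (*-identityˡ _)) ⟩
    ΠL (allFin n) (λ j → f (zero , suc j)) * ΠL (allFin n) (λ i → ΠL (allFin n) (λ j → g f′ i j))
      ≈⟨ *-congˡ (sym (pairs-product f′)) ⟩
    ΠL (allFin n) (λ j → f (zero , suc j)) * ΠL (pairs n) f′ ∎
    where
    f′ : Fin n × Fin n → Carrier
    f′ ij = f (suc (proj₁ ij) , suc (proj₂ ij))
    g : ∀ {m} → (Fin m × Fin m → Carrier) → Fin m → Fin m → Carrier
    g f i j = if does (i Fin.<? j) then f (i , j) else 1#
    pairs-product : ∀ {m} f → ΠL (pairs m) f ≈ ΠL (allFin m) (λ i → ΠL (allFin m) (λ j → g f i j))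
    pairs-product {m} f = trans (ΠL-filter _ (cartesianProduct (allFin m) (allFin m)) f)
      (ΠL-cartesianProduct (allFin m) (allFin m) (λ ij → g f (proj₁ ij) (proj₂ ij)))

  ΠL-permute : ∀ {n} (w : Permutation′ n) f → ΠL (allFin n) (λ j → f (w ⟨$⟩ʳ j)) ≈ ΠL (allFin n) f
  ΠL-permute {n} w f = trans (reflexive (≡.sym (product n _))) (trans (sym (M.sum-permute f w)) (reflexive (product n f)))
    where
    module M where
      open import Algebra.Properties.CommutativeMonoid.Sum *-commutativeMonoid public
    product : ∀ n f → M.sum {n} f ≡ ΠL (allFin n) f
    product zero    f = ≡.refl
    product (suc n) f = ≡.trans (≡.cong (f zero *_) (product n (f ∘ suc))) (≡.sym (ΠFin-suc f))

  ΣL-permute : ∀ {n} (w : Permutation′ n) f → ΣL (allFin n) (λ j → f (w ⟨$⟩ʳ j)) ≈ ΣL (allFin n) f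
  ΣL-permute {n} w f = trans (reflexive (≡.sym (total n _))) (trans (sym (M.sum-permute f w)) (reflexive (total n f)))
    where
    module M where
      open import Algebra.Properties.CommutativeMonoid.Sum +-commutativeMonoid public
    total : ∀ n f → M.sum {n} f ≡ ΣL (allFin n) f
    total zero    f = ≡.refl
    total (suc n) f = ≡.trans (≡.cong (f zero +_) (total n (f ∘ suc))) (≡.sym (ΣFin-suc f))

  ΣL-permutations-suc : ∀ {n} (F : Permutation′ (suc n) → Carrier) →
    ΣL (permutations (suc n)) F ≈ ΣL (allFin (suc n)) (λ i → ΣL (permutations n) (λ w → F (Perm.insert zero i w)))
  ΣL-permutations-suc {n} F = trans (ΣL-concatMap (λ i → map (Perm.insert zero i) (permutations n)) (allFin (suc n)) F)
    (ΣL-cong (allFin (suc n)) λ i → reflexive (ΣL-map (Perm.insert zero i) (permutations n) F))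

  open Alternants R

  -- The sign (-1)^i, written as the inversions created by placing i in front so that it splits off
  -- from the product defining `sign`.
  position-sign : ∀ {n} → Fin (suc n) → Carrier
  position-sign {n} i = ΠL (allFin n) λ k → if does (punchIn i k Fin.<? i) then - 1# else 1#

  altS-tabulate : ∀ {A : Set} {n} (u : Fin (suc n) → A) f →
    altS (tabulate u) f ≈ ΣL (allFin (suc n)) (λ i → position-sign i * f (u i) (tabulate (u ∘ punchIn i)))
  altS-tabulate {n = zero}  u f = trans (+-congˡ -0≈0) (+-congʳ (sym (*-identityˡ _)))
    where open import Algebra.Properties.Ring ring using () renaming (-0#≈0# to -0≈0)
  altS-tabulate {n = suc n} u f = begin
    f (u zero) (tabulate (u ∘ suc)) - altS (tabulate (u ∘ suc)) (λ b bs → f b (u zero ∷ bs))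
      ≈⟨ +-cong (trans (sym (*-identityˡ _)) (*-congʳ (sym (ΠL-1 (allFin (suc n))))))
           (trans (-‿cong (altS-tabulate (u ∘ suc) (λ b bs → f b (u zero ∷ bs))))
                  (trans (minus _) (trans (ΣL-*ˡ _ (allFin (suc n)) _) (ΣL-cong (allFin (suc n)) λ i →
                    trans (sym (*-assoc _ _ _)) (*-congʳ (reflexive (≡.sym (ΠFin-suc {n = n} _)))))))) ⟩
    g zero + ΣL (allFin (suc n)) (g ∘ suc)
      ≡⟨ ΣFin-suc g ⟨
    ΣL (allFin (suc (suc n))) g ∎
    where
    open IntegerCoefficients R
    g : Fin (suc (suc n)) → Carrier
    g i = position-sign i * f (u i) (tabulate (u ∘ punchIn i))
    minus : ∀ x → - x ≈ - 1# * x
    minus x = solve 1 (λ x → :- x := (:- :1) :* x) refl x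

open import Defs using (orbit; cycleLength; cycleType)

-- Cycles of permutations

module Iterates {n : ℕ} (g : Fin n → Fin n) (g-injective : ∀ {i j} → g i ≡ g j → i ≡ j) where

  power : ℕ → Fin n → Fin n
  power zero    i = i
  power (suc k) i = power k (g i)

  Path : Fin n → Fin n → Set
  Path i j = ∃ λ k → power k i ≡ j

  power-+ : ∀ a b i → power (a ℕ.+ b) i ≡ power b (power a i)
  power-+ zero    b i = ≡.refl
  power-+ (suc a) b i = power-+ a b (g i)

  power-injective : ∀ k {i j} → power k i ≡ power k j → i ≡ j
  power-injective zero    e = e
  power-injective (suc k) e = g-injective (power-injective k e)

  period : ∀ i → ∃ λ p → suc p ℕ.≤ n × power (suc p) i ≡ i
  period i with Fin.pigeonhole (ℕ.n<1+n n) (λ t → power (toℕ t) i)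
  ... | s , t , s<t , e with ℕ.m≤n⇒∃[o]m+o≡n s<t
  ...   | p , s+p≡t = p , ℕ.≤-trans (ℕ.m≤n+m (suc p) (toℕ s))
      (≡.subst (ℕ._≤ n) (≡.sym shifted) (ℕ.≤-pred (Fin.toℕ<n t))) ,
      power-injective (toℕ s) (≡.trans (≡.sym (power-+ (suc p) (toℕ s) i))
        (≡.trans (≡.cong (λ z → power z i) (≡.trans (ℕ.+-comm (suc p) (toℕ s)) shifted)) (≡.sym e)))
    where
    shifted : toℕ s ℕ.+ suc p ≡ toℕ t
    shifted = ≡.trans (ℕ.+-suc (toℕ s) p) s+p≡t

  bounded : ∀ i k → ∃ λ k′ → k′ ℕ.< n × power k′ i ≡ power k i
  bounded i = <-rec _ go
    where
    go : ∀ k → (∀ {k₀} → k₀ ℕ.< k → ∃ λ k′ → k′ ℕ.< n × power k′ i ≡ power k₀ i) → ∃ λ k′ → k′ ℕ.< n × power k′ i ≡ power k i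
    go k rec with k ℕ.<? n | period i
    ... | yes k<n | _ = k , k<n , ≡.refl
    ... | no  k≮n | p , p<n , e with ℕ.m≤n⇒∃[o]m+o≡n (ℕ.≤-trans p<n (ℕ.≮⇒≥ k≮n))
    ...   | o , ≡.refl with rec (ℕ.s≤s (ℕ.m≤n+m o p))
    ...     | k′ , k′<n , e′ = k′ , k′<n , ≡.trans e′ (≡.trans (≡.cong (power o) (≡.sym e)) (≡.sym (power-+ (suc p) o i)))

  -- If j lies k steps after i and i has period p + 1, then k (p + 1) - k further steps lead from j
  -- back to i.
  Path-sym : ∀ {i j} → Path i j → Path j i
  Path-sym {i} (k , ≡.refl) with period i
  ... | p , _ , e with ℕ.m≤n⇒∃[o]m+o≡n (ℕ.m≤m*n k (suc p))
  ...   | o , k+o≡ = o , ≡.trans (≡.sym (power-+ k o i)) (≡.trans (≡.cong (λ z → power z i) k+o≡) (multiple k))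
    where
    multiple : ∀ k → power (k ℕ.* suc p) i ≡ i
    multiple zero    = ≡.refl
    multiple (suc k) = ≡.trans (power-+ (suc p) (k ℕ.* suc p) i) (≡.trans (≡.cong (power (k ℕ.* suc p)) e) (multiple k))

  Path-trans : ∀ {i j l} → Path i j → Path j l → Path i l
  Path-trans {i} (a , ≡.refl) (b , ≡.refl) = a ℕ.+ b , power-+ a b i

  ∈-iterate⇒Path : ∀ m {i j} → j ∈ iterate g i m → Path i j
  ∈-iterate⇒Path (suc m) (here j≡i) = 0 , ≡.sym j≡i
  ∈-iterate⇒Path (suc m) (there j∈) with ∈-iterate⇒Path m j∈
  ... | k , e = suc k , e

  power-∈-iterate : ∀ m {i} k → k ℕ.< m → power k i ∈ iterate g i m
  power-∈-iterate (suc m) zero    _           = here ≡.refl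
  power-∈-iterate (suc m) (suc k) (ℕ.s≤s k<m) = there (power-∈-iterate m k k<m)

  ∈-iterate⇔Path : ∀ {i j} → j ∈ iterate g i n ⇔ Path i j
  ∈-iterate⇔Path {i} = mk⇔ (∈-iterate⇒Path n) λ { (k , ≡.refl) → from k }
    where
    from : ∀ k → power k i ∈ iterate g i n
    from k with bounded i k
    ... | k′ , k′<n , e = ≡.subst (_∈ iterate g i n) e (power-∈-iterate n k′ k′<n)

module _ {n : ℕ} (w : Permutation′ n) where
  permutation-injective : ∀ {i j} → w ⟨$⟩ʳ i ≡ w ⟨$⟩ʳ j → i ≡ j
  permutation-injective {i} {j} e = ≡.trans (≡.sym (Perm.inverseˡ w)) (≡.trans (≡.cong (w ⟨$⟩ˡ_) e) (Perm.inverseˡ w))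

  open Iterates (w ⟨$⟩ʳ_) permutation-injective public

  SameCycle : Fin n → Fin n → Set
  SameCycle i j = j ∈ orbit w i

  sameCycle? : ∀ i j → Dec (SameCycle i j)
  sameCycle? i j = DecMembership._∈?_ (Fin._≟_ {n}) j (orbit w i)

power-cong : ∀ {n} (w v : Permutation′ n) → (∀ i → w ⟨$⟩ʳ i ≡ v ⟨$⟩ʳ i) → ∀ k i → power w k i ≡ power v k i
power-cong w v e zero    i = ≡.refl
power-cong w v e (suc k) i = ≡.trans (power-cong w v e k (w ⟨$⟩ʳ i)) (≡.cong (power v k) (e i))

weight : ∀ {n} → (Fin n → Bool) → Vec ℕ n → ℕ
weight b []      = 0
weight b (a ∷ m) = (if b zero then a else 0) ℕ.+ weight (b ∘ suc) m

weight-cong : ∀ {n} {b c : Fin n → Bool} (m : Vec ℕ n) → (∀ i → b i ≡ c i) → weight b m ≡ weight c m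
weight-cong []      e = ≡.refl
weight-cong (a ∷ m) e = ≡.cong₂ ℕ._+_ (≡.cong (λ z → if z then a else 0) (e zero)) (weight-cong m (e ∘ suc))

weight-false : ∀ {n} {b : Fin n → Bool} (m : Vec ℕ n) → (∀ i → b i ≡ false) → weight b m ≡ 0
weight-false []      e = ≡.refl
weight-false (a ∷ m) e rewrite e zero = weight-false m (e ∘ suc)

weight-bump-in : ∀ {n} (b : Fin n → Bool) (m : Vec ℕ n) i a → b i ≡ true → weight b (Vec.updateAt m i (a ℕ.+_)) ≡ a ℕ.+ weight b m
weight-bump-in b (c ∷ m) zero    a e rewrite e = ℕ.+-assoc a c _
weight-bump-in b (c ∷ m) (suc i) a e = ≡.trans (≡.cong (d ℕ.+_) (weight-bump-in (b ∘ suc) m i a e))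
  (≡.trans (≡.sym (ℕ.+-assoc d a v)) (≡.trans (≡.cong (ℕ._+ v) (ℕ.+-comm d a)) (ℕ.+-assoc a d v)))
  where
  d = if b zero then c else 0
  v = weight (b ∘ suc) m

weight-bump-out : ∀ {n} (b : Fin n → Bool) (m : Vec ℕ n) i a → b i ≡ false → weight b (Vec.updateAt m i (a ℕ.+_)) ≡ weight b m
weight-bump-out b (c ∷ m) zero    a e rewrite e = ≡.refl
weight-bump-out b (c ∷ m) (suc i) a e = ≡.cong ((if b zero then c else 0) ℕ.+_) (weight-bump-out (b ∘ suc) m i a e)

least-witness : ∀ {n} {Q : Fin n → Set} → (∀ i → Dec (Q i)) → ∀ i → Q i → ∃ λ l → Q l × (∀ j → Q j → l Fin.≤ j)
least-witness {suc n} Q? i q with Q? zero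
... | yes q₀ = zero , q₀ , λ _ _ → ℕ.z≤n
least-witness {suc n} Q? zero    q | no ¬q₀ = contradiction q ¬q₀
least-witness {suc n} Q? (suc i) q | no ¬q₀ with least-witness (Q? ∘ suc) i q
... | l , ql , min = suc l , ql , λ { zero q₀ → contradiction q₀ ¬q₀ ; (suc j) qj → ℕ.s≤s (min j qj) }

Least : ∀ {n} → (Fin n → Fin n → Set) → Fin n → Set
Least E i = ∀ j → E i j → i Fin.≤ j

least? : ∀ {n} {E : Fin n → Fin n → Set} → (∀ i j → Dec (E i j)) → ∀ i → Dec (Least E i)
least? E? i = Fin.all? λ j → E? i j →-dec (i Fin.≤? j)

conjunction : ∀ {P Q : Set} (P? : Dec P) (Q? : Dec Q) → (if does P? then does Q? else false) ≡ true → P × Q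
conjunction (yes p) (yes q) _ = p , q

module ClassProducts (R : CommutativeRing 0ℓ 0ℓ) where
  open CommutativeRing R hiding (zero)
  open Sums R
  open FiniteSums R
  open CycleSums R
  open import Relation.Binary.Reasoning.Setoid setoid

  ΠL-indicator : ∀ {n} (b : Fin n → Bool) (g : Fin n → Carrier) l → b l ≡ true → (∀ j → b j ≡ true → j ≡ l) →
                 ΠL (allFin n) (λ j → if b j then g j else 1#) ≈ g l
  ΠL-indicator {suc n} b g zero    bl uniq = trans (reflexive (ΠFin-suc {n} _)) (trans (*-cong
    (reflexive (≡.cong (λ z → if z then g zero else 1#) bl))
    (trans (ΠL-cong (allFin n) λ j → others j (b (suc j)) ≡.refl) (ΠL-1 (allFin n)))) (*-identityʳ _))
    where
    others : ∀ j c → b (suc j) ≡ c → (if c then g (suc j) else 1#) ≈ 1#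
    others j true  e = contradiction (uniq (suc j) e) λ ()
    others j false e = refl
  ΠL-indicator {suc n} b g (suc l) bl uniq = trans (reflexive (ΠFin-suc {n} _)) (trans (*-cong
    (first (b zero) ≡.refl)
    (ΠL-indicator (b ∘ suc) (g ∘ suc) l bl λ j e → Fin.suc-injective (uniq (suc j) e))) (*-identityˡ _))
    where
    first : ∀ c → b zero ≡ c → (if c then g zero else 1#) ≈ 1#
    first true  e = contradiction (uniq zero e) λ ()
    first false e = refl

  -- Each class is represented by its least element, as `cycleType` does with cycles.
  classProduct : ∀ {n} {E : Fin n → Fin n → Set} → (∀ i j → Dec (E i j)) → (ℕ → Carrier) → Vec ℕ n → Carrier
  classProduct {n} E? f m = ΠL (allFin n) λ i → if does (least? E? i) then f (weight (does ∘ E? i) m) else 1#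

  classProduct-cong : ∀ {n} {E E′ : Fin n → Fin n → Set} (E? : ∀ i j → Dec (E i j)) (E′? : ∀ i j → Dec (E′ i j)) →
    (∀ i j → E i j ⇔ E′ i j) → ∀ f m → classProduct E? f m ≈ classProduct E′? f m
  classProduct-cong {n} E? E′? e f m = ΠL-cong (allFin n) λ i → reflexive (≡.cong₂ (λ b k → if b then f k else 1#)
    (does-⇔ (mk⇔ (λ L j x → L j (Equivalence.from (e i j) x)) (λ L j x → L j (Equivalence.to (e i j) x))) (least? E? i)
        (least? E′? i))
    (weight-cong m λ j → does-⇔ (e i j) (E? i j) (E′? i j)))

  classProduct-fixed : ∀ {n} {E : Fin (suc n) → Fin (suc n) → Set} {E′ : Fin n → Fin n → Set}
    (E? : ∀ i j → Dec (E i j)) (E′? : ∀ i j → Dec (E′ i j)) →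
    E zero zero → (∀ j → ¬ E zero (suc j)) → (∀ j → ¬ E (suc j) zero) → (∀ i j → E (suc i) (suc j) ⇔ E′ i j) →
    ∀ f a m → classProduct E? f (a ∷ m) ≈ f a * classProduct E′? f m
  classProduct-fixed {n} E? E′? e₀ ¬eʳ ¬eˡ e f a m = trans (reflexive (ΠFin-suc {n} _)) (*-cong
    (reflexive (≡.cong₂ (λ b k → if b then f k else 1#) (dec-true (least? E? zero) λ _ _ → ℕ.z≤n) first))
    (ΠL-cong (allFin n) λ i → reflexive (≡.cong₂ (λ b k → if b then f k else 1#)
      (does-⇔ (mk⇔ (λ L j x → ℕ.≤-pred (L (suc j) (Equivalence.from (e i j) x)))
          (λ { L zero x → contradiction x (¬eˡ i) ; L (suc j) x → ℕ.s≤s (L j (Equivalence.to (e i j) x)) })) (least? E? (suc i))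
              (least? E′? i))
      (≡.cong₂ ℕ._+_ (≡.cong (λ b → if b then a else 0) (dec-false (E? (suc i) zero) (¬eˡ i)))
        (weight-cong m λ j → does-⇔ (e i j) (E? (suc i) (suc j)) (E′? i j))))))
    where
    first : weight (does ∘ E? zero) (a ∷ m) ≡ a
    first = ≡.trans (≡.cong₂ ℕ._+_ (≡.cong (λ b → if b then a else 0) (dec-true (E? zero zero) e₀))
      (weight-false m λ j → dec-false (E? zero (suc j)) (¬eʳ j))) (ℕ.+-identityʳ a)

  collapse : ∀ {n} → Fin n → Fin (suc n) → Fin n
  collapse i₀ zero    = i₀
  collapse i₀ (suc j) = j

  -- The least element 0 of the class of 0 stands for the least element l of the class of i₀.
  classProduct-merged : ∀ {n} {E : Fin (suc n) → Fin (suc n) → Set} {E′ : Fin n → Fin n → Set}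
    (E? : ∀ i j → Dec (E i j)) (E′? : ∀ i j → Dec (E′ i j)) i₀ →
    (∀ i → E′ i i) → (∀ {i j} → E′ i j → E′ j i) → (∀ {i j k} → E′ i j → E′ j k → E′ i k) →
    (∀ i j → E i j ⇔ E′ (collapse i₀ i) (collapse i₀ j)) →
    ∀ f a m → classProduct E? f (a ∷ m) ≈ classProduct E′? f (Vec.updateAt m i₀ (a ℕ.+_))
  classProduct-merged {n} {E} {E′} E? E′? i₀ e-refl e-sym e-trans e f a m = begin
    classProduct E? f (a ∷ m)
      ≡⟨ ΠFin-suc {n} _ ⟩
    (if does (least? E? zero) then f (weight (does ∘ E? zero) (a ∷ m)) else 1#) *
      ΠL (allFin n) (λ i → if does (least? E? (suc i)) then f (weight (does ∘ E? (suc i)) (a ∷ m)) else 1#)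
      ≈⟨ *-cong (reflexive (≡.cong₂ (λ b k → if b then f k else 1#) (dec-true (least? E? zero) λ _ _ → ℕ.z≤n) first))
                (ΠL-cong (allFin n) others) ⟩
    h i₀ * ΠL (allFin n) outside
      ≈⟨ *-congʳ (trans (sym h-class) (sym (ΠL-indicator (λ i → inside i) h l inside-l inside-unique))) ⟩
    ΠL (allFin n) (λ i → if inside i then h i else 1#) * ΠL (allFin n) outside
      ≈⟨ ΠL-* (allFin n) _ _ ⟨
    ΠL (allFin n) (λ i → (if inside i then h i else 1#) * outside i)
      ≈⟨ ΠL-cong (allFin n) split ⟩
    classProduct E′? f m′ ∎
    where
    m′ = Vec.updateAt m i₀ (a ℕ.+_)
    h : Fin n → Carrier
    h i = f (weight (does ∘ E′? i) m′)
    inside : Fin n → Bool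
    inside i = if does (E′? i₀ i) then does (least? E′? i) else false
    outside : Fin n → Carrier
    outside i = if does (E′? i₀ i) then 1# else (if does (least? E′? i) then h i else 1#)
    split : ∀ i → (if inside i then h i else 1#) * outside i ≈ (if does (least? E′? i) then h i else 1#)
    split i with does (E′? i₀ i)
    ... | true  = *-identityʳ _
    ... | false = *-identityˡ _
    witness = least-witness (E′? i₀) i₀ (e-refl i₀)
    l = proj₁ witness
    e-l : E′ i₀ l
    e-l = proj₁ (proj₂ witness)
    l-least : Least E′ l
    l-least j x = proj₂ (proj₂ witness) j (e-trans e-l x)
    h-class : h l ≈ h i₀
    h-class = reflexive (≡.cong f (weight-cong m′ λ j → does-⇔ (mk⇔ (e-trans e-l) (e-trans (e-sym e-l))) (E′? l j) (E′? i₀ j)))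
    inside-l : inside l ≡ true
    inside-l rewrite dec-true (E′? i₀ l) e-l = dec-true (least? E′? l) l-least
    inside-unique : ∀ j → inside j ≡ true → j ≡ l
    inside-unique j eq = Fin.≤-antisym (proj₂ both l (e-trans (e-sym (proj₁ both)) e-l)) (proj₂ (proj₂ witness) j (proj₁ both))
      where
      both : E′ i₀ j × Least E′ j
      both = conjunction (E′? i₀ j) (least? E′? j) eq
    first : weight (does ∘ E? zero) (a ∷ m) ≡ weight (does ∘ E′? i₀) m′
    first = ≡.trans (≡.cong₂ ℕ._+_ (≡.cong (λ b → if b then a else 0) (dec-true (E? zero zero) (Equivalence.from (e zero zero)
        (e-refl i₀))))
        (weight-cong m λ j → does-⇔ (e zero (suc j)) (E? zero (suc j)) (E′? i₀ j)))
      (≡.sym (weight-bump-in (does ∘ E′? i₀) m i₀ a (dec-true (E′? i₀ i₀) (e-refl i₀))))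
    others : ∀ i → (if does (least? E? (suc i)) then f (weight (does ∘ E? (suc i)) (a ∷ m)) else 1#) ≈ outside i
    others i with E′? i₀ i
    ... | yes x = reflexive (≡.cong (λ b → if b then f (weight (does ∘ E? (suc i)) (a ∷ m)) else 1#)
      (dec-false (least? E? (suc i)) λ L → ℕ.n≮0 (L zero (Equivalence.from (e (suc i) zero) (e-sym x)))))
    ... | no ¬x = reflexive (≡.cong₂ (λ b k → if b then f k else 1#)
      (does-⇔ (mk⇔ (λ L j y → ℕ.≤-pred (L (suc j) (Equivalence.from (e (suc i) (suc j)) y)))
        (λ { L zero y → contradiction (e-sym (Equivalence.to (e (suc i) zero) y)) ¬x
           ; L (suc j) y → ℕ.s≤s (L j (Equivalence.to (e (suc i) (suc j)) y)) })) (least? E? (suc i)) (least? E′? i))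
      (≡.trans (≡.cong₂ ℕ._+_
          (≡.cong (λ b → if b then a else 0) (dec-false (E? (suc i) zero) λ y → ¬x (e-sym (Equivalence.to (e (suc i) zero) y))))
          (weight-cong m λ j → does-⇔ (e (suc i) (suc j)) (E? (suc i) (suc j)) (E′? i j)))
        (≡.sym (weight-bump-out (does ∘ E′? i) m i₀ a (dec-false (E′? i i₀) λ y → ¬x (e-sym y))))))

  cycleProduct : ∀ {n} → (ℕ → Carrier) → Permutation′ n → Vec ℕ n → Carrier
  cycleProduct f w m = classProduct (sameCycle? w) f m

  cycleProduct-cycleType : ∀ {n} f (w : Permutation′ n) → ΠL (cycleType w) f ≈ cycleProduct f w (ones n)
  cycleProduct-cycleType {n} f w = begin
    ΠL (cycleType w) f
      ≡⟨ ΠL-map (cycleLength w) (filter (λ i → all? (i Fin.≤?_) (orbit w i)) (allFin n)) f ⟩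
    ΠL (filter (λ i → all? (i Fin.≤?_) (orbit w i)) (allFin n)) (f ∘ cycleLength w)
      ≈⟨ ΠL-filter _ (allFin n) _ ⟩
    ΠL (allFin n) (λ i → if does (all? (i Fin.≤?_) (orbit w i)) then f (cycleLength w i) else 1#)
      ≈⟨ ΠL-cong (allFin n) (λ i → reflexive (≡.cong₂ (λ b k → if b then f k else 1#)
           (does-⇔ (mk⇔ (λ L j x → All.lookup L x) (λ L → All.tabulate (L _))) (all? (i Fin.≤?_) (orbit w i)) (least?
               (sameCycle? w) i))
           (≡.sym (count n (sameCycle? w i))))) ⟩
    cycleProduct f w (ones n) ∎
    where
    count : ∀ n {P : Fin n → Set} (P? : ∀ i → Dec (P i)) → weight (does ∘ P?) (ones n) ≡ length (filter P? (allFin n))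
    count zero    P? = ≡.refl
    count (suc n) P? = ≡.trans (≡.cong ((if does (P? zero) then 1 else 0) ℕ.+_) (count n (P? ∘ suc))) (≡.sym (≡.trans (≡.cong
        (λ as → length (filter P? as)) (allFin-suc n)) step))
      where
      filter-map : ∀ (as : List (Fin n)) → length (filter P? (map suc as)) ≡ length (filter (P? ∘ suc) as)
      filter-map []       = ≡.refl
      filter-map (a ∷ as) with does (P? (suc a))
      ... | true  = ≡.cong suc (filter-map as)
      ... | false = filter-map as
      step : length (filter P? (zero ∷ map suc (allFin n))) ≡ (if does (P? zero) then 1 else 0) ℕ.+ length (filter (P? ∘ suc)
          (allFin n))
      step with does (P? zero)
      ... | true  = ≡.cong suc (filter-map (allFin n))
      ... | false = filter-map (allFin n)

-- w arises from v by inserting the new point 0 just before i₀ in the cycle of i₀.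
Contracts : ∀ {n} → Permutation′ (suc n) → Permutation′ n → Fin n → Set
Contracts w v i₀ = w ⟨$⟩ʳ zero ≡ suc i₀ ×
  (∀ j → (w ⟨$⟩ʳ suc j ≡ zero × v ⟨$⟩ʳ j ≡ i₀) ⊎ w ⟨$⟩ʳ suc j ≡ suc (v ⟨$⟩ʳ j))

-- In `Perm.insert zero (suc i₀) w′` the value 0 of `w′` stands for the point 0, whose successor is
-- i₀. The contraction redirects it to i₀ and reads the other values through `punchIn i₀`, which
-- makes it a translate of `w′` by a permutation depending on i₀ alone.
contraction : ∀ {n} → Fin n → Permutation′ n → Permutation′ n
contraction {suc n} i₀ w′ = w′ ∘ₚ Perm.insert zero i₀ Perm.id

contraction-contracts : ∀ {n} (w : Permutation′ (suc n)) w′ i₀ → w ⟨$⟩ʳ zero ≡ suc i₀ →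
  (∀ j → w ⟨$⟩ʳ suc j ≡ punchIn (suc i₀) (w′ ⟨$⟩ʳ j)) → Contracts w (contraction i₀ w′) i₀
contraction-contracts {suc n} w w′ i₀ w₀ e = w₀ , λ j → cases j (w′ ⟨$⟩ʳ j) ≡.refl
  where
  cases : ∀ j k → w′ ⟨$⟩ʳ j ≡ k →
    (w ⟨$⟩ʳ suc j ≡ zero × contraction i₀ w′ ⟨$⟩ʳ j ≡ i₀) ⊎ w ⟨$⟩ʳ suc j ≡ suc (contraction i₀ w′ ⟨$⟩ʳ j)
  cases j zero    eq = inj₁ (≡.trans (e j) (≡.cong (punchIn (suc i₀)) eq) , ≡.cong (Perm.insert zero i₀ Perm.id ⟨$⟩ʳ_) eq)
  cases j (suc k) eq = inj₂ (≡.trans (≡.trans (e j) (≡.cong (punchIn (suc i₀)) eq))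
    (≡.cong suc (≡.sym (≡.cong (Perm.insert zero i₀ Perm.id ⟨$⟩ʳ_) eq))))

module _ {n : ℕ} (w : Permutation′ n) where
  sameCycle⇔Path : ∀ {i j} → SameCycle w i j ⇔ Path w i j
  sameCycle⇔Path = ∈-iterate⇔Path w

  private
    to : ∀ {i j} → SameCycle w i j → Path w i j
    to = Equivalence.to sameCycle⇔Path
    from : ∀ {i j} → Path w i j → SameCycle w i j
    from = Equivalence.from sameCycle⇔Path

  sameCycle-refl : ∀ i → SameCycle w i i
  sameCycle-refl i = from (0 , ≡.refl)

  sameCycle-sym : ∀ {i j} → SameCycle w i j → SameCycle w j i
  sameCycle-sym x = from (Path-sym w (to x))

  sameCycle-trans : ∀ {i j k} → SameCycle w i j → SameCycle w j k → SameCycle w i k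
  sameCycle-trans x y = from (Path-trans w (to x) (to y))

module _ {n : ℕ} {w : Permutation′ (suc n)} {v : Permutation′ n} {i₀ : Fin n} (c : Contracts w v i₀) where
  private
    col : Fin (suc n) → Fin n
    col zero    = i₀
    col (suc j) = j

    col-step : ∀ a → Path v (col a) (col (w ⟨$⟩ʳ a))
    col-step zero    = 0 , ≡.sym (≡.cong col (proj₁ c))
    col-step (suc j) with proj₂ c j
    ... | inj₁ (e , e′) = 1 , ≡.trans e′ (≡.sym (≡.cong col e))
    ... | inj₂ e        = 1 , ≡.sym (≡.cong col e)

    project : ∀ k a → Path v (col a) (col (power w k a))
    project zero    a = 0 , ≡.refl
    project (suc k) a = Path-trans v (col-step a) (project k (w ⟨$⟩ʳ a))

    one-step : ∀ i → Path w (suc i) (suc (v ⟨$⟩ʳ i))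
    one-step i with proj₂ c i
    ... | inj₁ (e , e′) = 2 , ≡.trans (≡.cong (w ⟨$⟩ʳ_) e) (≡.trans (proj₁ c) (≡.cong suc (≡.sym e′)))
    ... | inj₂ e        = 1 , e

    lift : ∀ k i → Path w (suc i) (suc (power v k i))
    lift zero    i = 0 , ≡.refl
    lift (suc k) i = Path-trans w (one-step i) (lift k (v ⟨$⟩ʳ i))

    attach : ∀ a → Path w a (suc (col a))
    attach zero    = 1 , proj₁ c
    attach (suc j) = 0 , ≡.refl

  -- Deleting the visits to 0 projects walks of `w` to walks of `v`. Conversely a step of `v` lifts
  -- to one step of `w`, or to two when it passes through 0.
  contracts-path : ∀ a b → Path w a b ⇔ Path v (col a) (col b)
  contracts-path a b = mk⇔ (λ { (k , ≡.refl) → project k a })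
    (λ { (k , e) → Path-trans w (attach a) (Path-trans w (lift k (col a))
      (≡.subst (λ z → Path w (suc z) b) (≡.sym e) (Path-sym w (attach b)))) })

module PermutationSums (R : CommutativeRing 0ℓ 0ℓ) where
  open CommutativeRing R hiding (zero)
  open Sums R
  open FiniteSums R
  open CycleSums R
  open ClassProducts R
  open import Relation.Binary.Reasoning.Setoid setoid

  cycleProduct-merged : ∀ {n} {w : Permutation′ (suc n)} {v : Permutation′ n} {i₀} → Contracts w v i₀ →
    ∀ f a m → cycleProduct f w (a ∷ m) ≈ cycleProduct f v (Vec.updateAt m i₀ (a ℕ.+_))
  cycleProduct-merged {w = w} {v} {i₀} c = classProduct-merged (sameCycle? w) (sameCycle? v) i₀
    (sameCycle-refl v) (sameCycle-sym v) (sameCycle-trans v) λ i j → mk⇔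
    (λ x → Equivalence.from (sameCycle⇔Path v) (proj i j (Equivalence.to (sameCycle⇔Path w) x)))
    (λ x → Equivalence.from (sameCycle⇔Path w) (inj i j (Equivalence.to (sameCycle⇔Path v) x)))
    where
    proj : ∀ i j → Path w i j → Path v (collapse i₀ i) (collapse i₀ j)
    proj zero    zero    = Equivalence.to (contracts-path {w = w} {v} c zero zero)
    proj zero    (suc j) = Equivalence.to (contracts-path {w = w} {v} c zero (suc j))
    proj (suc i) zero    = Equivalence.to (contracts-path {w = w} {v} c (suc i) zero)
    proj (suc i) (suc j) = Equivalence.to (contracts-path {w = w} {v} c (suc i) (suc j))
    inj : ∀ i j → Path v (collapse i₀ i) (collapse i₀ j) → Path w i j
    inj zero    zero    = Equivalence.from (contracts-path {w = w} {v} c zero zero)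
    inj zero    (suc j) = Equivalence.from (contracts-path {w = w} {v} c zero (suc j))
    inj (suc i) zero    = Equivalence.from (contracts-path {w = w} {v} c (suc i) zero)
    inj (suc i) (suc j) = Equivalence.from (contracts-path {w = w} {v} c (suc i) (suc j))

  cycleProduct-fixed : ∀ {n} (w : Permutation′ (suc n)) (v : Permutation′ n) → w ⟨$⟩ʳ zero ≡ zero →
    (∀ j → w ⟨$⟩ʳ suc j ≡ suc (v ⟨$⟩ʳ j)) → ∀ f a m → cycleProduct f w (a ∷ m) ≈ f a * cycleProduct f v m
  cycleProduct-fixed w v w₀ e = classProduct-fixed (sameCycle? w) (sameCycle? v) (sameCycle-refl w zero)
    (λ j x → ¬zero j (Equivalence.to (sameCycle⇔Path w) x))
    (λ j x → ¬zero j (Equivalence.to (sameCycle⇔Path w) (sameCycle-sym w x)))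
    λ i j → mk⇔
      (λ x → Equivalence.from (sameCycle⇔Path v) (down (Equivalence.to (sameCycle⇔Path w) x)))
      (λ x → Equivalence.from (sameCycle⇔Path w) (up (Equivalence.to (sameCycle⇔Path v) x)))
    where
    power-zero : ∀ k → power w k zero ≡ zero
    power-zero zero    = ≡.refl
    power-zero (suc k) = ≡.trans (≡.cong (power w k) w₀) (power-zero k)
    power-suc : ∀ k i → power w k (suc i) ≡ suc (power v k i)
    power-suc zero    i = ≡.refl
    power-suc (suc k) i = ≡.trans (≡.cong (power w k) (e i)) (power-suc k (v ⟨$⟩ʳ i))
    ¬zero : ∀ j → ¬ Path w zero (suc j)
    ¬zero j (k , eq) = contradiction (≡.trans (≡.sym (power-zero k)) eq) λ ()
    down : ∀ {i j} → Path w (suc i) (suc j) → Path v i j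
    down {i} (k , eq) = k , Fin.suc-injective (≡.trans (≡.sym (power-suc k i)) eq)
    up : ∀ {i j} → Path v i j → Path w (suc i) (suc j)
    up {i} (k , eq) = k , ≡.trans (power-suc k i) (≡.cong suc eq)

  cycleProduct-cong : ∀ {n} (w v : Permutation′ n) → (∀ i → w ⟨$⟩ʳ i ≡ v ⟨$⟩ʳ i) → ∀ f m → cycleProduct f w m ≈ cycleProduct f v m
  cycleProduct-cong w v e = classProduct-cong (sameCycle? w) (sameCycle? v) λ i j → mk⇔
    (λ x → Equivalence.from (sameCycle⇔Path v) (go w v e (Equivalence.to (sameCycle⇔Path w) x)))
    (λ x → Equivalence.from (sameCycle⇔Path w) (go v w (λ i → ≡.sym (e i)) (Equivalence.to (sameCycle⇔Path v) x)))
    where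
    go : ∀ w v → (∀ i → w ⟨$⟩ʳ i ≡ v ⟨$⟩ʳ i) → ∀ {i j} → Path w i j → Path v i j
    go w v e {i} (k , eq) = k , ≡.trans (≡.sym (power-cong w v e k i)) eq

  -- Permutations are records with inverses and proofs, so those built by different operations are
  -- compared pointwise.
  Extensional : ∀ {n} → (Permutation′ n → Carrier) → Set
  Extensional {n} F = ∀ w v → (∀ i → w ⟨$⟩ʳ i ≡ v ⟨$⟩ʳ i) → F w ≈ F v

  insert-cong : ∀ {n} k (w v : Permutation′ n) → (∀ i → w ⟨$⟩ʳ i ≡ v ⟨$⟩ʳ i) → ∀ i →
                Perm.insert zero k w ⟨$⟩ʳ i ≡ Perm.insert zero k v ⟨$⟩ʳ i
  insert-cong k w v e zero    = ≡.refl
  insert-cong k w v e (suc i) = ≡.cong (punchIn k) (e i)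

  -- The translate of an insertion at i is an insertion at π(i) of a translate by `Perm.remove i π`;
  -- the inner sum is invariant by induction, and the outer one is reindexed by π.
  translation-invariance : ∀ {n} (π : Permutation′ n) F → Extensional F →
                           ΣL (permutations n) (λ w → F (w ∘ₚ π)) ≈ ΣL (permutations n) F
  translation-invariance {zero}  π F ext = +-congʳ (ext _ _ λ ())
  translation-invariance {suc n} π F ext = begin
    ΣL (permutations (suc n)) (λ w → F (w ∘ₚ π))
      ≈⟨ ΣL-permutations-suc (λ w → F (w ∘ₚ π)) ⟩
    ΣL (allFin (suc n)) (λ i → ΣL (permutations n) (λ w → F (Perm.insert zero i w ∘ₚ π)))
      ≈⟨ ΣL-cong (allFin (suc n)) (λ i → trans
           (ΣL-cong (permutations n) λ w → ext _ (Perm.insert zero (π ⟨$⟩ʳ i) (w ∘ₚ Perm.remove i π)) (λ { zero → ≡.refl ;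
               (suc j) → Perm.punchIn-permute π i (w ⟨$⟩ʳ j) }))
           (translation-invariance (Perm.remove i π) (λ w → F (Perm.insert zero (π ⟨$⟩ʳ i) w)) λ w v e → ext _ _
               (insert-cong _ w v e))) ⟩
    ΣL (allFin (suc n)) (λ i → ΣL (permutations n) (λ w → F (Perm.insert zero (π ⟨$⟩ʳ i) w)))
      ≈⟨ ΣL-permute π (λ i → ΣL (permutations n) (λ w → F (Perm.insert zero i w))) ⟩
    ΣL (allFin (suc n)) (λ i → ΣL (permutations n) (λ w → F (Perm.insert zero i w)))
      ≈⟨ ΣL-permutations-suc F ⟨
    ΣL (permutations (suc n)) F ∎

  bumpSum-updateAt : ∀ {n} a (m : Vec ℕ n) F → ΣL (allFin n) (λ i → F (Vec.updateAt m i (a ℕ.+_))) ≈ bumpSum a m F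
  bumpSum-updateAt a []      F = refl
  bumpSum-updateAt {suc n} a (b ∷ m) F = trans (reflexive (ΣFin-suc {n} λ i → F (Vec.updateAt (b ∷ m) i (a ℕ.+_))))
    (+-congˡ (bumpSum-updateAt a m λ m′ → F (b ∷ m′)))

  -- The image of 0 decides: 0 is a cycle by itself or is contracted into i. For fixed i the
  -- contractions are translates by one permutation and hence run over all of S_n.
  cycleSum-permutations : ∀ f n m → ΣL (permutations n) (λ w → cycleProduct f w m) ≈ cycleSum f n m
  cycleSum-permutations f zero    []      = +-identityʳ 1#
  cycleSum-permutations f (suc n) (a ∷ m) = begin
    ΣL (permutations (suc n)) (λ w → cycleProduct f w (a ∷ m))
      ≈⟨ ΣL-permutations-suc (λ w → cycleProduct f w (a ∷ m)) ⟩
    ΣL (allFin (suc n)) (λ i → ΣL (permutations n) (λ w → cycleProduct f (Perm.insert zero i w) (a ∷ m)))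
      ≡⟨ ΣFin-suc {n} (λ i → ΣL (permutations n) (λ w → cycleProduct f (Perm.insert zero i w) (a ∷ m))) ⟩
    ΣL (permutations n) (λ w → cycleProduct f (Perm.insert zero zero w) (a ∷ m)) +
      ΣL (allFin n) (λ i → ΣL (permutations n) (λ w → cycleProduct f (Perm.insert zero (suc i) w) (a ∷ m)))
      ≈⟨ +-cong
           (trans (ΣL-cong (permutations n) λ w → cycleProduct-fixed (Perm.insert zero zero w) w ≡.refl (λ _ → ≡.refl) f a m)
             (trans (sym (ΣL-*ˡ (f a) (permutations n) _)) (*-congˡ (cycleSum-permutations f n m))))
           (trans (ΣL-cong (allFin n) λ i → merged n i m) (bumpSum-updateAt a m (cycleSum f n))) ⟩
    f a * cycleSum f n m + bumpSum a m (cycleSum f n) ∎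
    where
    merged : ∀ n i m → ΣL (permutations n) (λ w → cycleProduct f (Perm.insert zero (suc i) w) (a ∷ m)) ≈ cycleSum f n
        (Vec.updateAt m i (a ℕ.+_))
    merged (suc n) i m = begin
      ΣL (permutations (suc n)) (λ w → cycleProduct f (Perm.insert zero (suc i) w) (a ∷ m))
        ≈⟨ ΣL-cong (permutations (suc n)) (λ w → cycleProduct-merged {w = Perm.insert zero (suc i) w} {contraction i w} {i}
            (contraction-contracts (Perm.insert zero (suc i) w) w i ≡.refl λ _ → ≡.refl) f a m) ⟩
      ΣL (permutations (suc n)) (λ w → cycleProduct f (w ∘ₚ Perm.insert zero i Perm.id) m′)
        ≈⟨ translation-invariance (Perm.insert zero i Perm.id) (λ w → cycleProduct f w m′)
            (λ w v e → cycleProduct-cong w v e f m′) ⟩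
      ΣL (permutations (suc n)) (λ w → cycleProduct f w m′)
        ≈⟨ cycleSum-permutations f (suc n) m′ ⟩
      cycleSum f (suc n) m′ ∎
      where m′ = Vec.updateAt m i (a ℕ.+_)

-- Words fixed by a permutation

open import Defs using (words; _·_)

Fixed : ∀ {n} {A : Set} → Permutation′ n → Vec A n → Set
Fixed w u = ∀ i → Vec.lookup u (w ⟨$⟩ʳ i) ≡ Vec.lookup u i

Fixed⇔· : ∀ {n} {A : Set} (w : Permutation′ n) (u : Vec A n) → Fixed w u ⇔ (w · u ≡ u)
Fixed⇔· w u = mk⇔
  (λ h → ≡.trans (Vec.tabulate-cong λ i → ≡.trans (≡.sym (h (w ⟨$⟩ˡ i))) (≡.cong (Vec.lookup u) (Perm.inverseʳ w)))
      (Vec.tabulate∘lookup u))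
  (λ e i → ≡.trans (≡.cong (λ z → Vec.lookup z (w ⟨$⟩ʳ i)) (≡.sym e))
    (≡.trans (Vec.lookup∘tabulate _ (w ⟨$⟩ʳ i)) (≡.cong (Vec.lookup u) (Perm.inverseˡ w))))

fixed? : ∀ {n q} (w : Permutation′ n) (u : Vec (Fin q) n) → Dec (Fixed w u)
fixed? w u = Fin.all? λ i → Vec.lookup u (w ⟨$⟩ʳ i) Fin.≟ Vec.lookup u i

module WordCounts (R : CommutativeRing 0ℓ 0ℓ) where
  open CommutativeRing R hiding (zero)
  open Sums R
  open FiniteSums R
  open ClassProducts R
  open PermutationSums R
  open import Relation.Binary.Reasoning.Setoid setoid

  indicator : Bool → Carrier
  indicator b = if b then 1# else 0#

  ΣL-words-suc : ∀ {A : Set} (as : List A) n (F : Vec A (suc n) → Carrier) →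
    ΣL (words as (suc n)) F ≈ ΣL as (λ a → ΣL (words as n) (λ u → F (a ∷ u)))
  ΣL-words-suc as n F = trans (ΣL-concatMap (λ a → map (a ∷_) (words as n)) as F)
    (ΣL-cong as λ a → reflexive (ΣL-map (a ∷_) (words as n) F))

  ΣL-constant : ∀ {A : Set} (as : List A) f → ΣL as (λ _ → f) ≈ fromℕ (length as) * f
  ΣL-constant []       f = sym (zeroˡ f)
  ΣL-constant (a ∷ as) f = trans (+-cong (sym (*-identityˡ f)) (ΣL-constant as f)) (sym (distribʳ f 1# _))

  ΣFin-constant : ∀ q f → ΣL (allFin q) (λ _ → f) ≈ fromℕ q * f
  ΣFin-constant q f = trans (ΣL-constant (allFin q) f) (*-congʳ (reflexive (≡.cong fromℕ (List.length-tabulate {n = q} id))))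

  ΣFin-indicator : ∀ {q} (c : Fin q) → ΣL (allFin q) (λ a → indicator (does (a Fin.≟ c))) ≈ 1#
  ΣFin-indicator {suc q} zero    = trans (reflexive (ΣFin-suc {q} _)) (trans (+-congˡ (ΣL-0 (allFin q))) (+-identityʳ 1#))
  ΣFin-indicator {suc q} (suc c) = trans (reflexive (ΣFin-suc {q} _)) (trans (+-identityˡ _) (ΣFin-indicator c))

  fixedWords : ∀ q n (w : Permutation′ n) m →
    ΣL (words (allFin q) n) (λ u → indicator (does (fixed? w u))) ≈ cycleProduct (const (fromℕ q)) w m
  fixedWords q zero    w [] = +-identityʳ 1#
  fixedWords q (suc n) w (a ∷ m) = by-image (w ⟨$⟩ʳ zero) ≡.refl
    where
    by-image : ∀ k → w ⟨$⟩ʳ zero ≡ k →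
      ΣL (words (allFin q) (suc n)) (λ u → indicator (does (fixed? w u))) ≈ cycleProduct (const (fromℕ q)) w (a ∷ m)
    by-image zero w₀ = begin
      ΣL (words (allFin q) (suc n)) (λ u → indicator (does (fixed? w u)))
        ≈⟨ ΣL-words-suc (allFin q) n _ ⟩
      ΣL (allFin q) (λ c → ΣL (words (allFin q) n) (λ u → indicator (does (fixed? w (c ∷ u)))))
        ≈⟨ ΣL-cong (allFin q) (λ c → ΣL-cong (words (allFin q) n) λ u → reflexive (≡.cong indicator
             (does-⇔ (mk⇔ (λ h i → ≡.trans (≡.cong (Vec.lookup (c ∷ u)) (≡.sym (w₊ i))) (h (suc i)))
               (λ { h zero → ≡.cong (Vec.lookup (c ∷ u)) w₀ ; h (suc i) → ≡.trans (≡.cong (Vec.lookup (c ∷ u)) (w₊ i)) (h i) }))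
               (fixed? w (c ∷ u)) (fixed? v u)))) ⟩
      ΣL (allFin q) (λ c → ΣL (words (allFin q) n) (λ u → indicator (does (fixed? v u))))
        ≈⟨ ΣFin-constant q _ ⟩
      fromℕ q * ΣL (words (allFin q) n) (λ u → indicator (does (fixed? v u)))
        ≈⟨ *-congˡ (fixedWords q n v m) ⟩
      fromℕ q * cycleProduct (const (fromℕ q)) v m
        ≈⟨ cycleProduct-fixed w v w₀ w₊ (const (fromℕ q)) a m ⟨
      cycleProduct (const (fromℕ q)) w (a ∷ m) ∎
      where
      v = Perm.remove zero w
      w₊ : ∀ j → w ⟨$⟩ʳ suc j ≡ suc (v ⟨$⟩ʳ j)
      w₊ j = ≡.trans (Perm.punchIn-permute w zero j) (≡.cong (λ z → punchIn z (v ⟨$⟩ʳ j)) w₀)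
    by-image (suc i₀) w₀ = begin
      ΣL (words (allFin q) (suc n)) (λ u → indicator (does (fixed? w u)))
        ≈⟨ ΣL-words-suc (allFin q) n _ ⟩
      ΣL (allFin q) (λ c → ΣL (words (allFin q) n) (λ u → indicator (does (fixed? w (c ∷ u)))))
        ≈⟨ ΣL-swap (allFin q) (words (allFin q) n) _ ⟩
      ΣL (words (allFin q) n) (λ u → ΣL (allFin q) (λ c → indicator (does (fixed? w (c ∷ u)))))
        ≈⟨ ΣL-cong (words (allFin q) n) first-letter ⟩
      ΣL (words (allFin q) n) (λ u → indicator (does (fixed? v u)))
        ≈⟨ fixedWords q n v (Vec.updateAt m i₀ (a ℕ.+_)) ⟩
      cycleProduct (const (fromℕ q)) v (Vec.updateAt m i₀ (a ℕ.+_))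
        ≈⟨ cycleProduct-merged {w = w} {v} {i₀} contracts (const (fromℕ q)) a m ⟨
      cycleProduct (const (fromℕ q)) w (a ∷ m) ∎
      where
      v = contraction i₀ (Perm.remove zero w)
      contracts : Contracts w v i₀
      contracts = contraction-contracts w (Perm.remove zero w) i₀ w₀ λ j →
        ≡.trans (Perm.punchIn-permute w zero j) (≡.cong (λ z → punchIn z (Perm.remove zero w ⟨$⟩ʳ j)) w₀)
      to : ∀ c u → Fixed w (c ∷ u) → c ≡ Vec.lookup u i₀ × Fixed v u
      to c u h = c≡ , fixed
        where
        c≡ : c ≡ Vec.lookup u i₀
        c≡ = ≡.trans (≡.sym (h zero)) (≡.cong (Vec.lookup (c ∷ u)) w₀)
        fixed : Fixed v u
        fixed j with proj₂ contracts j
        ... | inj₁ (e , e′) = ≡.trans (≡.cong (Vec.lookup u) e′) (≡.trans (≡.sym c≡) (≡.trans (≡.cong (Vec.lookup (c ∷ u))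
            (≡.sym e)) (h (suc j))))
        ... | inj₂ e        = ≡.trans (≡.cong (Vec.lookup (c ∷ u)) (≡.sym e)) (h (suc j))
      from : ∀ c u → c ≡ Vec.lookup u i₀ × Fixed v u → Fixed w (c ∷ u)
      from c u (c≡ , h) zero    = ≡.trans (≡.cong (Vec.lookup (c ∷ u)) w₀) (≡.sym c≡)
      from c u (c≡ , h) (suc j) with proj₂ contracts j
      ... | inj₁ (e , e′) = ≡.trans (≡.cong (Vec.lookup (c ∷ u)) e) (≡.trans c≡ (≡.trans (≡.cong (Vec.lookup u) (≡.sym e′))
          (h j)))
      ... | inj₂ e        = ≡.trans (≡.cong (Vec.lookup (c ∷ u)) e) (h j)
      first-letter : ∀ u → ΣL (allFin q) (λ c → indicator (does (fixed? w (c ∷ u)))) ≈ indicator (does (fixed? v u))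
      first-letter u = by-dec (fixed? v u)
        where
        by-dec : (d : Dec (Fixed v u)) → ΣL (allFin q) (λ c → indicator (does (fixed? w (c ∷ u)))) ≈ indicator (does d)
        by-dec (yes h) = trans (ΣL-cong (allFin q) λ c → reflexive (≡.cong indicator
          (does-⇔ (mk⇔ (proj₁ ∘ to c u) (λ e → from c u (e , h))) (fixed? w (c ∷ u)) (c Fin.≟ Vec.lookup u i₀))))
          (ΣFin-indicator (Vec.lookup u i₀))
        by-dec (no ¬h) = trans (ΣL-cong (allFin q) λ c → reflexive (≡.cong indicator (dec-false (fixed? w (c ∷ u))
            (¬h ∘ proj₂ ∘ to c u))))
          (ΣL-0 (allFin q))

  ΣL-words-permute : ∀ {q} (π : Permutation′ q) n (F : Vec (Fin q) n → Carrier) →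
    ΣL (words (allFin q) n) (λ u → F (Vec.map (π ⟨$⟩ʳ_) u)) ≈ ΣL (words (allFin q) n) F
  ΣL-words-permute π zero    F = refl
  ΣL-words-permute {q} π (suc n) F = begin
    ΣL (words (allFin q) (suc n)) (λ u → F (Vec.map (π ⟨$⟩ʳ_) u))
      ≈⟨ ΣL-words-suc (allFin q) n _ ⟩
    ΣL (allFin q) (λ c → ΣL (words (allFin q) n) (λ u → F ((π ⟨$⟩ʳ c) ∷ Vec.map (π ⟨$⟩ʳ_) u)))
      ≈⟨ ΣL-cong (allFin q) (λ c → ΣL-words-permute π n (λ u → F ((π ⟨$⟩ʳ c) ∷ u))) ⟩
    ΣL (allFin q) (λ c → ΣL (words (allFin q) n) (λ u → F ((π ⟨$⟩ʳ c) ∷ u)))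
      ≈⟨ ΣL-permute π (λ c → ΣL (words (allFin q) n) (λ u → F (c ∷ u))) ⟩
    ΣL (allFin q) (λ c → ΣL (words (allFin q) n) (λ u → F (c ∷ u)))
      ≈⟨ ΣL-words-suc (allFin q) n F ⟨
    ΣL (words (allFin q) (suc n)) F ∎

  ΣL-words-map : ∀ {A B : Set} (h : A → B) as n (F : Vec B n → Carrier) →
    ΣL (words (map h as) n) F ≈ ΣL (words as n) (λ u → F (Vec.map h u))
  ΣL-words-map h as zero    F = refl
  ΣL-words-map h as (suc n) F = trans (ΣL-words-suc (map h as) n F) (trans (reflexive (ΣL-map h as _))
    (trans (ΣL-cong as λ a → ΣL-words-map h as n (λ u → F (h a ∷ u))) (sym (ΣL-words-suc as n (λ u → F (Vec.map h u))))))

  ΣL-words-drop : ∀ {A : Set} (as : List A) z n (F : Vec A n → Carrier) →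
    (∀ u i → Vec.lookup u i ≡ z → F u ≈ 0#) → ΣL (words (as ++ z ∷ []) n) F ≈ ΣL (words as n) F
  ΣL-words-drop as z zero    F e = refl
  ΣL-words-drop as z (suc n) F e = begin
    ΣL (words (as ++ z ∷ []) (suc n)) F
      ≈⟨ ΣL-words-suc (as ++ z ∷ []) n F ⟩
    ΣL (as ++ z ∷ []) (λ a → ΣL (words (as ++ z ∷ []) n) (λ u → F (a ∷ u)))
      ≈⟨ ΣL-++ as (z ∷ []) _ ⟩
    ΣL as (λ a → ΣL (words (as ++ z ∷ []) n) (λ u → F (a ∷ u))) + (ΣL (words (as ++ z ∷ []) n) (λ u → F (z ∷ u)) + 0#)
      ≈⟨ +-cong (ΣL-cong as λ a → ΣL-words-drop as z n (λ u → F (a ∷ u)) λ u i h → e (a ∷ u) (suc i) h)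
           (trans (+-identityʳ _) (trans (ΣL-cong (words (as ++ z ∷ []) n) λ u → e (z ∷ u) zero ≡.refl) (ΣL-0 (words
               (as ++ z ∷ []) n)))) ⟩
    ΣL as (λ a → ΣL (words as n) (λ u → F (a ∷ u))) + 0#
      ≈⟨ trans (+-identityʳ _) (sym (ΣL-words-suc as n F)) ⟩
    ΣL (words as (suc n)) F ∎

open import Defs using (Bounded; []; _∷_; IsParkingFunction; isParkingFunction?; parkingFunctions)

-- Pollak's argument

count≤ : ℕ → List ℕ → ℕ
count≤ k []       = 0
count≤ k (b ∷ bs) = (if does (b ℕ.≤? k) then 1 else 0) ℕ.+ count≤ k bs

count≤-↭ : ∀ k {as bs} → as ↭ bs → count≤ k as ≡ count≤ k bs
count≤-↭ k ↭.refl        = ≡.refl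
count≤-↭ k (↭.prep a p)  = ≡.cong ((if does (a ℕ.≤? k) then 1 else 0) ℕ.+_) (count≤-↭ k p)
count≤-↭ k (↭.swap {as} {bs} a b p) = ≡.trans (≡.cong (λ z → x ℕ.+ (y ℕ.+ z)) (count≤-↭ k p))
  (≡.trans (≡.sym (ℕ.+-assoc x y _)) (≡.trans (≡.cong (ℕ._+ count≤ k bs) (ℕ.+-comm x y)) (ℕ.+-assoc y x _)))
  where
  x = if does (a ℕ.≤? k) then 1 else 0
  y = if does (b ℕ.≤? k) then 1 else 0
count≤-↭ k (↭.trans p q) = ≡.trans (count≤-↭ k p) (count≤-↭ k q)

count≤-∷ : ∀ {k b} bs → b ℕ.≤ k → count≤ k (b ∷ bs) ≡ suc (count≤ k bs)
count≤-∷ {k} {b} bs b≤k rewrite dec-true (b ℕ.≤? k) b≤k = ≡.refl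

count≤-∷-≰ : ∀ {k b} bs → ¬ (b ℕ.≤ k) → count≤ k (b ∷ bs) ≡ count≤ k bs
count≤-∷-≰ {k} {b} bs b≰k rewrite dec-false (b ℕ.≤? k) b≰k = ≡.refl

count≤-∷-≤ : ∀ k b bs → count≤ k (b ∷ bs) ℕ.≤ suc (count≤ k bs)
count≤-∷-≤ k b bs with b ℕ.≤? k
... | yes b≤k = ℕ.≤-reflexive (count≤-∷ bs b≤k)
... | no  b≰k = ℕ.≤-trans (ℕ.≤-reflexive (count≤-∷-≰ bs b≰k)) (ℕ.n≤1+n _)

count≤-length : ∀ k bs → count≤ k bs ℕ.≤ length bs
count≤-length k []       = ℕ.z≤n
count≤-length k (b ∷ bs) = ℕ.≤-trans (count≤-∷-≤ k b bs) (ℕ.s≤s (count≤-length k bs))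

count≤-none : ∀ k {bs} → All (k ℕ.<_) bs → count≤ k bs ≡ 0
count≤-none k []                  = ≡.refl
count≤-none k {b ∷ bs} (h ∷ hs) = ≡.trans (count≤-∷-≰ bs (ℕ.<⇒≱ h)) (count≤-none k hs)

Bounded⇒count≤ : ∀ {k bs} → Bounded k bs → ∀ j → j ℕ.≤ k ℕ.+ length bs → j ℕ.≤ k ℕ.+ count≤ j bs
Bounded⇒count≤ {k} []               j h = h
Bounded⇒count≤ {k} {b ∷ bs} (b≤ ∷ B) j h with j ℕ.≤? k
... | yes j≤k = ℕ.≤-trans j≤k (ℕ.m≤m+n k _)
... | no  j≰k = ≡.subst (λ z → j ℕ.≤ k ℕ.+ z) (≡.sym (count≤-∷ bs (ℕ.≤-trans b≤ (ℕ.≰⇒> j≰k))))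
  (≡.subst (j ℕ.≤_) (≡.sym (ℕ.+-suc k _)) (Bounded⇒count≤ B j (≡.subst (j ℕ.≤_) (ℕ.+-suc k _) h)))

count≤⇒Bounded : ∀ {k bs} → AllPairs ℕ._≤_ bs → (∀ j → j ℕ.≤ k ℕ.+ length bs → j ℕ.≤ k ℕ.+ count≤ j bs) → Bounded k bs
count≤⇒Bounded {k} {[]}     _        _ = []
count≤⇒Bounded {k} {b ∷ bs} (b≤bs ∷ s) h = b≤suc-k ∷ count≤⇒Bounded s λ j j≤ →
  ℕ.≤-trans (h j (≡.subst (j ℕ.≤_) (≡.sym (ℕ.+-suc k _)) j≤))
    (≡.subst (k ℕ.+ count≤ j (b ∷ bs) ℕ.≤_) (ℕ.+-suc k _) (ℕ.+-monoʳ-≤ k (count≤-∷-≤ j b bs)))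
  where
  b≤suc-k : b ℕ.≤ suc k
  b≤suc-k with b ℕ.≤? suc k
  ... | yes b≤ = b≤
  ... | no  b≰ = contradiction (h (suc k) (≡.subst (suc k ℕ.≤_) (≡.sym (ℕ.+-suc k _)) (ℕ.s≤s (ℕ.m≤m+n k _))))
    (ℕ.<⇒≱ (ℕ.s≤s (ℕ.≤-reflexive (≡.trans (≡.cong (k ℕ.+_) (≡.trans (count≤-∷-≰ bs b≰)
      (count≤-none (suc k) (All.map (ℕ.<-≤-trans (ℕ.≰⇒> b≰)) b≤bs)))) (ℕ.+-identityʳ k)))))

-- The k-th smallest entry is at most k exactly when at least k entries are at most k, and such
-- counts ignore the order of the entries.
parking⇔count≤ : ∀ {n} (a : Vec ℕ n) → IsParkingFunction a ⇔ (∀ k → k ℕ.≤ n → k ℕ.≤ count≤ k (Vec.toList a))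
parking⇔count≤ {n} a = mk⇔
  (λ B k k≤n → ≡.subst (k ℕ.≤_) (count≤-↭ k (sort-↭ (Vec.toList a))) (Bounded⇒count≤ B k (≡.subst (k ℕ.≤_) (≡.sym len) k≤n)))
  (λ h → count≤⇒Bounded (Linked⇒AllPairs ℕ.≤-trans (sort-↗ (Vec.toList a))) λ k k≤ →
    ≡.subst (k ℕ.≤_) (≡.sym (count≤-↭ k (sort-↭ (Vec.toList a)))) (h k (≡.subst (k ℕ.≤_) len k≤)))
  where
  len : length (sort (Vec.toList a)) ≡ n
  len = ≡.trans (↭.↭-length (sort-↭ (Vec.toList a))) (Vec.length-toList a)

-- The cycle lemma for a walk A with A (j + n + 1) = A j + n: the starting point is the first
-- minimum of A j − j.
module CycleLemma (n : ℕ) (A : ℕ → ℕ) (periodic : ∀ j → A (j ℕ.+ suc n) ≡ A j ℕ.+ n) where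
  Valid : ℕ → Set
  Valid r = ∀ k → k ℕ.≤ n → A r ℕ.+ k ℕ.≤ A (r ℕ.+ k)

  first-minimum : ∀ (B : ℕ → ℕ) m → ∃ λ r → r ℕ.≤ m × (∀ j → j ℕ.< r → B r ℕ.< B j) × (∀ j → j ℕ.≤ m → B r ℕ.≤ B j)
  first-minimum B zero    = 0 , ℕ.z≤n , (λ _ ()) , λ { zero _ → ℕ.≤-refl }
  first-minimum B (suc m) with first-minimum B m
  ... | r , r≤m , strict , weak with B r ℕ.≤? B (suc m)
  ...   | yes Br≤ = r , ℕ.m≤n⇒m≤1+n r≤m , strict , λ j j≤ → [ (λ j<sm → weak j (ℕ.≤-pred j<sm)) , (λ { ≡.refl → Br≤ }) ]′
      (ℕ.m≤n⇒m<n∨m≡n j≤)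
  ...   | no  Br≰ = suc m , ℕ.≤-refl , (λ j j<sm → ℕ.<-≤-trans (ℕ.≰⇒> Br≰) (weak j (ℕ.≤-pred j<sm))) ,
    λ j j≤ → [ (λ j<sm → ℕ.<⇒≤ (ℕ.<-≤-trans (ℕ.≰⇒> Br≰) (weak j (ℕ.≤-pred j<sm)))) , (λ { ≡.refl → ℕ.≤-refl }) ]′
        (ℕ.m≤n⇒m<n∨m≡n j≤)

  valid-exists : ∃ λ r → r ℕ.≤ n × Valid r
  -- Adding n - j instead of subtracting j stays within the natural numbers and leaves the minima in
  -- place.
  valid-exists with first-minimum (λ j → A j ℕ.+ (n ℕ.∸ j)) n
  ... | r , r≤n , strict , weak = r , r≤n , valid
    where
    valid : Valid r
    valid k k≤n with r ℕ.+ k ℕ.≤? n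
    ... | yes r+k≤n = ℕ.+-cancelʳ-≤ (n ℕ.∸ (r ℕ.+ k)) (A r ℕ.+ k) (A (r ℕ.+ k))
      (≡.subst (ℕ._≤ A (r ℕ.+ k) ℕ.+ (n ℕ.∸ (r ℕ.+ k))) (≡.trans (≡.cong (A r ℕ.+_) split) (≡.sym (ℕ.+-assoc (A r) k _))) (weak
          (r ℕ.+ k) r+k≤n))
      where
      split : n ℕ.∸ r ≡ k ℕ.+ (n ℕ.∸ (r ℕ.+ k))
      split = ≡.trans (≡.sym (ℕ.m+[n∸m]≡n (ℕ.m+n≤o⇒m≤o∸n k (≡.subst (ℕ._≤ n) (ℕ.+-comm r k) r+k≤n)))) (≡.cong (k ℕ.+_)
          (ℕ.∸-+-assoc n r k))
    -- Past the end the walk is at j < r one period later, where A j - j has dropped by one. The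
    -- strict inequality before the first minimum compensates for this.
    ... | no  r+k≰n with ℕ.m≤n⇒∃[o]m+o≡n (ℕ.≰⇒> r+k≰n)
    ...   | j , sn+j≡r+k = ≡.subst (A r ℕ.+ k ℕ.≤_) (≡.sym A-wrap) goal
      where
      j<r : j ℕ.< r
      j<r = ℕ.+-cancelˡ-< n j r (ℕ.<-≤-trans (ℕ.≤-reflexive sn+j≡r+k) (≡.subst (r ℕ.+ k ℕ.≤_) (ℕ.+-comm r n) (ℕ.+-monoʳ-≤ r k≤n)))
      x = n ℕ.∸ r
      y = n ℕ.∸ j
      k≡ : k ≡ suc x ℕ.+ j
      k≡ = ℕ.+-cancelˡ-≡ r k (suc x ℕ.+ j) (≡.trans (≡.sym sn+j≡r+k) (≡.trans
        (≡.cong (λ z → suc z ℕ.+ j) (≡.sym (ℕ.m+[n∸m]≡n r≤n))) (≡.trans (≡.cong (ℕ._+ j) (≡.sym (ℕ.+-suc r x))) (ℕ.+-assoc r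
            (suc x) j))))
      A-wrap : A (r ℕ.+ k) ≡ A j ℕ.+ n
      A-wrap = ≡.trans (≡.cong A (≡.trans (≡.sym sn+j≡r+k) (ℕ.+-comm (suc n) j))) (periodic j)
      goal : A r ℕ.+ k ℕ.≤ A j ℕ.+ n
      goal = ≡.subst₂ ℕ._≤_
        (≡.trans (≡.cong (ℕ._+ j) (≡.sym (ℕ.+-suc (A r) x))) (≡.trans (ℕ.+-assoc (A r) (suc x) j) (≡.cong (A r ℕ.+_) (≡.sym k≡))))
        (≡.trans (ℕ.+-assoc (A j) y j) (≡.cong (A j ℕ.+_) (ℕ.m∸n+n≡m (ℕ.≤-trans (ℕ.<⇒≤ j<r) r≤n))))
        (ℕ.+-monoˡ-≤ j (strict j j<r))

  -- Validity at r as far as r′, and at r′ for the rest of the period, would make A grow by n + 1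
  -- over a period, whereas it grows by n.
  valid-ordered : ∀ {r r′} → r′ ℕ.≤ n → Valid r → Valid r′ → ¬ (r ℕ.< r′)
  valid-ordered {r} {r′} r′≤n v v′ r<r′ with ℕ.m≤n⇒∃[o]m+o≡n r<r′
  ... | d , ≡.refl = ℕ.n≮n (A r ℕ.+ n) (ℕ.≤-trans (ℕ.≤-reflexive lhs) (ℕ.≤-trans (ℕ.+-monoˡ-≤ k (v (suc d) d<n)) (ℕ.≤-trans second
      (ℕ.≤-reflexive rhs))))
    where
    d<n : suc d ℕ.≤ n
    d<n = ℕ.≤-trans (ℕ.s≤s (ℕ.m≤n+m d r)) r′≤n
    k = n ℕ.∸ d
    lhs : suc (A r ℕ.+ n) ≡ (A r ℕ.+ suc d) ℕ.+ k
    lhs = ≡.trans (≡.sym (ℕ.+-suc (A r) n)) (≡.trans (≡.cong (λ z → A r ℕ.+ suc z) (≡.sym (ℕ.m+[n∸m]≡n (ℕ.<⇒≤ d<n)))) (≡.sym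
        (ℕ.+-assoc (A r) (suc d) k)))
    second : A (r ℕ.+ suc d) ℕ.+ k ℕ.≤ A (suc (r ℕ.+ d) ℕ.+ k)
    second = ≡.subst (λ z → A z ℕ.+ k ℕ.≤ A (suc (r ℕ.+ d) ℕ.+ k)) (≡.sym (ℕ.+-suc r d)) (v′ k (ℕ.m∸n≤m n d))
    rhs : A (suc (r ℕ.+ d) ℕ.+ k) ≡ A r ℕ.+ n
    rhs = ≡.trans (≡.cong A (≡.trans (≡.cong suc (≡.trans (ℕ.+-assoc r d k) (≡.cong (r ℕ.+_) (ℕ.m+[n∸m]≡n (ℕ.<⇒≤ d<n))))) (≡.sym
        (ℕ.+-suc r n)))) (periodic r)

  valid-unique : ∀ {r r′} → r ℕ.≤ n → r′ ℕ.≤ n → Valid r → Valid r′ → r ≡ r′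
  valid-unique {r} {r′} r≤ r′≤ v v′ with ℕ.<-cmp r r′
  ... | tri< r<r′ _ _ = contradiction r<r′ (valid-ordered r′≤ v v′)
  ... | tri≈ _ e _    = e
  ... | tri> _ _ r′<r = contradiction r′<r (valid-ordered r≤ v′ v)

module Rotation (n : ℕ) where
  -- Subtraction of 1 modulo n + 1.
  rotation : Permutation′ (suc n)
  rotation = Perm.insert zero (Fin.fromℕ n) Perm.id

  toℕ-rotation-suc : ∀ v → toℕ (rotation ⟨$⟩ʳ suc v) ≡ toℕ v
  toℕ-rotation-suc = go n
    where
    go : ∀ n (v : Fin n) → toℕ (punchIn (Fin.fromℕ n) v) ≡ toℕ v
    go (suc n) zero    = ≡.refl
    go (suc n) (suc v) = ≡.cong suc (go n v)

  rotate : ℕ → Fin (suc n) → Fin (suc n)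
  rotate zero    v = v
  rotate (suc r) v = rotate r (rotation ⟨$⟩ʳ v)

  -- The number of times v stands at 0 during k successive decrements. For k ≤ n + 1 this tells
  -- whether v < k; beyond, it supplies the periodic continuation used by the cycle lemma. Starting
  -- after r decrements shifts the walk, as `visits-+` records.
  visits : Fin (suc n) → ℕ → ℕ
  visits v       zero    = 0
  visits zero    (suc k) = suc (visits (rotation ⟨$⟩ʳ zero) k)
  visits (suc v) (suc k) = visits (rotation ⟨$⟩ʳ suc v) k

  visits-< : ∀ v k → k ℕ.≤ suc n → visits v k ≡ (if does (toℕ v ℕ.<? k) then 1 else 0)
  visits-< v       zero    _           = ≡.refl
  visits-< zero    (suc k) (ℕ.s≤s k≤n) = ≡.cong suc (≡.trans (visits-< _ k (ℕ.m≤n⇒m≤1+n k≤n))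
    (≡.cong (λ b → if b then 1 else 0) (dec-false (toℕ (Fin.fromℕ n) ℕ.<? k) λ h → ℕ.<⇒≱ h (≡.subst (k ℕ.≤_) (≡.sym
        (Fin.toℕ-fromℕ n)) k≤n))))
  visits-< (suc v) (suc k) (ℕ.s≤s k≤n) = ≡.trans (visits-< _ k (ℕ.m≤n⇒m≤1+n k≤n))
    (≡.cong (λ z → if does (z ℕ.<? k) then 1 else 0) (toℕ-rotation-suc v))

  visits-+ : ∀ v r k → visits v (r ℕ.+ k) ≡ visits v r ℕ.+ visits (rotate r v) k
  visits-+ v       zero    k = ≡.refl
  visits-+ zero    (suc r) k = ≡.cong suc (visits-+ _ r k)
  visits-+ (suc v) (suc r) k = visits-+ _ r k

  totalVisits : ∀ {m} → Vec (Fin (suc n)) m → ℕ → ℕ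
  totalVisits []      k = 0
  totalVisits (v ∷ u) k = visits v k ℕ.+ totalVisits u k

  totalVisits-+ : ∀ {m} (u : Vec (Fin (suc n)) m) r k → totalVisits u (r ℕ.+ k) ≡ totalVisits u r ℕ.+ totalVisits (Vec.map
      (rotate r) u) k
  totalVisits-+ []      r k = ≡.refl
  totalVisits-+ (v ∷ u) r k = ≡.trans (≡.cong₂ ℕ._+_ (visits-+ v r k) (totalVisits-+ u r k)) (interchange (visits v r) (visits
      (rotate r v) k) (totalVisits u r) (totalVisits (Vec.map (rotate r) u) k))
    where open import Algebra.Properties.CommutativeSemigroup ℕ.+-commutativeSemigroup using (interchange)

  totalVisits-full : ∀ {m} (u : Vec (Fin (suc n)) m) → totalVisits u (suc n) ≡ m
  totalVisits-full []      = ≡.refl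
  totalVisits-full (v ∷ u) = ≡.cong₂ ℕ._+_ (≡.trans (visits-< v (suc n) ℕ.≤-refl)
    (≡.cong (λ b → if b then 1 else 0) (dec-true (toℕ v ℕ.<? suc n) (Fin.toℕ<n v)))) (totalVisits-full u)

  word : ∀ {m} → Vec (Fin (suc n)) m → Vec ℕ m
  word = Vec.map (suc ∘ toℕ)

  totalVisits-count≤ : ∀ {m} (u : Vec (Fin (suc n)) m) k → k ℕ.≤ suc n → totalVisits u k ≡ count≤ k (Vec.toList (word u))
  totalVisits-count≤ []      k _ = ≡.refl
  totalVisits-count≤ (v ∷ u) k h = ≡.cong₂ ℕ._+_ (visits-< v k h) (totalVisits-count≤ u k h)

  Parking : Vec (Fin (suc n)) n → Set
  Parking u = IsParkingFunction (word u)

  parking? : ∀ u → Dec (Parking u)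
  parking? u = isParkingFunction? (word u)

  module _ (u : Vec (Fin (suc n)) n) where
    open CycleLemma n (totalVisits u) (λ j → ≡.trans (totalVisits-+ u j (suc n)) (≡.cong (totalVisits u j ℕ.+_) (totalVisits-full (Vec.map (rotate j) u)))) public

    -- The number of entries at most k in the rotated word is A(r + k) - A(r), and the parking
    -- condition bounds it below by k.
    rotated-parking⇔Valid : ∀ r → Parking (Vec.map (rotate r) u) ⇔ Valid r
    rotated-parking⇔Valid r = mk⇔
      (λ p k k≤n → ≡.subst (totalVisits u r ℕ.+ k ℕ.≤_) (≡.sym (totalVisits-+ u r k)) (ℕ.+-monoʳ-≤ (totalVisits u r)
        (≡.subst (k ℕ.≤_) (≡.sym (count k k≤n)) (Equivalence.to (parking⇔count≤ (word (Vec.map (rotate r) u))) p k k≤n))))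
      (λ v → Equivalence.from (parking⇔count≤ (word (Vec.map (rotate r) u))) λ k k≤n → ≡.subst (k ℕ.≤_) (count k k≤n)
        (ℕ.+-cancelˡ-≤ (totalVisits u r) k _ (≡.subst (totalVisits u r ℕ.+ k ℕ.≤_) (totalVisits-+ u r k) (v k k≤n))))
      where
      count : ∀ k → k ℕ.≤ n → totalVisits (Vec.map (rotate r) u) k ≡ count≤ k (Vec.toList (word (Vec.map (rotate r) u)))
      count k k≤n = totalVisits-count≤ (Vec.map (rotate r) u) k (ℕ.m≤n⇒m≤1+n k≤n)

module PollakSum (R : CommutativeRing 0ℓ 0ℓ) (n : ℕ) where
  open CommutativeRing R hiding (zero)
  open Sums R
  open FiniteSums R
  open ClassProducts R
  open WordCounts R
  open Rotation n
  open import Relation.Binary.Reasoning.Setoid setoid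

  private
    q = suc n
    W = words (allFin q) n

  ΣL-indicator-unique : ∀ (b : ℕ → Bool) m r → r ℕ.< m → b r ≡ true → (∀ j → j ℕ.< m → b j ≡ true → j ≡ r) →
                        ΣL (downFrom m) (indicator ∘ b) ≈ 1#
  ΣL-indicator-unique b (suc m) r r<sm br uniq = by-head (b m) ≡.refl
    where
    none : ∀ m′ → m′ ℕ.≤ m → (∀ j → j ℕ.< m′ → b j ≢ true) → ΣL (downFrom m′) (indicator ∘ b) ≈ 0#
    none zero     _ _ = refl
    none (suc m′) h e = trans (+-cong (off (b m′) ≡.refl) (none m′ (ℕ.<⇒≤ h) λ j j<m′ → e j (ℕ.m≤n⇒m≤1+n j<m′))) (+-identityˡ 0#)
      where
      off : ∀ c → b m′ ≡ c → indicator c ≈ 0#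
      off true  eq = contradiction eq (e m′ ℕ.≤-refl)
      off false _  = refl
    by-head : ∀ c → b m ≡ c → indicator c + ΣL (downFrom m) (indicator ∘ b) ≈ 1#
    by-head true  eq = trans (+-congˡ (none m ℕ.≤-refl λ j j<m bj →
      ℕ.<⇒≢ j<m (≡.trans (uniq j (ℕ.m≤n⇒m≤1+n j<m) bj) (≡.sym (uniq m ℕ.≤-refl eq))))) (+-identityʳ 1#)
    by-head false eq = trans (+-identityˡ _) (ΣL-indicator-unique b m r
      (ℕ.≤∧≢⇒< (ℕ.≤-pred r<sm) λ r≡m → contradiction (≡.trans (≡.sym br) (≡.trans (≡.cong b r≡m) eq)) λ ()) br
      λ j j<m → uniq j (ℕ.m≤n⇒m≤1+n j<m))

  one-rotation : ∀ u → ΣL (downFrom q) (λ r → indicator (does (parking? (Vec.map (rotate r) u)))) ≈ 1#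
  one-rotation u with valid-exists u
  ... | r , r≤n , v = ΣL-indicator-unique (λ r → does (parking? (Vec.map (rotate r) u))) q r (ℕ.s≤s r≤n)
    (dec-true (parking? (Vec.map (rotate r) u)) (Equivalence.from (rotated-parking⇔Valid u r) v))
    λ j j<q e → valid-unique u (ℕ.≤-pred j<q) r≤n (Equivalence.to (rotated-parking⇔Valid u j) (holds (parking? (Vec.map
        (rotate j) u)) e)) v
    where
    holds : ∀ {P : Set} (d : Dec P) → does d ≡ true → P
    holds (yes p) _ = p

  ΣL-words-rotate : ∀ r (F : Vec (Fin q) n → Carrier) → ΣL W (λ u → F (Vec.map (rotate r) u)) ≈ ΣL W F
  ΣL-words-rotate zero    F = ΣL-cong W λ u → reflexive (≡.cong F (Vec.map-id u))
  ΣL-words-rotate (suc r) F = trans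
    (ΣL-cong W λ u → reflexive (≡.cong F (Vec.map-∘ (rotate r) (rotation ⟨$⟩ʳ_) u)))
    (trans (ΣL-words-permute rotation n (λ u → F (Vec.map (rotate r) u))) (ΣL-words-rotate r F))

  pollak : ∀ (F : Vec (Fin q) n → Carrier) → (∀ r u → F (Vec.map (rotate r) u) ≈ F u) →
           ΣL W F ≈ fromℕ q * ΣL W (λ u → indicator (does (parking? u)) * F u)
  pollak F inv = begin
    ΣL W F
      ≈⟨ ΣL-cong W (λ u → trans (sym (*-identityˡ _)) (trans (*-congʳ (sym (one-rotation u))) (ΣL-*ʳ (F u) (downFrom q) _))) ⟩
    ΣL W (λ u → ΣL (downFrom q) (λ r → indicator (does (parking? (Vec.map (rotate r) u))) * F u))
      ≈⟨ ΣL-swap W (downFrom q) _ ⟩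
    ΣL (downFrom q) (λ r → ΣL W (λ u → indicator (does (parking? (Vec.map (rotate r) u))) * F u))
      ≈⟨ ΣL-cong (downFrom q) (λ r → trans (ΣL-cong W λ u → *-congˡ (sym (inv r u))) (ΣL-words-rotate r (λ u → indicator (does
          (parking? u)) * F u))) ⟩
    ΣL (downFrom q) (λ _ → ΣL W (λ u → indicator (does (parking? u)) * F u))
      ≈⟨ trans (ΣL-constant (downFrom q) _) (*-congʳ (reflexive (≡.cong fromℕ (List.length-downFrom q)))) ⟩
    fromℕ q * ΣL W (λ u → indicator (does (parking? u)) * F u) ∎

  rotate-injective : ∀ r {v v′} → rotate r v ≡ rotate r v′ → v ≡ v′
  rotate-injective zero    e = e
  rotate-injective (suc r) e = permutation-injective rotation (rotate-injective r e)

  Fixed-map : ∀ {A B : Set} (h : A → B) → (∀ {a b} → h a ≡ h b → a ≡ b) → ∀ w (u : Vec A n) → Fixed w (Vec.map h u) ⇔ Fixed w u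
  Fixed-map h inj w u = mk⇔
    (λ f i → inj (≡.trans (≡.sym (Vec.lookup-map (w ⟨$⟩ʳ i) h u)) (≡.trans (f i) (Vec.lookup-map i h u))))
    (λ f i → ≡.trans (Vec.lookup-map (w ⟨$⟩ʳ i) h u) (≡.trans (≡.cong h (f i)) (≡.sym (Vec.lookup-map i h u))))

  length-filter : ∀ {A : Set} {P : A → Set} (P? : ∀ a → Dec (P a)) as → fromℕ (length (filter P? as)) ≈ ΣL as (λ a → indicator
      (does (P? a)))
  length-filter P? []       = refl
  length-filter P? (a ∷ as) with does (P? a)
  ... | true  = +-congˡ (length-filter P? as)
  ... | false = trans (length-filter P? as) (sym (+-identityˡ _))

  upTo-word : map suc (upTo n) ++ suc n ∷ [] ≡ map (suc ∘ toℕ) (allFin q)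
  upTo-word = ≡.trans (≡.sym (List.map-++ suc (upTo n) (n ∷ []))) (≡.trans (≡.cong (map suc) (List.upTo-∷ʳ n))
    (≡.trans (List.map-applyUpTo id suc q) (≡.trans (applyUpTo≡tabulate suc q) (≡.sym (List.map-tabulate id (suc ∘ toℕ))))))
    where
    open import Data.List.Base using (applyUpTo)
    applyUpTo≡tabulate : ∀ (f : ℕ → ℕ) m → applyUpTo f m ≡ tabulate {n = m} (f ∘ toℕ)
    applyUpTo≡tabulate f zero    = ≡.refl
    applyUpTo≡tabulate f (suc m) = ≡.cong (f 0 ∷_) (applyUpTo≡tabulate (f ∘ suc) m)

  parking-letter : ∀ (a : Vec ℕ n) i → Vec.lookup a i ≡ suc n → ¬ IsParkingFunction a
  parking-letter a i e p = ℕ.<⇒≱ (short a i e) (Equivalence.to (parking⇔count≤ a) p n ℕ.≤-refl)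
    where
    short : ∀ {m} (a : Vec ℕ m) i → Vec.lookup a i ≡ suc n → count≤ n (Vec.toList a) ℕ.< m
    short (b ∷ a) zero    ≡.refl = ℕ.s≤s (ℕ.≤-trans (ℕ.≤-reflexive (count≤-∷-≰ (Vec.toList a) (ℕ.n≮n n)))
      (≡.subst (count≤ n (Vec.toList a) ℕ.≤_) (Vec.length-toList a) (count≤-length n (Vec.toList a))))
    short (b ∷ a) (suc i) e = ℕ.≤-<-trans (count≤-∷-≤ n b (Vec.toList a)) (ℕ.s≤s (short a i e))

  fixedParking? : ∀ (w : Permutation′ n) (a : Vec ℕ n) → Dec (w · a ≡ a)
  fixedParking? w a = Vec.≡-dec ℕ._≟_ (w · a) a

  -- Rotating the alphabet is injective on letters, so it preserves being fixed by w, and Pollak's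
  -- count applies to the fixed words alone.
  parkingFixed : ∀ w m → fromℕ q * fromℕ (length (filter (fixedParking? w) (parkingFunctions n))) ≈ cycleProduct (const
      (fromℕ q)) w m
  parkingFixed w m = begin
    fromℕ q * fromℕ (length (filter (fixedParking? w) (parkingFunctions n)))
      ≈⟨ *-congˡ (length-filter (fixedParking? w) (parkingFunctions n)) ⟩
    fromℕ q * ΣL (parkingFunctions n) (λ a → indicator (does (fixedParking? w a)))
      ≈⟨ *-congˡ (trans (ΣL-filter isParkingFunction? (words (map suc (upTo n)) n) _) (ΣL-cong (words (map suc (upTo n)) n)
          λ a → if-* (does (isParkingFunction? a)) _)) ⟩
    fromℕ q * ΣL (words (map suc (upTo n)) n) G
      ≈⟨ *-congˡ (ΣL-words-drop (map suc (upTo n)) (suc n) n G (λ a i e → trans (*-congʳ (reflexive (≡.cong indicator (dec-false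
          (isParkingFunction? a) (parking-letter a i e))))) (zeroˡ _))) ⟨
    fromℕ q * ΣL (words (map suc (upTo n) ++ suc n ∷ []) n) G
      ≡⟨ ≡.cong (λ as → fromℕ q * ΣL (words as n) G) upTo-word ⟩
    fromℕ q * ΣL (words (map (suc ∘ toℕ) (allFin q)) n) G
      ≈⟨ *-congˡ (trans (ΣL-words-map (suc ∘ toℕ) (allFin q) n G) (ΣL-cong W λ u → *-congˡ (reflexive (≡.cong indicator
          (fixed-word u))))) ⟩
    fromℕ q * ΣL W (λ u → indicator (does (parking? u)) * indicator (does (fixed? w u)))
      ≈⟨ pollak (λ u → indicator (does (fixed? w u))) (λ r u → reflexive (≡.cong indicator
           (does-⇔ (Fixed-map (rotate r) (rotate-injective r) w u) (fixed? w (Vec.map (rotate r) u)) (fixed? w u)))) ⟨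
    ΣL W (λ u → indicator (does (fixed? w u)))
      ≈⟨ fixedWords q n w m ⟩
    cycleProduct (const (fromℕ q)) w m ∎
    where
    G : Vec ℕ n → Carrier
    G a = indicator (does (isParkingFunction? a)) * indicator (does (fixedParking? w a))
    if-* : ∀ b x → (if b then x else 0#) ≈ indicator b * x
    if-* true  x = sym (*-identityˡ x)
    if-* false x = sym (zeroˡ x)
    fixed-word : ∀ u → does (fixedParking? w (word u)) ≡ does (fixed? w u)
    fixed-word u = does-⇔ (mk⇔
      (λ e → Equivalence.to (Fixed-map (suc ∘ toℕ) (Fin.toℕ-injective ∘ ℕ.suc-injective) w u) (Equivalence.from (Fixed⇔· w
          (word u)) e))
      (λ f → Equivalence.to (Fixed⇔· w (word u)) (Equivalence.from (Fixed-map (suc ∘ toℕ)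
          (Fin.toℕ-injective ∘ ℕ.suc-injective) w u) f)))
      (fixedParking? w (word u)) (fixed? w u)

-- Rational scalars

open import Defs
open import Data.Rational.Base using (_/_)

/1-suc : ∀ n → (ℤ.+ suc n) / 1 ≡ 1ℚ ℚ.+ (ℤ.+ n) / 1
/1-suc n = ℚ.toℚᵘ-injective (begin
  ℚ.toℚᵘ ((ℤ.+ suc n) / 1)                    ≈⟨ ℚ.toℚᵘ-fromℚᵘ (ℚᵘ.mkℚᵘ (ℤ.+ suc n) 0) ⟩
  ℚᵘ.mkℚᵘ (ℤ.+ suc n) 0                       ≈⟨ ℚᵘ.*≡* (≡.cong (ℤ._* (ℤ.+ 1)) (≡.sym (≡.cong (λ z → ℤ.+ 1 ℤ.+ z) (ℤ.*-identityʳ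
      (ℤ.+ n))))) ⟩
  ℚᵘ.1ℚᵘ ℚᵘ.+ ℚᵘ.mkℚᵘ (ℤ.+ n) 0               ≈⟨ ℚᵘ.+-congʳ ℚᵘ.1ℚᵘ (ℚ.toℚᵘ-fromℚᵘ (ℚᵘ.mkℚᵘ (ℤ.+ n) 0)) ⟨
  ℚᵘ.1ℚᵘ ℚᵘ.+ ℚ.toℚᵘ ((ℤ.+ n) / 1)            ≈⟨ ℚ.toℚᵘ-homo-+ 1ℚ ((ℤ.+ n) / 1) ⟨
  ℚ.toℚᵘ (1ℚ ℚ.+ (ℤ.+ n) / 1)                 ∎)
  where open ℚᵘ.≃-Reasoning

/-inverse : ∀ m .{{_ : ℕ.NonZero m}} → ((ℤ.+ 1) / m) ℚ.* ((ℤ.+ m) / 1) ≡ 1ℚ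
/-inverse (suc n) = ℚ.toℚᵘ-injective (begin
  ℚ.toℚᵘ (((ℤ.+ 1) / suc n) ℚ.* ((ℤ.+ suc n) / 1))
    ≈⟨ ℚ.toℚᵘ-homo-* ((ℤ.+ 1) / suc n) ((ℤ.+ suc n) / 1) ⟩
  ℚ.toℚᵘ ((ℤ.+ 1) / suc n) ℚᵘ.* ℚ.toℚᵘ ((ℤ.+ suc n) / 1)
    ≈⟨ ℚᵘ.*-cong (ℚ.toℚᵘ-fromℚᵘ (ℚᵘ.mkℚᵘ (ℤ.+ 1) n)) (ℚ.toℚᵘ-fromℚᵘ (ℚᵘ.mkℚᵘ (ℤ.+ suc n) 0)) ⟩
  ℚᵘ.mkℚᵘ (ℤ.+ 1) n ℚᵘ.* ℚᵘ.mkℚᵘ (ℤ.+ suc n) 0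
    ≈⟨ ℚᵘ.*≡* (≡.cong ℤ.+_ (≡.trans (ℕ.*-identityʳ _) (≡.cong suc (≡.trans (ℕ.+-identityʳ n) (≡.sym (≡.trans (ℕ.+-identityʳ _)
        (ℕ.*-identityʳ n))))))) ⟩
  ℚᵘ.1ℚᵘ ∎)
  where open ℚᵘ.≃-Reasoning

private variable X Y Z : Set

-- Divisibility by the Vandermonde product and Schur's P-functions

module PolySolver {X : Set} = IntegerCoefficients (polyRing X)
module PolyRing {X : Set} = CommutativeRing (polyRing X)

subst-cong : ∀ (σ : X → Poly Y) {f g} → f ≈ g → subst σ f ≈ subst σ g
subst-cong σ ≈-refl             = ≈-refl
subst-cong σ (≈-sym e)          = ≈-sym (subst-cong σ e)
subst-cong σ (≈-trans e h)      = ≈-trans (subst-cong σ e) (subst-cong σ h)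
subst-cong σ (⊕-cong e h)       = ⊕-cong (subst-cong σ e) (subst-cong σ h)
subst-cong σ (⊗-cong e h)       = ⊗-cong (subst-cong σ e) (subst-cong σ h)
subst-cong σ (⊕-assoc f g h)    = ⊕-assoc _ _ _
subst-cong σ (⊕-comm f g)       = ⊕-comm _ _
subst-cong σ (⊕-identityˡ f)    = ⊕-identityˡ _
subst-cong σ (⊗-assoc f g h)    = ⊗-assoc _ _ _
subst-cong σ (⊗-comm f g)       = ⊗-comm _ _
subst-cong σ (⊗-identityˡ f)    = ⊗-identityˡ _
subst-cong σ (⊗-zeroˡ f)        = ⊗-zeroˡ _
subst-cong σ (⊗-distribˡ f g h) = ⊗-distribˡ _ _ _
subst-cong σ (con-⊕ a b)        = con-⊕ a b
subst-cong σ (con-⊗ a b)        = con-⊗ a b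

subst-cong-var : ∀ {σ τ : X → Poly Y} → (∀ x → σ x ≈ τ x) → ∀ f → subst σ f ≈ subst τ f
subst-cong-var e (con c) = ≈-refl
subst-cong-var e (var x) = e x
subst-cong-var e (f ⊕ g) = ⊕-cong (subst-cong-var e f) (subst-cong-var e g)
subst-cong-var e (f ⊗ g) = ⊗-cong (subst-cong-var e f) (subst-cong-var e g)

subst-subst : ∀ (τ : Y → Poly Z) (σ : X → Poly Y) f → subst τ (subst σ f) ≡ subst (subst τ ∘ σ) f
subst-subst τ σ (con c) = ≡.refl
subst-subst τ σ (var x) = ≡.refl
subst-subst τ σ (f ⊕ g) = ≡.cong₂ _⊕_ (subst-subst τ σ f) (subst-subst τ σ g)
subst-subst τ σ (f ⊗ g) = ≡.cong₂ _⊗_ (subst-subst τ σ f) (subst-subst τ σ g)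

module _ {N : ℕ} (i j : Fin N) where
  open PolySolver {Fin N}
  open import Relation.Binary.Reasoning.Setoid (PolyRing.setoid {Fin N})

  -- Division is defined on expressions by a twisted Leibniz rule. The critical axiom is
  -- commutativity of the product, where the rule treats the factors unequally; writing each factor
  -- as remainder plus multiple of the difference restores the symmetry.
  quo-cong : ∀ {f g : Poly (Fin N)} → f ≈ g → quo i j f ≈ quo i j g
  quo-cong ≈-refl             = ≈-refl
  quo-cong (≈-sym e)          = ≈-sym (quo-cong e)
  quo-cong (≈-trans e h)      = ≈-trans (quo-cong e) (quo-cong h)
  quo-cong (⊕-cong e h)       = ⊕-cong (quo-cong e) (quo-cong h)
  quo-cong (⊗-cong e h)       = ⊕-cong (⊗-cong (quo-cong e) h) (⊗-cong (subst-cong _ e) (quo-cong h))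
  quo-cong (⊕-assoc f g h)    = ⊕-assoc _ _ _
  quo-cong (⊕-comm f g)       = ⊕-comm _ _
  quo-cong (⊕-identityˡ f)    = ⊕-identityˡ _
  quo-cong (⊗-assoc f g h)    = solve 7 (λ F f′ G g′ g H h →
    (F :* g :+ f′ :* G) :* h :+ (f′ :* g′) :* H := F :* (g :* h) :+ f′ :* (G :* h :+ g′ :* H)) ≈-refl
    (quo i j f) (f [ i ≔ j ]) (quo i j g) (g [ i ≔ j ]) g (quo i j h) h
  quo-cong (⊗-comm f g)       = begin
    F ⊗ g ⊕ f′ ⊗ G                    ≈⟨ ⊕-cong (⊗-cong ≈-refl (quo-correct i j g)) ≈-refl ⟩
    F ⊗ (g′ ⊕ d ⊗ G) ⊕ f′ ⊗ G         ≈⟨ solve 5 (λ F f′ G g′ d → F :* (g′ :+ d :* G) :+ f′ :* G := G :*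
        (f′ :+ d :* F) :+ g′ :* F) ≈-refl F f′ G g′ d ⟩
    G ⊗ (f′ ⊕ d ⊗ F) ⊕ g′ ⊗ F         ≈⟨ ⊕-cong (⊗-cong ≈-refl (quo-correct i j f)) ≈-refl ⟨
    G ⊗ f ⊕ g′ ⊗ F                    ∎
    where F = quo i j f ; G = quo i j g ; f′ = f [ i ≔ j ] ; g′ = g [ i ≔ j ] ; d = var i ⊖ var j
  quo-cong (⊗-identityˡ f)    = ≈-trans (⊕-cong (⊗-zeroˡ _) (⊗-identityˡ _)) (⊕-identityˡ _)
  quo-cong (⊗-zeroˡ f)        = ≈-trans (⊕-cong (⊗-zeroˡ _) (⊗-zeroˡ _)) (⊕-identityˡ _)
  quo-cong (⊗-distribˡ f g h) = solve 7 (λ F f′ g G h H x →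
    F :* (g :+ h) :+ f′ :* (G :+ H) := (F :* g :+ f′ :* G) :+ (F :* h :+ f′ :* H)) ≈-refl
    (quo i j f) (f [ i ≔ j ]) g (quo i j g) h (quo i j h) (con 0ℚ)
  quo-cong (con-⊕ a b)        = ≈-sym (⊕-identityˡ _)
  quo-cong (con-⊗ a b)        = ≈-sym (≈-trans (⊕-cong (⊗-zeroˡ _) (≈-trans (⊗-comm _ _) (⊗-zeroˡ _))) (⊕-identityˡ _))

  -- The difference has quotient 1 and remainder 0, so the Leibniz rule leaves `f`.
  quo-difference : i ≢ j → ∀ f → quo i j ((var i ⊖ var j) ⊗ f) ≈ f
  quo-difference i≢j f
    rewrite dec-true (i Fin.≟ i) ≡.refl | dec-false (j Fin.≟ i) (i≢j ∘ ≡.sym) =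
    solve 4 (λ v f q m → (:1 :+ (:0 :* v :+ m :* :0)) :* f :+ (v :+ (:- v)) :* q := f)
      ≈-refl (var j) f (quo i j f) (con (ℚ.- 1ℚ))

  -- Division has a left inverse property and respects equality, so a vanishing product can be
  -- divided.
  difference-regular : i ≢ j → Fractions.Regular (polyRing (Fin N)) (var i ⊖ var j)
  difference-regular i≢j f h = ≈-trans (≈-sym (quo-difference i≢j f)) (quo-cong h)

module _ {N : ℕ} where
  open Sums (polyRing (Fin N))
  open Fractions (polyRing (Fin N)) using (Regular; Regular-1; Regular-*)
  open import Relation.Binary.Reasoning.Setoid (PolyRing.setoid {Fin N})

  difference : Fin N × Fin N → Poly (Fin N)
  difference (i , j) = var i ⊖ var j

  -- Distinct as unordered pairs: identifying x_i with x_j then keeps x_a - x_b a difference of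
  -- distinct variables, hence regular.
  Independent : Fin N × Fin N → Fin N × Fin N → Set
  Independent (i , j) (a , b) = (a , b) ≢ (i , j) × (a , b) ≢ (j , i)

  private
    identify : Fin N → Fin N → Fin N → Fin N
    identify i j k = if does (k Fin.≟ i) then j else k

    identify-injective : ∀ {i j a b} → Independent (i , j) (a , b) → a ≢ b → identify i j a ≢ identify i j b
    identify-injective {i} {j} {a} {b} (p , q) a≢b with a Fin.≟ i | b Fin.≟ i
    ... | yes a≡i | yes b≡i = λ _ → a≢b (≡.trans a≡i (≡.sym b≡i))
    ... | yes a≡i | no  _   = λ j≡b → p (≡.cong₂ _,_ a≡i (≡.sym j≡b))
    ... | no  _   | yes b≡i = λ a≡j → q (≡.cong₂ _,_ a≡j b≡i)
    ... | no  _   | no  _   = a≢b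

    substitute-difference : ∀ i j ab → difference ab [ i ≔ j ] ≡ difference (identify i j (proj₁ ab) , identify i j (proj₂ ab))
    substitute-difference i j (a , b) with does (a Fin.≟ i) | does (b Fin.≟ i)
    ... | true  | true  = ≡.refl
    ... | true  | false = ≡.refl
    ... | false | true  = ≡.refl
    ... | false | false = ≡.refl

    product-regular : ∀ i j ps → All (λ ab → proj₁ ab ≢ proj₂ ab) ps → All (Independent (i , j)) ps →
                      Regular (ΠL ps difference [ i ≔ j ])
    product-regular i j []            _          _          = Regular-1
    product-regular i j ((a , b) ∷ ps) (a≢b ∷ ne) (ind ∷ inds) = Regular-*
      {difference (a , b) [ i ≔ j ]} {ΠL ps difference [ i ≔ j ]}
      (≡.subst Regular (≡.sym (substitute-difference i j (a , b))) (difference-regular _ _ (identify-injective ind a≢b)))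
      (product-regular i j ps ne inds)

  -- The next division is exact if the quotient g so far vanishes at x_i = x_j. There 0 = f = D g,
  -- and D stays regular because all its factors belong to other pairs.
  quo-product : ∀ f ps → All (λ ij → proj₁ ij ≢ proj₂ ij) ps → AllPairs Independent ps →
                All (λ ij → f [ proj₁ ij ≔ proj₂ ij ] ≈ con 0ℚ) ps →
                f ≈ ΠL ps difference ⊗ foldr (λ ij g → quo (proj₁ ij) (proj₂ ij) g) f ps
  quo-product f []             _          _            _          = ≈-sym (⊗-identityˡ f)
  quo-product f ((i , j) ∷ ps) (i≢j ∷ ne) (ind ∷ inds) (f≈0 ∷ zs) = begin
    f                                                ≈⟨ IH ⟩
    D ⊗ g                                            ≈⟨ ⊗-cong ≈-refl (quo-correct i j g) ⟩
    D ⊗ (g [ i ≔ j ] ⊕ difference (i , j) ⊗ quo i j g)  ≈⟨ ⊗-cong ≈-refl (≈-trans (⊕-cong g≈0 ≈-refl) (⊕-identityˡ _)) ⟩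
    D ⊗ (difference (i , j) ⊗ quo i j g)             ≈⟨ ≈-trans (≈-sym (⊗-assoc _ _ _)) (⊗-cong (⊗-comm _ _) ≈-refl) ⟩
    (difference (i , j) ⊗ D) ⊗ quo i j g             ∎
    where
    D = ΠL ps difference
    g = foldr (λ ij g → quo (proj₁ ij) (proj₂ ij) g) f ps
    IH : f ≈ D ⊗ g
    IH = quo-product f ps ne inds zs
    g≈0 : g [ i ≔ j ] ≈ con 0ℚ
    g≈0 = product-regular i j ps ne ind (g [ i ≔ j ]) (≈-trans (≈-sym (subst-cong _ IH)) f≈0)

  pairs-< : All (λ ij → proj₁ ij Fin.< proj₂ ij) (pairs N)
  pairs-< = All.all-filter (λ ij → proj₁ ij Fin.<? proj₂ ij) (cartesianProduct (allFin N) (allFin N))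

  pairs-independent : AllPairs Independent (pairs N)
  pairs-independent = go (pairs N) pairs-< (Unique.filter⁺ _ (Unique.cartesianProduct⁺ (Unique.allFin⁺ N) (Unique.allFin⁺ N)))
    where
    go : ∀ ps → All (λ ij → proj₁ ij Fin.< proj₂ ij) ps → Unique ps → AllPairs Independent ps
    go []             _           _         = []
    go ((i , j) ∷ ps) (i<j ∷ lts) (ne ∷ us) = All.zipWith
      (λ { {a , b} (a<b , ne) → (ne ∘ ≡.sym) , λ e → Fin.<-asym i<j (≡.subst₂ Fin._<_ (≡.cong proj₁ e) (≡.cong proj₂ e) a<b) })
      (lts , ne) ∷ go ps lts us

  divideByΔ-correct : ∀ f → (∀ i j → i ≢ j → f [ i ≔ j ] ≈ con 0ℚ) → f ≈ ΠL (pairs N) difference ⊗ divideByΔ f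
  divideByΔ-correct f z = quo-product f (pairs N) (All.map Fin.<⇒≢ pairs-<) pairs-independent
    (All.map (λ i<j → z _ _ (Fin.<⇒≢ i<j)) pairs-<)

punchIn-<? : ∀ {n} (i : Fin (suc n)) j k → does (punchIn i j Fin.<? punchIn i k) ≡ does (j Fin.<? k)
punchIn-<? zero    j       k       = ≡.refl
punchIn-<? (suc i) zero    zero    = ≡.refl
punchIn-<? (suc i) zero    (suc k) = ≡.refl
punchIn-<? (suc i) (suc j) zero    = ≡.refl
punchIn-<? (suc i) (suc j) (suc k) = punchIn-<? i j k

punchIn-mono-< : ∀ {n} (i : Fin (suc n)) {j k} → j Fin.< k → punchIn i j Fin.< punchIn i k
punchIn-mono-< zero    h                           = ℕ.s≤s h
punchIn-mono-< (suc i) {zero}  {suc k} h           = ℕ.z<s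
punchIn-mono-< (suc i) {suc j} {suc k} (ℕ.s≤s h)   = ℕ.s≤s (punchIn-mono-< i h)

punchIn-cancel-< : ∀ {n} (i : Fin (suc n)) {j k} → punchIn i j Fin.< punchIn i k → j Fin.< k
punchIn-cancel-< zero    (ℕ.s≤s h)                 = h
punchIn-cancel-< (suc i) {zero}  {suc k} h         = ℕ.z<s
punchIn-cancel-< (suc i) {suc j} {suc k} (ℕ.s≤s h) = ℕ.s≤s (punchIn-cancel-< i h)

^^≡^ : ∀ (f : Poly X) n → f ^^ n ≡ Sums._^_ (polyRing X) f n
^^≡^ f zero    = ≡.refl
^^≡^ f (suc n) = ≡.cong (f ⊗_) (^^≡^ f n)

CosetRep : ∀ {N} → (Fin N → ℕ) → Permutation′ N → Set
CosetRep λs w = ∀ i j → i Fin.< j → λs i ≡ λs j → w ⟨$⟩ʳ i Fin.< w ⟨$⟩ʳ j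

¬CosetRep-insert : ∀ {n} (i : Fin n) (w : Permutation′ n) → ¬ CosetRep (λ _ → 0) (Perm.insert zero (suc i) w)
¬CosetRep-insert {suc n} i w C = ℕ.n≮0 (≡.subst (λ z → suc i Fin.< punchIn (suc i) z) (Perm.inverseʳ w {zero})
  (C zero (suc (w ⟨$⟩ˡ zero)) ℕ.z<s ≡.refl))

StrictPartition : List ℕ → Set
StrictPartition μ = AllPairs ℕ._>_ μ × All (ℕ._> 0) μ

part-< : ∀ {l μ} → 0 ℕ.< l → All (ℕ._< l) μ → ∀ k → part μ k ℕ.< l
part-< 0<l []        k       = 0<l
part-< 0<l (h ∷ hs)  zero    = h
part-< 0<l (h ∷ hs)  (suc k) = part-< 0<l hs k

module Numerator {X : Set} where
  open CommutativeRing (polyRing X) hiding (zero; _≈_)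
  open Sums (polyRing X)
  open FiniteSums (polyRing X)
  open Alternants (polyRing X)
  open IntegerCoefficients (polyRing X)
  open import Relation.Binary.Reasoning.Setoid setoid

  parts : List ℕ → ∀ {N} → Fin N → ℕ
  parts μ i = part μ (toℕ i)

  -- The values `v` replace the variables so that the induction can pass to `v ∘ punchIn i`, the
  -- family with one value removed.
  factor : ∀ {N} → (Fin N → Poly X) → (Fin N → ℕ) → Permutation′ N → Fin N × Fin N → Poly X
  factor v λs w (i , j) = if does (λs j ℕ.<? λs i)
    then v (w ⟨$⟩ʳ i) ⊖ con (ℚ.- 1ℚ) ⊗ v (w ⟨$⟩ʳ j)
    else v (w ⟨$⟩ʳ i) ⊖ v (w ⟨$⟩ʳ j)

  term : ∀ {N} → (Fin N → Poly X) → (Fin N → ℕ) → Permutation′ N → Poly X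
  term {N} v λs w = con (sign w) ⊗ ΠL (allFin N) (λ i → v (w ⟨$⟩ʳ i) ^^ λs i) ⊗ ΠL (pairs N) (factor v λs w)

  numerator : ∀ {N} → (Fin N → Poly X) → List ℕ → Poly X
  numerator {N} v μ = ΣL (filter (cosetRep? (parts μ)) (permutations N)) (term v (parts μ))

  inversion : ∀ {N} → Permutation′ N → Fin N × Fin N → Poly X
  inversion w (i , j) = if does ((w ⟨$⟩ʳ j) Fin.<? (w ⟨$⟩ʳ i)) then - 1# else 1#

  con-neg : ∀ s → con (ℚ.- s) ≈ - con s
  con-neg s = ≈-trans (reflexive (≡.cong con (≡.trans (≡.cong ℚ.-_ (≡.sym (ℚ.*-identityˡ s))) (ℚ.neg-distribˡ-* 1ℚ s))))
      (con-⊗ _ _)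

  con-sign : ∀ {N} (w : Permutation′ N) → con (sign w) ≈ ΠL (pairs N) (inversion w)
  con-sign {N} w = go (pairs N)
    where
    go : ∀ ps → con (foldr (λ ij s → if does ((w ⟨$⟩ʳ proj₂ ij) Fin.<? (w ⟨$⟩ʳ proj₁ ij)) then ℚ.- s else s) 1ℚ ps) ≈ ΠL ps
        (inversion w)
    go []        = ≈-refl
    go (ij ∷ ps) with does ((w ⟨$⟩ʳ proj₂ ij) Fin.<? (w ⟨$⟩ʳ proj₁ ij))
    ... | true  = ≈-trans (con-neg _) (≈-trans (-‿cong (go ps)) (solve 1 (λ x → :- x := (:- :1) :* x) ≈-refl _))
    ... | false = ≈-trans (go ps) (≈-sym (⊗-identityˡ _))

  term-insert : ∀ {n} (v : Fin (suc n) → Poly X) λs i w (h : Poly X → Poly X → Poly X) →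
    (∀ j a b → (if does (λs (suc j) ℕ.<? λs zero) then a ⊖ con (ℚ.- 1ℚ) ⊗ b else a ⊖ b) ≈ h a b) →
    term v λs (Perm.insert zero i w) ≈
    position-sign i ⊗ (v i ^ λs zero ⊗ ΠL (allFin n) (λ j → h (v i) (v (punchIn i j))) ⊗ term (v ∘ punchIn i) (λs ∘ suc) w)
  term-insert {n} v λs i w h e = begin
    con (sign w′) ⊗ ΠL (allFin (suc n)) (λ j → v (w′ ⟨$⟩ʳ j) ^^ λs j) ⊗ ΠL (pairs (suc n)) (factor v λs w′)
      ≈⟨ ⊗-cong (⊗-cong signs powers) factors ⟩
    (position-sign i ⊗ S) ⊗ (v i ^ λs zero ⊗ P) ⊗ (L ⊗ F)
      ≈⟨ solve 6 (λ s S p P L F → (s :* S) :* (p :* P) :* (L :* F) := s :* (p :* L :* (S :* P :* F))) ≈-refl (position-sign i) S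
          (v i ^ λs zero) P L F ⟩
    position-sign i ⊗ (v i ^ λs zero ⊗ L ⊗ (S ⊗ P ⊗ F)) ∎
    where
    w′ = Perm.insert zero i w
    S = con (sign w)
    P = ΠL (allFin n) (λ j → v (punchIn i (w ⟨$⟩ʳ j)) ^^ λs (suc j))
    L = ΠL (allFin n) (λ j → h (v i) (v (punchIn i j)))
    F = ΠL (pairs n) (factor (v ∘ punchIn i) (λs ∘ suc) w)
    signs : con (sign w′) ≈ position-sign i ⊗ S
    signs = ≈-trans (con-sign w′) (≈-trans (ΠL-pairs-suc (inversion w′))
      (⊗-cong (ΠL-permute w (λ j → if does (punchIn i j Fin.<? i) then - 1# else 1#))
        (≈-trans (ΠL-cong (pairs n) λ { (a , b) → reflexive (≡.cong (λ z → if z then - 1# else 1#) (punchIn-<? i (w ⟨$⟩ʳ b)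
            (w ⟨$⟩ʳ a))) })
          (≈-sym (con-sign w)))))
    powers : ΠL (allFin (suc n)) (λ j → v (w′ ⟨$⟩ʳ j) ^^ λs j) ≈ v i ^ λs zero ⊗ P
    powers = ≈-trans (reflexive (ΠFin-suc (λ j → v (w′ ⟨$⟩ʳ j) ^^ λs j))) (⊗-cong (reflexive (^^≡^ (v i) (λs zero))) ≈-refl)
    factors : ΠL (pairs (suc n)) (factor v λs w′) ≈ L ⊗ F
    factors = ≈-trans (ΠL-pairs-suc (factor v λs w′)) (⊗-cong
      (≈-trans (ΠL-cong (allFin n) λ j → e j (v i) (v (punchIn i (w ⟨$⟩ʳ j)))) (ΠL-permute w (λ j → h (v i) (v (punchIn i j)))))
      ≈-refl)

  vandermonde-tabulate : ∀ {N} (v : Fin N → Poly X) → ΠL (pairs N) (λ ij → v (proj₁ ij) ⊖ v (proj₂ ij)) ≈ vandermonde (tabulate v)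
  vandermonde-tabulate {zero}  v = ≈-refl
  vandermonde-tabulate {suc n} v = ≈-trans (ΠL-pairs-suc {n} (λ ij → v (proj₁ ij) ⊖ v (proj₂ ij))) (⊗-cong
    (reflexive (≡.trans (≡.sym (ΠL-map (v ∘ suc) (allFin n) (λ y → v zero ⊖ y))) (≡.cong (λ as → ΠL as (λ y → v zero ⊖ y))
        (List.map-tabulate id (v ∘ suc)))))
    (vandermonde-tabulate (v ∘ suc)))

  ΠL-tabulate : ∀ {n} (v : Fin n → Poly X) f → ΠL (allFin n) (f ∘ v) ≡ ΠL (tabulate v) f
  ΠL-tabulate {n} v f = ≡.trans (≡.sym (ΠL-map v (allFin n) f)) (≡.cong (λ as → ΠL as f) (List.map-tabulate id v))

  numerator-suc : ∀ {n} (v : Fin (suc n) → Poly X) μ → numerator v μ ≈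
    ΣL (allFin (suc n)) (λ i → ΣL (permutations n) (λ w →
      if does (cosetRep? (parts μ) (Perm.insert zero i w)) then term v (parts μ) (Perm.insert zero i w) else 0#))
  numerator-suc {n} v μ = ≈-trans (ΣL-filter (cosetRep? (parts μ)) (permutations (suc n)) (term v (parts μ)))
      (ΣL-permutations-suc {n}
    (λ w → if does (cosetRep? (parts μ) w) then term v (parts μ) w else 0#))

  if-⊗ : ∀ (b : Bool) (c f : Poly X) → (if b then c ⊗ f else 0#) ≈ c ⊗ (if b then f else 0#)
  if-⊗ true  c f = ≈-refl
  if-⊗ false c f = ≈-sym (zeroʳ c)

  -- A first part larger than all others leaves the image of the first row unrestricted, which gives
  -- the Laplace expansion. When the parts are used up, the coset condition forces w to be
  -- increasing, hence the identity, and its term is the Vandermonde product.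
  numerator≈alternant : ∀ {N} (v : Fin N → Poly X) μ → StrictPartition μ → length μ ℕ.≤ N → numerator v μ ≈ alternant μ
      (tabulate v)
  numerator≈alternant {zero} v [] _ _ = solve 0 (:1 :* :1 :* :1 :+ :0 := :1) ≈-refl
  numerator≈alternant {suc n} v [] st _ = begin
    numerator v []
      ≈⟨ numerator-suc v [] ⟩
    ΣL (allFin (suc n)) (λ i → ΣL (permutations n) (λ w → cases i w))
      ≡⟨ ΣFin-suc (λ i → ΣL (permutations n) (cases i)) ⟩
    ΣL (permutations n) (cases zero) ⊕ ΣL (allFin n) (λ i → ΣL (permutations n) (cases (suc i)))
      ≈⟨ ⊕-cong (ΣL-cong (permutations n) first) (≈-trans (ΣL-cong (allFin n) λ i → ≈-trans (ΣL-cong (permutations n) (others i))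
          (ΣL-0 (permutations n))) (ΣL-0 (allFin n))) ⟩
    ΣL (permutations n) (λ w → L ⊗ (if does (cosetRep? (parts []) w) then term (v ∘ suc) (parts []) w else 0#)) ⊕ 0#
      ≈⟨ ≈-trans (+-identityʳ _) (≈-sym (ΣL-*ˡ L (permutations n) _)) ⟩
    L ⊗ ΣL (permutations n) (λ w → if does (cosetRep? (parts []) w) then term (v ∘ suc) (parts []) w else 0#)
      ≈⟨ ⊗-cong (reflexive (ΠL-tabulate (v ∘ suc) (λ y → v zero ⊖ y)))
           (≈-trans (≈-sym (ΣL-filter (cosetRep? (parts [])) (permutations n) _)) (numerator≈alternant (v ∘ suc) [] st ℕ.z≤n)) ⟩
    vandermonde (tabulate v) ∎
    where
    L = ΠL (allFin n) (λ j → v zero ⊖ v (suc j))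
    cases : Fin (suc n) → Permutation′ n → Poly X
    cases i w = if does (cosetRep? (parts []) (Perm.insert zero i w)) then term v (parts []) (Perm.insert zero i w) else 0#
    others : ∀ i w → cases (suc i) w ≈ 0#
    others i w = reflexive (≡.cong (λ b → if b then term v (parts []) (Perm.insert zero (suc i) w) else 0#)
      (dec-false (cosetRep? (parts []) (Perm.insert zero (suc i) w)) (¬CosetRep-insert i w)))
    first : ∀ w → cases zero w ≈ L ⊗ (if does (cosetRep? (parts []) w) then term (v ∘ suc) (parts []) w else 0#)
    first w = ≈-trans (reflexive (≡.cong (λ b → if b then term v (parts []) (Perm.insert zero zero w) else 0#)
        (does-⇔ (mk⇔ (λ C i j i<j e → ℕ.≤-pred (C (suc i) (suc j) (ℕ.s≤s i<j) e))
          (λ { C zero (suc j) _ _ → ℕ.z<s ; C (suc i) (suc j) (ℕ.s≤s i<j) e → ℕ.s≤s (C i j i<j e) }))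
          (cosetRep? (parts []) (Perm.insert zero zero w)) (cosetRep? (parts []) w))))
      (≈-trans (if-cong (does (cosetRep? (parts []) w)) (≈-trans (term-insert v (parts []) zero w (λ a b → a ⊖ b)
          (λ _ _ _ → ≈-refl))
        (≈-trans (⊗-cong (ΠL-1 (allFin n)) ≈-refl) (solve 2 (λ L t → :1 :* (:1 :* L :* t) := L :* t) ≈-refl L _))))
        (if-⊗ (does (cosetRep? (parts []) w)) L _))
      where
      if-cong : ∀ b {f g} → f ≈ g → (if b then f else 0#) ≈ (if b then g else 0#)
      if-cong true  e = e
      if-cong false e = ≈-refl
  numerator≈alternant {suc n} v (l ∷ μ) ((l>μ ∷ st) , (l>0 ∷ pos)) (ℕ.s≤s μ≤n) = begin
    numerator v (l ∷ μ)
      ≈⟨ numerator-suc v (l ∷ μ) ⟩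
    ΣL (allFin (suc n)) (λ i → ΣL (permutations n) (λ w →
      if does (cosetRep? (parts (l ∷ μ)) (Perm.insert zero i w)) then term v (parts (l ∷ μ)) (Perm.insert zero i w) else 0#))
      ≈⟨ ΣL-cong (allFin (suc n)) (λ i → ≈-trans (ΣL-cong (permutations n) (each i)) (≈-trans (≈-sym (ΣL-*ˡ (c i)
          (permutations n) _))
           (⊗-cong ≈-refl (≈-trans (≈-sym (ΣL-filter (cosetRep? (parts μ)) (permutations n) _)) (numerator≈alternant
               (v ∘ punchIn i) μ (st , pos) μ≤n))))) ⟩
    ΣL (allFin (suc n)) (λ i → c i ⊗ alternant μ (tabulate (v ∘ punchIn i)))
      ≈⟨ ΣL-cong (allFin (suc n)) (λ i → ≈-trans (⊗-assoc _ _ _) (⊗-cong ≈-refl (⊗-cong (⊗-cong ≈-refl (reflexive (ΠL-tabulate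
          (v ∘ punchIn i) (λ y → v i ⊕ y)))) ≈-refl))) ⟩
    ΣL (allFin (suc n)) (λ i → position-sign i ⊗ (v i ^ l ⊗ ΠL (tabulate (v ∘ punchIn i)) (λ y → v i ⊕ y) ⊗ alternant μ (tabulate
        (v ∘ punchIn i))))
      ≈⟨ altS-tabulate v (λ x ys → x ^ l ⊗ ΠL ys (λ y → x ⊕ y) ⊗ alternant μ ys) ⟨
    alternant (l ∷ μ) (tabulate v) ∎
    where
    c : Fin (suc n) → Poly X
    c i = position-sign i ⊗ (v i ^ l ⊗ ΠL (allFin n) (λ j → v i ⊕ v (punchIn i j)))
    plus : ∀ j a b → (if does (part μ (toℕ {n} j) ℕ.<? l) then a ⊖ con (ℚ.- 1ℚ) ⊗ b else a ⊖ b) ≈ a ⊕ b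
    plus j a b rewrite dec-true (part μ (toℕ j) ℕ.<? l) (part-< l>0 l>μ (toℕ j)) = ⊕-cong ≈-refl
      (≈-trans (≈-sym (⊗-assoc _ _ _)) (≈-trans (⊗-cong (≈-sym (con-⊗ (ℚ.- 1ℚ) (ℚ.- 1ℚ))) ≈-refl) (⊗-identityˡ b)))
    each : ∀ i w → (if does (cosetRep? (parts (l ∷ μ)) (Perm.insert zero i w)) then term v (parts (l ∷ μ))
        (Perm.insert zero i w) else 0#) ≈
      c i ⊗ (if does (cosetRep? (parts μ) w) then term (v ∘ punchIn i) (parts μ) w else 0#)
    each i w = ≈-trans (reflexive (≡.cong (λ b → if b then term v (parts (l ∷ μ)) (Perm.insert zero i w) else 0#)
        (does-⇔ (mk⇔ to from) (cosetRep? (parts (l ∷ μ)) (Perm.insert zero i w)) (cosetRep? (parts μ) w))))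
      (≈-trans (if-cong (does (cosetRep? (parts μ) w)) (≈-trans (term-insert v (parts (l ∷ μ)) i w _⊕_ plus) (≈-sym
          (⊗-assoc³ _ _ _))))
        (if-⊗ (does (cosetRep? (parts μ) w)) (c i) _))
      where
      ⊗-assoc³ : ∀ (a b d : Poly X) → (a ⊗ b) ⊗ d ≈ a ⊗ (b ⊗ d)
      ⊗-assoc³ = ⊗-assoc
      if-cong : ∀ b {f g} → f ≈ g → (if b then f else 0#) ≈ (if b then g else 0#)
      if-cong true  e = e
      if-cong false e = ≈-refl
      to : CosetRep (parts (l ∷ μ)) (Perm.insert zero i w) → CosetRep (parts μ) w
      to C a b a<b e = punchIn-cancel-< i (C (suc a) (suc b) (ℕ.s≤s a<b) e)
      from : CosetRep (parts μ) w → CosetRep (parts (l ∷ μ)) (Perm.insert zero i w)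
      from C zero    (suc b) _             e = contradiction e (ℕ.>⇒≢ (part-< l>0 l>μ (toℕ b)))
      from C (suc a) (suc b) (ℕ.s≤s a<b) e = punchIn-mono-< i (C a b a<b e)

substitution : ∀ {X Y : Set} → (X → Poly Y) → Homomorphism (polyRing X) (polyRing Y)
substitution σ = record
  { φ = subst σ ; φ-cong = subst-cong σ ; φ-+ = λ _ _ → ≈-refl ; φ-* = λ _ _ → ≈-refl
  ; φ-neg = λ _ → ≈-refl ; φ-0 = ≈-refl ; φ-1 = ≈-refl }

½+½≈1 : ∀ {X : Set} → con ½ ⊕ con ½ ≈ con {X} 1ℚ
½+½≈1 = ≈-sym (con-⊕ ½ ½)

module _ {N : ℕ} where
  open Alternants (polyRing (Fin N))
  open PolyRing {Fin N} using (reflexive)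

  alternant-vanishes : ∀ μ i j → i ≢ j → alternant μ (tabulate var) [ i ≔ j ] ≈ con 0ℚ
  alternant-vanishes μ i j i≢j = ≈-trans (RingMap.φ-alternant (substitution σ) μ (tabulate var))
    (≈-trans (reflexive (≡.cong (alternant μ) (List.map-tabulate var (subst σ)))) zeros)
    where
    σ : Fin N → Poly (Fin N)
    σ k = if does (k Fin.≟ i) then var j else var k
    σi≡σj : σ i ≡ σ j
    σi≡σj rewrite dec-true (i Fin.≟ i) ≡.refl | dec-false (j Fin.≟ i) (i≢j ∘ ≡.sym) = ≡.refl
    zeros : alternant μ (tabulate σ) ≈ con 0ℚ
    zeros with Fin.<-cmp i j
    ... | tri< i<j _ _ = alternant-tabulate-repeated (polyRing (Fin N)) (con ½) ½+½≈1 μ [] σ i j i<j σi≡σj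
    ... | tri≈ _ i≡j _ = contradiction i≡j i≢j
    ... | tri> _ _ j<i = alternant-tabulate-repeated (polyRing (Fin N)) (con ½) ½+½≈1 μ [] σ j i j<i (≡.sym σi≡σj)

  -- The alternant vanishes when two variables are identified, so every division by a difference is
  -- exact and Δ can be multiplied back.
  schurP-alternant : ∀ μ → StrictPartition μ → length μ ℕ.≤ N →
                     alternant μ (tabulate var) ≈ vandermonde (tabulate var) ⊗ schurP μ N
  schurP-alternant μ st μ≤N rewrite dec-true (length μ ℕ.≤? N) μ≤N = begin
    alternant μ (tabulate var)                                     ≈⟨ numerator≈alternant var μ st μ≤N ⟨
    hlNumerator (ℚ.- 1ℚ) μ N                                       ≈⟨ divideByΔ-correct _ (λ i j i≢j → ≈-trans (subst-cong _
        (numerator≈alternant var μ st μ≤N)) (alternant-vanishes μ i j i≢j)) ⟩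
    ΠL (pairs N) difference ⊗ divideByΔ (hlNumerator (ℚ.- 1ℚ) μ N) ≈⟨ ⊗-cong (vandermonde-tabulate var) ≈-refl ⟩
    vandermonde (tabulate var) ⊗ divideByΔ (hlNumerator (ℚ.- 1ℚ) μ N) ∎
    where
    open Numerator {Fin N}
    open Sums (polyRing (Fin N))
    open import Relation.Binary.Reasoning.Setoid (PolyRing.setoid {Fin N})

schurP-zero : ∀ {N} μ → ¬ (length μ ℕ.≤ N) → schurP μ N ≡ con 0ℚ
schurP-zero {N} μ μ≰N rewrite dec-false (length μ ℕ.≤? N) μ≰N = ≡.refl

boundedStrict-strict : ∀ m n → All (λ μ → StrictPartition μ × All (ℕ._< suc m) μ) (boundedStrict m n)
boundedStrict-strict zero    zero    = (([] , []) , []) ∷ []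
boundedStrict-strict zero    (suc n) = []
boundedStrict-strict (suc m) n = All.++⁺ (with-part (does (suc m ℕ.≤? n)))
  (All.map (λ { (st , bs) → st , All.map ℕ.m≤n⇒m≤1+n bs }) (boundedStrict-strict m n))
  where
  with-part : ∀ b → All (λ μ → StrictPartition μ × All (ℕ._< suc (suc m)) μ)
                    (if b then map (suc m ∷_) (boundedStrict m (n ℕ.∸ suc m)) else [])
  with-part false = []
  with-part true  = All.map⁺ (All.map (λ { ((st , pos) , bs) → (bs ∷ st , ℕ.z<s ∷ pos) , ℕ.≤-refl ∷ All.map ℕ.m≤n⇒m≤1+n bs })
    (boundedStrict-strict m (n ℕ.∸ suc m)))

strictPartitions-strict : ∀ n → All StrictPartition (strictPartitions n)
strictPartitions-strict n = All.map proj₁ (boundedStrict-strict n n)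

module SchurPValue {F : CommutativeRing 0ℓ 0ℓ} {N : ℕ} (h : Homomorphism (polyRing (Fin N)) F)
  (differences : InvertibleDifferences F (λ a → Homomorphism.φ h (var a))) where

  open RingMap h
  open DifferenceRatios F differences using (ratio)
  private
    module F = CommutativeRing F
    module A = Alternants F
    x : Fin N → F.Carrier
    x a = φ (var a)
  open RowRemoval F x ratio

  -- Both sides become the alternant after multiplication by the Vandermonde product, which is
  -- regular since the differences are units. If μ has more parts than variables, both sides are
  -- zero.
  schurP-rowSum : ∀ μ → StrictPartition μ → φ (schurP μ N) F.≈ rowSum μ (allFin N)
  schurP-rowSum μ st with length μ ℕ.≤? N
  ... | yes μ≤N = Fractions.Regular-cancel F (VandermondeUnit.vandermonde-regular F differences (allFin N) (Unique.allFin⁺ N))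
      (begin
    A.vandermonde xs F.* φ (schurP μ N)
      ≈⟨ F.*-congʳ (F.reflexive (≡.cong A.vandermonde (≡.sym map-φ))) ⟩
    A.vandermonde (map φ (tabulate var)) F.* φ (schurP μ N)
      ≈⟨ F.*-congʳ (φ-vandermonde (tabulate var)) ⟨
    φ (Alternants.vandermonde (polyRing (Fin N)) (tabulate var)) F.* φ (schurP μ N)
      ≈⟨ φ-* _ _ ⟨
    φ (Alternants.vandermonde (polyRing (Fin N)) (tabulate var) ⊗ schurP μ N)
      ≈⟨ φ-cong (schurP-alternant μ st μ≤N) ⟨
    φ (Alternants.alternant (polyRing (Fin N)) μ (tabulate var))
      ≈⟨ φ-alternant μ (tabulate var) ⟩
    A.alternant μ (map φ (tabulate var))
      ≈⟨ F.reflexive (≡.cong (A.alternant μ) map-φ) ⟩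
    A.alternant μ xs
      ≈⟨ A.alternant-rowSum differences μ (allFin N) (Unique.allFin⁺ N) ⟩
    A.vandermonde xs F.* rowSum μ (allFin N) ∎)
    where
    open import Relation.Binary.Reasoning.Setoid F.setoid
    xs : List F.Carrier
    xs = map x (allFin N)
    map-φ : map φ (tabulate var) ≡ xs
    map-φ = ≡.trans (List.map-tabulate var φ) (≡.sym (List.map-tabulate id x))
  ... | no  μ≰N = F.trans (F.trans (φ-cong (PolyRing.reflexive (schurP-zero μ μ≰N))) φ-0) (F.sym (rowSum-vanishes μ (allFin N)
    (≡.subst (ℕ._< length μ) (≡.sym (List.length-tabulate id)) (ℕ.≰⇒> μ≰N))))

-- The Cauchy identity pulled back to polynomials

con-fromℕ : ∀ {X : Set} n → con {X} ((ℤ.+ n) / 1) ≈ Sums.fromℕ (polyRing X) n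
con-fromℕ zero    = ≈-refl
con-fromℕ (suc n) = ≈-trans (PolyRing.reflexive (≡.cong con (/1-suc n))) (≈-trans (con-⊕ _ _) (⊕-cong ≈-refl (con-fromℕ n)))

-- The number 2^l/l!.
exponentialCoefficient : ℕ → ℚ
exponentialCoefficient zero    = 1ℚ
exponentialCoefficient (suc l) = (exponentialCoefficient l ℚ.+ exponentialCoefficient l) ℚ.* ((ℤ.+ 1) / suc l)

exponentialCoefficient-suc : ∀ l →
  exponentialCoefficient (suc l) ℚ.* ((ℤ.+ suc l) / 1) ≡ exponentialCoefficient l ℚ.+ exponentialCoefficient l
exponentialCoefficient-suc l = ≡.trans (ℚ.*-assoc double ((ℤ.+ 1) / suc l) ((ℤ.+ suc l) / 1))
  (≡.trans (≡.cong (double ℚ.*_) (/-inverse (suc l))) (ℚ.*-identityʳ double))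
  where
  double : ℚ
  double = exponentialCoefficient l ℚ.+ exponentialCoefficient l

module PolynomialCauchy (N M : ℕ) {F : CommutativeRing 0ℓ 0ℓ} (ι : Homomorphism (polyRing (Fin (N ℕ.+ M))) F)
  (ι-injective : ∀ {f g} → CommutativeRing._≈_ F (Homomorphism.φ ι f) (Homomorphism.φ ι g) → f ≈ g)
  (differences : InvertibleDifferences F (λ v → Homomorphism.φ ι (var v))) where

  open RingMap ι
  open CycleSumMap ι
  private
    R₀ = polyRing (Fin (N ℕ.+ M))
    module F = CommutativeRing F
    module ΣF = Sums F

  x₀ : Fin N → Fin (N ℕ.+ M)
  x₀ a = a ↑ˡ M
  y₀ : Fin M → Fin (N ℕ.+ M)
  y₀ b = N ↑ʳ b

  private
    coefficient : ℕ → F.Carrier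
    coefficient l = φ (con (exponentialCoefficient l))

    coefficient-suc : ∀ l → coefficient (suc l) F.* Sums.fromℕ F (suc l) F.≈ coefficient l F.+ coefficient l
    coefficient-suc l = begin
      coefficient (suc l) F.* Sums.fromℕ F (suc l)
        ≈⟨ F.*-congˡ (φ-fromℕ (suc l)) ⟨
      coefficient (suc l) F.* φ (Sums.fromℕ R₀ (suc l))
        ≈⟨ φ-* (con (exponentialCoefficient (suc l))) (Sums.fromℕ R₀ (suc l)) ⟨
      φ (con (exponentialCoefficient (suc l)) ⊗ Sums.fromℕ R₀ (suc l))
        ≈⟨ φ-cong (≈-trans (⊗-cong ≈-refl (≈-sym (con-fromℕ (suc l)))) (≈-trans (≈-sym (con-⊗ _ _))
             (≈-trans (PolyRing.reflexive (≡.cong con (exponentialCoefficient-suc l))) (con-⊕ _ _)))) ⟩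
      φ (con (exponentialCoefficient l) ⊕ con (exponentialCoefficient l))
        ≈⟨ φ-+ (con (exponentialCoefficient l)) (con (exponentialCoefficient l)) ⟩
      coefficient l F.+ coefficient l ∎
      where open import Relation.Binary.Reasoning.Setoid F.setoid

    x : Fin N → F.Carrier
    x a = φ (var (x₀ a))
    y : Fin M → F.Carrier
    y b = φ (var (y₀ b))

    pullback : ∀ {A : Set} (e : A → Fin (N ℕ.+ M)) → (∀ {a b} → e a ≡ e b → a ≡ b) → InvertibleDifferences F (λ a → φ (var (e a)))
    pullback e e-injective = record
      { inverse      = λ a b → inverse (e a) (e b)
      ; inverse-anti = λ a b → inverse-anti (e a) (e b)
      ; *-inverse    = λ ne → *-inverse (ne ∘ e-injective) }
      where open InvertibleDifferences differences

    x-differences : InvertibleDifferences F x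
    x-differences = pullback x₀ (λ {a} {b} → Fin.↑ˡ-injective M a b)
    y-differences : InvertibleDifferences F y
    y-differences = pullback y₀ (λ {a} {b} → Fin.↑ʳ-injective N a b)

    ½+½ : φ (con ½) F.+ φ (con ½) F.≈ F.1#
    ½+½ = F.trans (F.sym (φ-+ (con ½) (con ½))) (F.trans (φ-cong ½+½≈1) φ-1)

    module Cauchy = CauchyIdentity F x-differences y-differences

  embedX : Poly (Fin N) → Poly (Fin (N ℕ.+ M))
  embedX = subst (var ∘ x₀)
  embedY : Poly (Fin M) → Poly (Fin (N ℕ.+ M))
  embedY = subst (var ∘ y₀)

  -- The n-th power sum of all products x_a y_b, after shiftification.
  powerSums : ℕ → Poly (Fin (N ℕ.+ M))
  powerSums n = LogarithmicDerivative.oddTwo R₀ n ⊗ Sums.ΣL R₀ (allFin M) (λ b → Sums.ΣL R₀ (allFin N) (λ a →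
    Sums._^_ R₀ (var (x₀ a) ⊗ var (y₀ b)) n))

  schurExpansion : ℕ → Poly (Fin (N ℕ.+ M))
  schurExpansion n = Sums.ΣL R₀ (strictPartitions n) (λ μ →
    Sums._^_ R₀ (con 1ℚ ⊕ con 1ℚ) (length μ) ⊗ (embedX (schurP μ N) ⊗ embedY (schurP μ M)))

  private
    composite : ∀ {X : Set} (e : X → Fin (N ℕ.+ M)) → Homomorphism (polyRing X) F
    composite e = record
      { φ = φ ∘ subst (var ∘ e) ; φ-cong = λ h → φ-cong (subst-cong _ h)
      ; φ-+ = λ _ _ → φ-+ _ _ ; φ-* = λ _ _ → φ-* _ _ ; φ-neg = λ _ → φ-neg _ ; φ-0 = φ-0 ; φ-1 = φ-1 }
    module XValue = SchurPValue (composite x₀) x-differences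
    module YValue = SchurPValue (composite y₀) y-differences
    module K = KernelCoefficients F (λ a b → x a F.* y b)

  -- The kernel coefficient, times n!, is a cycle sum of power sums. In this form both sides are
  -- polynomials, so the identity over fractions descends by injectivity.
  polynomialCauchy : ∀ n → CycleSums.cycleSum R₀ powerSums n (CycleSums.ones R₀ n) ≈ Sums.fromℕ R₀ (n !) ⊗ schurExpansion n
  polynomialCauchy n = ι-injective (begin
    φ (CycleSums.cycleSum R₀ powerSums n (CycleSums.ones R₀ n))
      ≈⟨ φ-cycleSum powerSums n _ ⟩
    CycleSums.cycleSum F (φ ∘ powerSums) n (CycleSums.ones F n)
      ≈⟨ CycleSumCongruence.cycleSum-cong F sums n (CycleSums.ones F n) ⟩
    CycleSums.cycleSum F (K.kernelPowerSum (allFin N) (allFin M)) n (CycleSums.ones F n)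
      ≈⟨ K.cycleSum-kernel (allFin N) (allFin M) n ⟩
    ΣF.fromℕ (n !) F.* K.cauchyKernel (allFin N) (allFin M) n
      ≈⟨ F.*-cong (F.sym (φ-fromℕ (n !))) expansion ⟩
    φ (Sums.fromℕ R₀ (n !)) F.* φ (schurExpansion n)
      ≈⟨ φ-* (Sums.fromℕ R₀ (n !)) (schurExpansion n) ⟨
    φ (Sums.fromℕ R₀ (n !) ⊗ schurExpansion n) ∎)
    where
    open import Relation.Binary.Reasoning.Setoid F.setoid
    sums : ∀ n → φ (powerSums n) F.≈ K.kernelPowerSum (allFin N) (allFin M) n
    sums n = begin
      φ (powerSums n)
        ≈⟨ φ-* (LogarithmicDerivative.oddTwo R₀ n) _ ⟩
      φ (LogarithmicDerivative.oddTwo R₀ n) F.* φ (Sums.ΣL R₀ (allFin M) (λ b → Sums.ΣL R₀ (allFin N) (λ a → Sums._^_ R₀ (var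
          (x₀ a) ⊗ var (y₀ b)) n)))
        ≈⟨ F.*-cong (φ-oddTwo n)
             (F.trans (φ-ΣL (allFin M) _) (ΣF.ΣL-cong (allFin M) λ b → F.trans (φ-ΣL (allFin N) _) (ΣF.ΣL-cong (allFin N) λ a →
               F.trans (φ-^ (var (x₀ a) ⊗ var (y₀ b)) n) (ΣF.^-cong n (φ-* (var (x₀ a)) (var (y₀ b))))))) ⟩
      K.kernelPowerSum (allFin N) (allFin M) n ∎
    expansion : K.cauchyKernel (allFin N) (allFin M) n F.≈ φ (schurExpansion n)
    expansion = begin
      K.cauchyKernel (allFin N) (allFin M) n
        ≈⟨ Cauchy.cauchy (φ (con ½)) ½+½ coefficient φ-1 coefficient-suc n (allFin N) (allFin M) (Unique.allFin⁺ N)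
            (Unique.allFin⁺ M) ⟩
      ΣF.ΣL (strictPartitions n) (λ μ → Cauchy.two^ μ F.* (Cauchy.G μ (allFin N) F.* Cauchy.H μ (allFin M)))
        ≈⟨ ΣF.ΣL-congᴬ (strictPartitions-strict n) (λ μ st → F.sym (F.trans (φ-* _ _) (F.*-cong
             (F.trans (φ-^ _ (length μ)) (ΣF.^-cong (length μ) (F.trans (φ-+ (con 1ℚ) (con 1ℚ)) (F.+-cong φ-1 φ-1))))
             (F.trans (φ-* _ _) (F.*-cong (XValue.schurP-rowSum μ st) (YValue.schurP-rowSum μ st)))))) ⟩
      ΣF.ΣL (strictPartitions n) (λ μ → φ (Sums._^_ R₀ (con 1ℚ ⊕ con 1ℚ) (length μ) ⊗ (embedX (schurP μ N) ⊗ embedY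
          (schurP μ M))))
        ≈⟨ φ-ΣL (strictPartitions n) _ ⟨
      φ (schurExpansion n) ∎

module FractionDifferences (V : ℕ) where
  private
    R₀ = polyRing (Fin V)
    module Fr = Fractions R₀
    F = Fr.fractionRing
    module F = CommutativeRing F
  open Fr using (ι; ι-+; inverse; *-inverse)
  open IntegerCoefficients R₀

  -- 0 on the diagonal keeps the family antisymmetric.
  differenceInverse : ∀ v₁ v₂ → Fr.Fraction
  differenceInverse v₁ v₂ with v₁ Fin.≟ v₂
  ... | yes _ = F.0#
  ... | no ne = inverse (var v₁ ⊖ var v₂) (difference-regular v₁ v₂ ne)

  differenceInverse-anti : ∀ v₁ v₂ → differenceInverse v₁ v₂ F.≈ F.- differenceInverse v₂ v₁
  differenceInverse-anti v₁ v₂ with v₁ Fin.≟ v₂ | v₂ Fin.≟ v₁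
  ... | yes _ | yes _ = solve 0 (:0 :* :1 := (:- :0) :* :1) ≈-refl
  ... | yes e | no ne = contradiction (≡.sym e) ne
  ... | no ne | yes e = contradiction (≡.sym e) ne
  ... | no _  | no _  = solve 2 (λ a b → :1 :* (b :- a) := (:- :1) :* (a :- b)) ≈-refl (var v₁) (var v₂)

  differenceInverse-inverse : ∀ v₁ v₂ → v₁ ≢ v₂ → (ι (var v₁) F.- ι (var v₂)) F.* differenceInverse v₁ v₂ F.≈ F.1#
  differenceInverse-inverse v₁ v₂ ne with v₁ Fin.≟ v₂
  ... | yes e  = contradiction e ne
  ... | no ne′ = F.trans {(ι (var v₁) F.- ι (var v₂)) F.* d} {ι (var v₁ ⊖ var v₂) F.* d} {F.1#}
    (F.*-congʳ {d} {ι (var v₁) F.- ι (var v₂)} {ι (var v₁ ⊖ var v₂)} (F.sym {ι (var v₁ ⊖ var v₂)} {ι (var v₁) F.- ι (var v₂)} (ι-+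
        (var v₁) (⊝ var v₂))))
    (*-inverse (var v₁ ⊖ var v₂) (difference-regular v₁ v₂ ne′))
    where d = inverse (var v₁ ⊖ var v₂) (difference-regular v₁ v₂ ne′)

  toFractions : Homomorphism R₀ F
  toFractions = record
    { φ = Fr.ι ; φ-cong = Fr.ι-cong ; φ-+ = ι-+ ; φ-* = Fr.ι-*
    ; φ-neg = λ f → F.refl {ι (⊝ f)} ; φ-0 = F.refl {F.0#} ; φ-1 = F.refl {F.1#} }

  differences : InvertibleDifferences F (λ v → ι (var v))
  differences = record
    { inverse = differenceInverse ; inverse-anti = differenceInverse-anti
    ; *-inverse = λ {v₁} {v₂} → differenceInverse-inverse v₁ v₂ }

module Expansion (N M : ℕ) where
  private
    R₀ = polyRing (Fin (N ℕ.+ M))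
  open FractionDifferences (N ℕ.+ M)
  open PolynomialCauchy N M toFractions (Fractions.ι-injective R₀) differences public
    using (powerSums; schurExpansion; embedX; embedY; x₀; y₀; polynomialCauchy)

module _ {X : Set} where
  subst-var : ∀ (f : Poly X) → subst var f ≡ f
  subst-var (con c) = ≡.refl
  subst-var (var x) = ≡.refl
  subst-var (f ⊕ g) = ≡.cong₂ _⊕_ (subst-var f) (subst-var g)
  subst-var (f ⊗ g) = ≡.cong₂ _⊗_ (subst-var f) (subst-var g)

  subst-con : ∀ {Y : Set} (ρ : X → ℚ) (f : Poly X) → subst {Y = Y} (con ∘ ρ) f ≈ con (evalℚ ρ f)
  subst-con ρ (con c) = ≈-refl
  subst-con ρ (var x) = ≈-refl
  subst-con ρ (f ⊕ g) = ≈-trans (⊕-cong (subst-con ρ f) (subst-con ρ g)) (≈-sym (con-⊕ _ _))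
  subst-con ρ (f ⊗ g) = ≈-trans (⊗-cong (subst-con ρ f) (subst-con ρ g)) (≈-sym (con-⊗ _ _))

-- Specialisation of the y's and the parking characteristic

module Specialisation (N n : ℕ) where
  private
    M = suc n
    R₀ = polyRing (Fin (N ℕ.+ M))
    R = polyRing (Fin N)
    module Σ₀ = Sums R₀
  open Expansion N M
  open Sums R
  open CycleSums R using (cycleSum; ones)
  open LogarithmicDerivative R using (oddTwo)
  open PolyRing {Fin N} using (reflexive; *-identityʳ)
  open IntegerCoefficients R
  open import Relation.Binary.Reasoning.Setoid (PolyRing.setoid {Fin N})

  oddPowerSum : ℕ → Poly (Fin N)
  oddPowerSum j = oddTwo j ⊗ ΣL (allFin N) (λ a → var a ^ j)

  private
    -- All y's become 1, which annihilates their differences; hence the map is applied to the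
    -- polynomial identity and not to fractions.
    τ : Fin (N ℕ.+ M) → Poly (Fin N)
    τ v = [ var , const (con 1ℚ) ]′ (splitAt N v)

    τ-x : ∀ a → τ (x₀ a) ≡ var a
    τ-x a = ≡.cong [ var , const (con 1ℚ) ]′ (Fin.splitAt-↑ˡ N a M)

    τ-y : ∀ b → τ (y₀ b) ≡ con 1ℚ
    τ-y b = ≡.cong [ var , const (con 1ℚ) ]′ (Fin.splitAt-↑ʳ N M b)

    module Φ = RingMap (substitution τ)
    module Ψ = CycleSumMap (substitution τ)

    τ-embedX : ∀ f → subst τ (embedX f) ≈ f
    τ-embedX f = ≈-trans (reflexive (subst-subst τ (var ∘ x₀) f))
      (≈-trans (subst-cong-var (λ a → reflexive (τ-x a)) f) (reflexive (subst-var f)))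

    τ-embedY : ∀ f → subst τ (embedY f) ≈ con (evalℚ (const 1ℚ) f)
    τ-embedY f = ≈-trans (reflexive (subst-subst τ (var ∘ y₀) f))
      (≈-trans (subst-cong-var (λ b → reflexive (τ-y b)) f) (subst-con (const 1ℚ) f))

    ΣL-constant : ∀ {A : Set} (as : List A) (f : Poly (Fin N)) → ΣL as (λ _ → f) ≈ fromℕ (length as) ⊗ f
    ΣL-constant []       f = ≈-sym (⊗-zeroˡ f)
    ΣL-constant (a ∷ as) f = ≈-trans (⊕-cong ≈-refl (ΣL-constant as f))
      (solve 2 (λ f m → f :+ m :* f := (:1 :+ m) :* f) ≈-refl f (fromℕ (length as)))

    τ-powerSums : ∀ j → subst τ (powerSums j) ≈ fromℕ (suc n) ⊗ oddPowerSum j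
    τ-powerSums j = begin
      subst τ (powerSums j)
        ≈⟨ ⊗-cong (Ψ.φ-oddTwo j) (≈-trans (Φ.φ-ΣL (allFin M) _) (ΣL-cong (allFin M) λ b → ≈-trans (Φ.φ-ΣL (allFin N) _) (ΣL-cong
            (allFin N) λ a →
             ≈-trans (Φ.φ-^ (var (x₀ a) ⊗ var (y₀ b)) j) (^-cong j (≈-trans (⊗-cong (reflexive (τ-x a)) (reflexive (τ-y b)))
                 (*-identityʳ _)))))) ⟩
      oddTwo j ⊗ ΣL (allFin M) (λ _ → ΣL (allFin N) (λ a → var a ^ j))
        ≈⟨ ⊗-cong ≈-refl (ΣL-constant (allFin M) _) ⟩
      oddTwo j ⊗ (fromℕ (length (allFin M)) ⊗ ΣL (allFin N) (λ a → var a ^ j))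
        ≈⟨ ≈-trans (≈-sym (⊗-assoc _ _ _)) (≈-trans (⊗-cong (⊗-comm _ _) ≈-refl) (⊗-assoc _ _ _)) ⟩
      fromℕ (length (allFin M)) ⊗ oddPowerSum j
        ≈⟨ ⊗-cong (reflexive (≡.cong fromℕ (List.length-tabulate {n = M} id))) ≈-refl ⟩
      fromℕ (suc n) ⊗ oddPowerSum j ∎

  cycleSum-schurP : cycleSum (λ j → fromℕ (suc n) ⊗ oddPowerSum j) n (ones n) ≈
    fromℕ (n !) ⊗ ΣL (strictPartitions n) (λ μ → (con 1ℚ ⊕ con 1ℚ) ^ length μ ⊗ (schurP μ N ⊗ con (schurP μ at1^ suc n)))
  cycleSum-schurP = begin
    cycleSum (λ j → fromℕ (suc n) ⊗ oddPowerSum j) n (ones n)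
      ≈⟨ CycleSumCongruence.cycleSum-cong R τ-powerSums n (ones n) ⟨
    cycleSum (subst τ ∘ powerSums) n (ones n)
      ≈⟨ Ψ.φ-cycleSum powerSums n (ones n) ⟨
    subst τ (CycleSums.cycleSum R₀ powerSums n (CycleSums.ones R₀ n))
      ≈⟨ subst-cong τ (polynomialCauchy n) ⟩
    subst τ (Σ₀.fromℕ (n !)) ⊗ subst τ (schurExpansion n)
      ≈⟨ ⊗-cong (Ψ.φ-fromℕ (n !)) (≈-trans (Φ.φ-ΣL (strictPartitions n) _) (ΣL-cong (strictPartitions n) λ μ →
           ⊗-cong (Φ.φ-^ (con 1ℚ ⊕ con 1ℚ) (length μ)) (⊗-cong (τ-embedX (schurP μ N)) (τ-embedY (schurP μ M))))) ⟩
    fromℕ (n !) ⊗ ΣL (strictPartitions n) (λ μ → (con 1ℚ ⊕ con 1ℚ) ^ length μ ⊗ (schurP μ N ⊗ con (schurP μ at1^ suc n))) ∎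

module Shiftification (N n : ℕ) where
  private
    R = polyRing (Fin N)
  open Sums R
  open CycleSums R using (cycleSum; ones)
  open LogarithmicDerivative R using (oddTwo)
  open ClassProducts R using (cycleProduct; cycleProduct-cycleType)
  open PermutationSums R using (cycleSum-permutations)
  open PollakSum R n using (parkingFixed; fixedParking?)
  open Specialisation N n
  open PolyRing {Fin N} using (reflexive)
  open IntegerCoefficients R
  open import Relation.Binary.Reasoning.Setoid (PolyRing.setoid {Fin N})

  value : PowerSumPoly → Poly (Fin N)
  value f = toSymFun (shiftify f) N

  private
    valuation : Homomorphism (polyRing ℕ) R
    valuation = record
      { φ = value ; φ-cong = λ e → subst-cong _ (subst-cong _ e) ; φ-+ = λ _ _ → ≈-refl ; φ-* = λ _ _ → ≈-refl
      ; φ-neg = λ _ → ≈-refl ; φ-0 = ≈-refl ; φ-1 = ≈-refl }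

    module Φ = RingMap valuation

    -- `oddTwo` and `parity` obey the same two-step recursion. The parity enters through an equation
    -- so that the case distinction in `value-p`, on which the image under `shiftify` depends, can
    -- supply it.
    oddTwo-parity : ∀ j → (∀ {x} → ℕ.parity j ≡ x → x ≡ 1ℙ → oddTwo j ≈ con (ℤ.+ 2 / 1)) ×
        (∀ {x} → ℕ.parity j ≡ x → x ≡ 0ℙ → oddTwo j ≈ con 0ℚ)
    oddTwo-parity zero          = (λ { ≡.refl () }) , λ _ _ → ≈-refl
    oddTwo-parity (suc zero)    = (λ _ _ → ≈-sym (con-⊕ 1ℚ 1ℚ)) , λ { ≡.refl () }
    oddTwo-parity (suc (suc j)) = oddTwo-parity j

    powerSum : ∀ j → ΣL (allFin N) (λ a → var a ^^ suc j) ≈ ΣL (allFin N) (λ a → var a ^ suc j)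
    powerSum j = ΣL-cong (allFin N) λ a → reflexive (^^≡^ (var a) (suc j))

  value-p : ∀ j → value (p (suc j)) ≈ oddPowerSum (suc j)
  value-p j with ℕ.parity (suc j) in eq
  ... | 1ℙ = ⊗-cong (≈-sym (proj₁ (oddTwo-parity (suc j)) eq ≡.refl)) (powerSum j)
  ... | 0ℙ = ≈-trans (≈-sym (⊗-zeroˡ _)) (⊗-cong (≈-sym (proj₂ (oddTwo-parity (suc j)) eq ≡.refl)) ≈-refl)

  private
    Q : Poly (Fin N)
    Q = fromℕ (suc n)

    n!⁻¹ : ℚ
    n!⁻¹ = ((ℤ.+ 1) / (n !)) {{n ℕ.!≢0}}

    -- The factor n + 1 turns the character value into (n + 1)^c(w), which is then distributed as
    -- one factor n + 1 per cycle.
    cycleTerm : ∀ w → Q ⊗ (con (parkingCharacter w) ⊗ ΠL (cycleType w) (value ∘ p)) ≈ cycleProduct (λ j → Q ⊗ value (p j)) w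
        (ones n)
    cycleTerm w = begin
      Q ⊗ (con (parkingCharacter w) ⊗ ΠL (cycleType w) (value ∘ p))
        ≈⟨ ≈-trans (≈-sym (⊗-assoc _ _ _)) (⊗-cong (≈-trans (⊗-cong ≈-refl (con-fromℕ (length (filter (fixedParking? w)
            (parkingFunctions n))))) (parkingFixed w (ones n))) ≈-refl) ⟩
      cycleProduct (const Q) w (ones n) ⊗ ΠL (cycleType w) (value ∘ p)
        ≈⟨ ⊗-cong (≈-sym (cycleProduct-cycleType (const Q) w)) ≈-refl ⟩
      ΠL (cycleType w) (const Q) ⊗ ΠL (cycleType w) (value ∘ p)
        ≈⟨ ΠL-* (cycleType w) (const Q) (value ∘ p) ⟨
      ΠL (cycleType w) (λ j → Q ⊗ value (p j))
        ≈⟨ cycleProduct-cycleType (λ j → Q ⊗ value (p j)) w ⟩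
      cycleProduct (λ j → Q ⊗ value (p j)) w (ones n) ∎

    schurSum : Poly (Fin N)
    schurSum = ΣL (strictPartitions n) (λ μ → (con 1ℚ ⊕ con 1ℚ) ^ length μ ⊗ (schurP μ N ⊗ con (schurP μ at1^ suc n)))

    con-inverse : ∀ m .{{_ : ℕ.NonZero m}} f → con ((ℤ.+ 1) / m) ⊗ (fromℕ m ⊗ f) ≈ f
    con-inverse m f = ≈-trans (≈-sym (⊗-assoc _ _ _)) (≈-trans (⊗-cong (≈-trans (⊗-cong ≈-refl (≈-sym (con-fromℕ m)))
      (≈-trans (≈-sym (con-⊗ _ _)) (reflexive (≡.cong con (/-inverse m))))) ≈-refl) (⊗-identityˡ f))

  Q⊗SH : Q ⊗ SH n N ≈ schurSum
  Q⊗SH = begin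
    Q ⊗ SH n N
      ≈⟨ ⊗-cong ≈-refl (⊗-cong ≈-refl (≈-trans (Φ.φ-ΣL (permutations n) _)
           (ΣL-cong (permutations n) λ w → ⊗-cong ≈-refl (Φ.φ-ΠL (cycleType w) p)))) ⟩
    Q ⊗ (con n!⁻¹ ⊗ ΣL (permutations n) (λ w → con (parkingCharacter w) ⊗ ΠL (cycleType w) (value ∘ p)))
      ≈⟨ ≈-trans (solve 3 (λ q t s → q :* (t :* s) := t :* (q :* s)) ≈-refl Q (con n!⁻¹) _) (⊗-cong ≈-refl (ΣL-*ˡ Q
          (permutations n) _)) ⟩
    con n!⁻¹ ⊗ ΣL (permutations n) (λ w → Q ⊗ (con (parkingCharacter w) ⊗ ΠL (cycleType w) (value ∘ p)))
      ≈⟨ ⊗-cong ≈-refl (≈-trans (ΣL-cong (permutations n) cycleTerm) (cycleSum-permutations (λ j → Q ⊗ value (p j)) n (ones n))) ⟩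
    con n!⁻¹ ⊗ cycleSum (λ j → Q ⊗ value (p j)) n (ones n)
      ≈⟨ ⊗-cong ≈-refl (PositiveWeights.cycleSum-cong⁺ R (λ j → ⊗-cong ≈-refl (value-p j)) n (ones n)
          (PositiveWeights.ones-positive R n)) ⟩
    con n!⁻¹ ⊗ cycleSum (λ j → Q ⊗ oddPowerSum j) n (ones n)
      ≈⟨ ⊗-cong ≈-refl cycleSum-schurP ⟩
    con n!⁻¹ ⊗ (fromℕ (n !) ⊗ schurSum)
      ≈⟨ con-inverse (n !) {{n ℕ.!≢0}} schurSum ⟩
    schurSum ∎

  fromℕ-2^ : ∀ l → fromℕ (2 ℕ.^ l) ≈ (con 1ℚ ⊕ con 1ℚ) ^ l
  fromℕ-2^ zero    = solve 0 (:1 :+ :0 := :1) ≈-refl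
  fromℕ-2^ (suc l) = ≈-trans (fromℕ-* 2 (2 ℕ.^ l)) (⊗-cong (solve 0 (:1 :+ (:1 :+ :0) := :1 :+ :1) ≈-refl) (fromℕ-2^ l))

  shiftified-parking : SH n N ≈ con ((ℤ.+ 1) / suc n) ⊗ ΣL (strictPartitions n) (λ μ →
    con (((ℤ.+ (2 ℕ.^ length μ)) / 1) ℚ.* (schurP μ at1^ suc n)) ⊗ schurP μ N)
  shiftified-parking = begin
    SH n N
      ≈⟨ con-inverse (suc n) (SH n N) ⟨
    con ((ℤ.+ 1) / suc n) ⊗ (Q ⊗ SH n N)
      ≈⟨ ⊗-cong ≈-refl Q⊗SH ⟩
    con ((ℤ.+ 1) / suc n) ⊗ schurSum
      ≈⟨ ⊗-cong ≈-refl (ΣL-cong (strictPartitions n) λ μ → ≈-sym (≈-trans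
           (⊗-cong (≈-trans (con-⊗ _ _) (⊗-cong (≈-trans (con-fromℕ (2 ℕ.^ length μ)) (fromℕ-2^ (length μ))) ≈-refl)) ≈-refl)
           (≈-trans (⊗-assoc _ _ _) (⊗-cong ≈-refl (⊗-comm _ _))))) ⟩
    con ((ℤ.+ 1) / suc n) ⊗ ΣL (strictPartitions n) (λ μ → con (((ℤ.+ (2 ℕ.^ length μ)) / 1) ℚ.*
        (schurP μ at1^ suc n)) ⊗ schurP μ N) ∎

open import Data.Nat.Base using (ℕ; suc; _≤_; _^_)
open import Data.Integer.Base using (+_)
open import Data.List.Base using (length)
open import Data.Rational.Base using (_/_; _*_)

theorem2p4 : (n : ℕ) → 1 ≤ n →
    SH n ≈Λ ((+ 1 / suc n) • (∑Λ[ μ ∈ strictPartitions n ]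
    (((+ (2 ^ length μ) / 1) * (schurP μ at1^ suc n)) • schurP μ)))
theorem2p4 n _ N = Shiftification.shiftified-parking N n
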